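{- As $m\to\infty$, $$c_{2,m}=\Theta\left(\binom{m}{\lceil m/2\rceil}\right)=\Theta\left(\frac{2^m}{\sqrt m}\right),$$ where $c_{2,m}$ is the best possible randomized competitive ratio of the parametrized metrical service system problem that can be achieved on all $2$-level hierarchically separated trees with $m$ request types.
   Context: Parametrized metrical service system (MSS): given are a finite metric space $(X,d)$ and a fixed collection of $m$ non-empty subsets $K_1,\dots,K_m$ of $X$ (the request types), known to the algorithm in advance. An instance consists of an initial state $s_0\in X$ and a finite sequence of requests $\boldsymbol\rho=(\rho_1,\rho_2,\dots)$, each $\rho_t\in\{K_1,\dots,K_m\}$, revealed one at a time. On arrival of $\rho_t$, the algorithm must choose a state $s_t\in\rho_t$ without knowledge of future requests. The cost of a solution is $\sum_{t\ge1}d(s_{t-1},s_t)$. Let $\mathrm{cost}^*(\boldsymbol\rho)$ be the minimum cost of a feasible (offline) solution. A randomized online algorithm $\mathcal A$ has competitive ratio $c$ if there is a constant $\beta$, independent of the input sequence (but possibly depending on the metric space), such that $\mathbb E[\mathrm{cost}_{\mathcal A}(\boldsymbol\rho)]\le c\cdot \mathrm{cost}^*(\boldsymbol\rho)+\beta$ for every (fixed) input. Hierarchically separated tree (HST): a finite rooted edge-weighted tree in which all root-to-leaf paths have the same number of edges; the level of a node is the number of edges from it to any descendant leaf (leaves have level $0$); the edges between an internal node and all of its children have the same weight, which depends only on the level of the node. The points of the metric space are the leaves, with the tree path distance. It is a $k$-level HST if its root has level $k$. $c_{k,m}$ denotes the infimum of all $c$ such that for every $k$-level HST and every collection of $m$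 request types on it there is a randomized online algorithm with competitive ratio $c$. -}

module Defs where

open import Level using (0ℓ)
open import Algebra.Apartness.Bundles using (HeytingField)
open import Algebra.Bundles using (CommutativeRing; Semiring)
import Algebra.Definitions.RawSemiring as RawSemiringDefs
open import Data.Bool using (Bool; true)
open import Data.Fin using (Fin; _≟_)
open import Data.List using (List; []; _∷_)
open import Data.List.Relation.Binary.Pointwise using (Pointwise)
open import Data.Nat as ℕ using (ℕ; zero; suc; ⌈_/2⌉)
open import Data.Nat.Combinatorics using (_C_)
open import Data.Product using (Σ; ∃; ∃-syntax; _×_; _,_; proj₁)
open import Data.Sum using (_⊎_; inj₁; inj₂; [_,_]′)
open import Data.Unit using (⊤; tt)
open import Relation.Binary.Core using (Rel)
open import Relation.Binary.Structures using (IsStrictPartialOrder)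
open import Relation.Binary.PropositionalEquality using (_≡_; refl)
open import Relation.Nullary using (¬_; yes; no)

-- The real numbers, axiomatised as a Cauchy complete Archimedean ordered
-- field.  Classically such a structure is ℝ, up to isomorphism.  The order
-- is not assumed decidable, so constructive (e.g. Cauchy) reals are a model.
record RealNumbers : Set₁ where
  infix 4 _<_ _≤_
  field
    heytingField : HeytingField 0ℓ 0ℓ 0ℓ

  open HeytingField heytingField public
    renaming (Carrier to ℝ; refl to ≈-refl; sym to ≈-sym; trans to ≈-trans;
              zero to *-zero)

  commutativeRing : CommutativeRing 0ℓ 0ℓ
  commutativeRing = record { isCommutativeRing = isCommutativeRing }

  open CommutativeRing commutativeRing public
    using (semiring; ring)

  open RawSemiringDefs (Semiring.rawSemiring semiring) public
    using (sum) renaming (_×_ to _·_)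

  fromℕ : ℕ → ℝ
  fromℕ n = n · 1#

  field
    _<_                  : Rel ℝ 0ℓ
    isStrictPartialOrder : IsStrictPartialOrder _≈_ _<_
    <⇒#                  : ∀ {x y} → x < y → x # y
    #⇒<⊎>                : ∀ {x y} → x # y → x < y ⊎ y < x
    +-monoˡ-<            : ∀ {x y} z → x < y → x + z < y + z
    *-pos                : ∀ {x y} → 0# < x → 0# < y → 0# < x * y
    archimedean          : ∀ x → ∃[ n ] x < fromℕ n

    -- Every Cauchy sequence converges; swapping i and j in the hypothesis
    -- gives the bound on the absolute value.
    complete : ∀ (u : ℕ → ℝ) →
      (∀ k → ∃[ N ] ∀ i j → N ℕ.≤ i → N ℕ.≤ j →
        fromℕ (suc k) * (u i - u j) < 1#) →
      ∃[ l ] ∀ k → ∃[ N ] ∀ i → N ℕ.≤ i →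
        (fromℕ (suc k) * (u i - l) < 1#) × (fromℕ (suc k) * (l - u i) < 1#)

    -- Positive square roots exist by completeness; they are part of the
    -- structure only to avoid constructing them here.
    √        : ∀ {x} → 0# < x → ℝ
    √-pos    : ∀ {x} (x>0 : 0# < x) → 0# < √ x>0
    √-square : ∀ {x} (x>0 : 0# < x) → √ x>0 * √ x>0 ≈ x

  open IsStrictPartialOrder isStrictPartialOrder public
    using (<-resp-≈; <-respˡ-≈; <-respʳ-≈)
    renaming (irrefl to <-irrefl; trans to <-trans)

  _≤_ : Rel ℝ 0ℓ
  x ≤ y = ¬ (y < x)

  open import Algebra.Properties.Ring ring
    using (-‿distribˡ-*; -‿involutive; -0#≈0#)

  x-0≈x : ∀ x → x - 0# ≈ x
  x-0≈x x = ≈-trans (+-congˡ -0#≈0#) (+-identityʳ x)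

  -- The field axiom inverts x - 0#, which equals x.
  recip : ∀ {x} → 0# < x → ℝ
  recip x>0 = proj₁ (#⇒invertible (#-sym (<⇒# x>0)))

  recip-inverseʳ : ∀ {x} (x>0 : 0# < x) → x * recip x>0 ≈ 1#
  recip-inverseʳ {x} x>0 with #⇒invertible (#-sym (<⇒# x>0))
  ... | y , _ , x-0*y≈1 = ≈-trans (*-congʳ (≈-sym (x-0≈x x))) x-0*y≈1

  0<1 : 0# < 1#
  0<1 = [ negative , (λ p → p) ]′ (#⇒<⊎> 1#0)
    where
    1#0 : 1# # 0#
    1#0 = invertible⇒#
      (1# , ≈-trans (*-identityˡ _) (x-0≈x 1#)
          , ≈-trans (*-identityʳ _) (x-0≈x 1#))

    negative : 1# < 0# → 0# < 1#
    negative 1<0 = <-respʳ-≈ [-1]²≈1 (*-pos 0<-1 0<-1)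
      where
      0<-1 : 0# < - 1#
      0<-1 = <-respˡ-≈ (-‿inverseʳ 1#)
        (<-respʳ-≈ (+-identityˡ (- 1#)) (+-monoˡ-< (- 1#) 1<0))

      [-1]²≈1 : - 1# * - 1# ≈ 1#
      [-1]²≈1 = ≈-trans (≈-sym (-‿distribˡ-* 1# (- 1#)))
        (≈-trans (-‿cong (*-identityˡ (- 1#))) (-‿involutive 1#))

  fromℕ-pos : ∀ n → 0# < fromℕ (suc n)
  fromℕ-pos zero    = <-respʳ-≈ (≈-sym (+-identityʳ 1#)) 0<1
  fromℕ-pos (suc n) = <-trans (fromℕ-pos n)
    (<-respˡ-≈ (+-identityˡ _) (+-monoˡ-< (fromℕ (suc n)) 0<1))

module _ (R : RealNumbers) where
  open RealNumbers R

  -- The set S need not contain its infimum, and the infimum of a set of reals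
  -- need not exist constructively, so comparisons with inf S are spelled out.
  -- The second one entails that S is non-empty, i.e. that inf S is not +∞.
  _≤inf_ : ℝ → (ℝ → Set) → Set
  x ≤inf S = ∀ {c} → S c → x ≤ c

  inf_≤_ : (ℝ → Set) → ℝ → Set
  inf S ≤ x = ∀ {y} → x < y → ∃[ c ] S c × c < y

  -- inf (S m) = Θ(f m) as m → ∞.
  Inf_=Θ_ : (ℕ → ℝ → Set) → (ℕ → ℝ) → Set
  Inf S =Θ f = ∃[ a ] ∃[ b ] ∃[ m₀ ] 0# < a × 0# < b ×
    (∀ m → m₀ ℕ.≤ m → (a * f m) ≤inf S m × (inf S m ≤ (b * f m)))

-- Rooted trees in which every root-to-leaf path has exactly k edges.
data Tree : ℕ → Set where
  leaf : Tree 0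
  node : ∀ {k} n → (Fin (suc n) → Tree k) → Tree (suc k)

Leaf : ∀ {k} → Tree k → Set
Leaf leaf       = ⊤
Leaf (node n t) = Σ (Fin (suc n)) λ i → Leaf (t i)

module _ (R : RealNumbers) where
  open RealNumbers R

  record HST (k : ℕ) : Set where
    field
      tree       : Tree k
      -- weight ℓ is the weight of the edges between a node of level suc ℓ and
      -- its children; only the weights with ℓ < k matter.
      weight     : ℕ → ℝ
      weight-pos : ∀ ℓ → 0# < weight ℓ

    Point : Set
    Point = Leaf tree

  module _ (weight : ℕ → ℝ) where

    -- The length of the path from a node of level k down to a leaf.
    height : ℕ → ℝ
    height zero    = 0#
    height (suc k) = height k + weight k

    pathDistance : ∀ {k} (t : Tree k) → Leaf t → Leaf t → ℝ
    pathDistance leaf _ _ = 0#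
    pathDistance {suc k} (node n t) (i , x) (j , y) with i ≟ j
    ... | yes refl = pathDistance (t i) x y
    ... | no  _    = height (suc k) + height (suc k)

  sumLeaves : ∀ {k} (t : Tree k) → (Leaf t → ℝ) → ℝ
  sumLeaves leaf       f = f tt
  sumLeaves (node n t) f = sum λ i → sumLeaves (t i) λ x → f (i , x)

  module _ {k : ℕ} (H : HST k) where
    open HST H

    d : Point → Point → ℝ
    d = pathDistance weight tree

    record RequestTypes (m : ℕ) : Set where
      field
        member   : Fin m → Point → Bool
        nonEmpty : ∀ r → ∃[ x ] member r x ≡ true

    solutionCost : Point → List Point → ℝ
    solutionCost s₀ []       = 0#
    solutionCost s₀ (s ∷ ss) = d s₀ s + solutionCost s ss

    module _ {m : ℕ} (K : RequestTypes m) where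
      open RequestTypes K

      Feasible : List (Fin m) → List Point → Set
      Feasible = Pointwise λ r s → member r s ≡ true

      IsOptimalCost : Point → List (Fin m) → ℝ → Set
      IsOptimalCost s₀ ρ v =
        (∃[ σ ] Feasible ρ σ × solutionCost s₀ σ ≈ v) ×
        (∀ σ → Feasible ρ σ → v ≤ solutionCost s₀ σ)

      record Distribution (r : Fin m) : Set where
        field
          prob        : Point → ℝ
          nonNegative : ∀ x → 0# ≤ prob x
          total       : sumLeaves tree prob ≈ 1#
          supported   : ∀ x → ¬ (member r x ≡ true) → prob x ≈ 0#

      -- The requests served so far with the states chosen for them, most
      -- recent first.
      History : Set
      History = List (Fin m × Point)

      -- A behavioural strategy: the conditional law of the next state given
      -- the initial state, the history and the current request.  Because the
      -- history records the algorithm's own choices, this is as general as a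
      -- random choice among deterministic online algorithms.
      Algorithm : Set
      Algorithm = Point → History → (r : Fin m) → Distribution r

      -- The expected cost of serving the remaining requests from the current
      -- state s, conditional on the history.
      expectedCostFrom : Algorithm → Point → History → Point → List (Fin m) → ℝ
      expectedCostFrom A s₀ h s []      = 0#
      expectedCostFrom A s₀ h s (r ∷ ρ) = sumLeaves tree λ x →
        Distribution.prob (A s₀ h r) x *
          (d s x + expectedCostFrom A s₀ ((r , x) ∷ h) x ρ)

      expectedCost : Algorithm → Point → List (Fin m) → ℝ
      expectedCost A s₀ ρ = expectedCostFrom A s₀ [] s₀ ρ

      HasCompetitiveRatio : Algorithm → ℝ → Set
      HasCompetitiveRatio A c = ∃[ β ] ∀ s₀ ρ v →
        IsOptimalCost s₀ ρ v → expectedCost A s₀ ρ ≤ c * v + β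

  -- The set of ratios whose infimum is c_{k,m}.
  Ratios : ℕ → ℕ → ℝ → Set
  Ratios k m c = (H : HST k) (K : RequestTypes H m) →
    ∃[ A ] HasCompetitiveRatio H K A c

  centralBinomial : ℕ → ℝ
  centralBinomial m = fromℕ (m C ⌈ m /2⌉)

  -- 2^m / √m; the value at 0 is a dummy.
  2^m/√m : ℕ → ℝ
  2^m/√m zero      = 0#
  2^m/√m m@(suc n) = fromℕ (2 ℕ.^ m) * recip (√-pos (fromℕ-pos n))

{-# OPTIONS --safe #-}

-- Lower bound.  Let S₁, …, S_M be the middle layer of the subsets of m - 2
-- types, and give each b : {1, …, M} → Bool a subtree whose leaves lie in the
-- types of the sets Sᵢ, marked with b i.  An adversary who, for every i in turn,
-- insists on Sᵢ with a random mark makes an online algorithm leave its subtree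
-- with probability 1/2 each time, while the subtree of the actual marks is
-- good for all M rounds.  By Yao's principle the ratio is Ω(M).
--
-- Upper bound.  What matters about a subtree is the family of sets of types
-- having a common leaf in it.  By Hansel's theorem there are at most 3 ^ N
-- such families, N the central binomial coefficient.  The algorithm keeps one
-- subtree per family, and its state distributed proportionally to weights that
-- shrink geometrically as the subtree incurs cost.  Moving an amount Δ of
-- weight costs in proportion to Δ over the total weight, hence logarithmically
-- in 3 ^ N * 2 ^ O(m) until all weights vanish; by then the offline player has
-- paid the diameter, and the weights are reset.
module Submission where

open import Algebra.Apartness.Bundles using (HeytingField)
open import Algebra.Bundles using (CommutativeRing)
open import Data.Bool using (Bool; true; false; if_then_else_; not)
import Data.Bool.Properties as Boolₚ
open import Data.Empty using (⊥-elim)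
open import Data.Fin as Fin using (Fin; zero; suc; splitAt; finToFun; funToFin)
import Data.Fin.Properties as Finₚ
open import Data.Fin.Subset using (Subset; ∣_∣)
import Data.Fin.Subset.Properties as Subsetₚ
open import Data.List as List using (List; []; _∷_; _++_)
open import Data.List.Membership.Propositional using (_∈_)
open import Data.List.Membership.Propositional.Properties
  using (∈-filter⁺; ∈-filter⁻; ∈-map⁺; ∈-map⁻; ∈-allFin; ∈-++⁻)
import Data.List.Properties as Listₚ
open import Data.List.Relation.Binary.Pointwise using ([]; _∷_)
open import Data.List.Relation.Unary.Any using (here; there)
open import Data.Nat as ℕ using (ℕ; zero; suc; z≤n; s≤s; ⌈_/2⌉; ⌊_/2⌋)
open import Data.Nat.Combinatorics using (_C_; nCk+nC[k+1]≡[n+1]C[k+1]; nCk≡nC[n∸k]; k>n⇒nCk≡0)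
open import Data.Nat.Induction using (<-rec)
import Data.Nat.Properties as ℕₚ
open import Data.Nat.Tactic.RingSolver using (solve-∀)
open import Data.Product using (Σ; ∃; ∃-syntax; _×_; _,_; proj₁; proj₂)
open import Data.Sum using (_⊎_; inj₁; inj₂; [_,_]′)
open import Data.Unit using (⊤; tt)
open import Data.Vec as Vec using ([]; _∷_; lookup; replicate; _[_]≔_)
import Data.Vec.Properties as Vecₚ
open import Function using (_∘_; id; case_of_)
open import Relation.Binary.Definitions using (tri<; tri≈; tri>)
open import Relation.Binary.PropositionalEquality as ≡ using (_≡_; _≢_; _≗_)
open import Relation.Nullary using (¬_; yes; no; Dec; does; _→-dec_)
open import Relation.Nullary.Decidable using (dec-true)
open import Defs

-- Let D be, up to a constant factor, the ratio of the two distances. A subtree can be made to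
-- change its leaf up to m D times before an offline player in it has paid about as much as for a
-- jump. With the state uniform over the surviving subtrees, every such local move would enter a
-- harmonic sum over all families, and this accounting loses a factor m. Instead each local move
-- shrinks the weight by a factor of at most 1 - 1 / (2 D): the weight lost then pays for the local
-- move of the weight that stays, while m D shrinkings cost a factor of only 2 ^ m, hence an
-- additive m in the logarithm, which N absorbs. In the lower bound a single pass over a set costs a
-- wrong subtree one short move only. The pass is therefore repeated until staying costs as much as
-- a jump. The upper edges have weight M so that the jump of the offline player and its M short
-- moves are of the same order. The order of the reals is not decidable. Weights, credits and forced
-- costs are therefore natural numbers, and a harmonic sum replaces the logarithm.

-- Order and arithmetic of constructive reals

module Ordered (R : RealNumbers) where
  open RealNumbers R public
  open import Algebra.Solver.Ring.NaturalCoefficients.Default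
    (CommutativeRing.commutativeSemiring commutativeRing) public
    using (solve; _:=_; _:+_; _:*_; con)
  open import Algebra.Properties.Semiring.Sum semiring public
    using (sum-cong-≋; ∑-distrib-+; sum-replicate-zero; *-distribˡ-sum)
  open import Algebra.Properties.Semiring.Mult semiring public
    using (×1-homo-*; ×-homo-+)

  -- The order is not decidable; this is the case distinction that remains, inherited from the
  -- cotransitivity of apartness.
  cotrans : ∀ {x y} → x < y → ∀ z → x < z ⊎ z < y
  cotrans x<y z with #-cotrans (<⇒# x<y) z
  ... | inj₁ x#z with #⇒<⊎> x#z
  ...   | inj₁ x<z = inj₁ x<z
  ...   | inj₂ z<x = inj₂ (<-trans z<x x<y)
  cotrans x<y z | inj₂ z#y with #⇒<⊎> z#y
  ...   | inj₁ z<y = inj₂ z<y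
  ...   | inj₂ y<z = inj₁ (<-trans x<y y<z)

  ≤-refl : ∀ {x} → x ≤ x
  ≤-refl = <-irrefl ≈-refl

  ≤-reflexive : ∀ {x y} → x ≈ y → x ≤ y
  ≤-reflexive x≈y y<x = <-irrefl (≈-sym x≈y) y<x

  ≤-trans : ∀ {x y z} → x ≤ y → y ≤ z → x ≤ z
  ≤-trans {x} {y} x≤y y≤z z<x = [ y≤z , x≤y ]′ (cotrans z<x y)

  <⇒≤ : ∀ {x y} → x < y → x ≤ y
  <⇒≤ x<y y<x = <-irrefl ≈-refl (<-trans x<y y<x)

  <-≤-trans : ∀ {x y z} → x < y → y ≤ z → x < z
  <-≤-trans {z = z} x<y y≤z = [ id , (λ z<y → ⊥-elim (y≤z z<y)) ]′ (cotrans x<y z)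

  ≤-<-trans : ∀ {x y z} → x ≤ y → y < z → x < z
  ≤-<-trans {x} x≤y y<z = [ (λ y<x → ⊥-elim (x≤y y<x)) , id ]′ (cotrans y<z x)

  -- `≤` is a negation, hence stable. A proof of an inequality may thus use objects that exist only
  -- classically, such as an optimal solution in `yao`.
  ¬¬-≤ : ∀ {x y} → ¬ ¬ (x ≤ y) → x ≤ y
  ¬¬-≤ ¬¬x≤y y<x = ¬¬x≤y (λ x≤y → x≤y y<x)

  +-cancelʳ : ∀ x z → (x + z) - z ≈ x
  +-cancelʳ x z = ≈-trans (+-assoc x z (- z)) (≈-trans (+-congˡ (-‿inverseʳ z)) (+-identityʳ x))

  +-cancelʳ-< : ∀ {x y} z → x + z < y + z → x < y
  +-cancelʳ-< {x} {y} z p = <-respˡ-≈ (+-cancelʳ x z) (<-respʳ-≈ (+-cancelʳ y z) (+-monoˡ-< (- z) p))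

  +-monoˡ-≤ : ∀ {x y} z → x ≤ y → x + z ≤ y + z
  +-monoˡ-≤ z x≤y p = x≤y (+-cancelʳ-< z p)

  +-monoʳ-≤ : ∀ {x y} z → x ≤ y → z + x ≤ z + y
  +-monoʳ-≤ z x≤y = ≤-trans (≤-reflexive (+-comm z _))
    (≤-trans (+-monoˡ-≤ z x≤y) (≤-reflexive (+-comm _ z)))

  +-mono-≤ : ∀ {x y u v} → x ≤ y → u ≤ v → x + u ≤ y + v
  +-mono-≤ x≤y u≤v = ≤-trans (+-monoˡ-≤ _ x≤y) (+-monoʳ-≤ _ u≤v)

  +-cancelʳ-≤ : ∀ {x y} z → x + z ≤ y + z → x ≤ y
  +-cancelʳ-≤ z p y<x = p (+-monoˡ-< z y<x)

  0<y-x : ∀ {x y} → x < y → 0# < y - x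
  0<y-x {x} x<y = <-respˡ-≈ (-‿inverseʳ x) (+-monoˡ-< (- x) x<y)

  y≈y-x+x : ∀ x y → y ≈ (y - x) + x
  y≈y-x+x x y = ≈-sym (≈-trans (+-assoc y (- x) x) (≈-trans (+-congˡ (-‿inverseˡ x)) (+-identityʳ y)))

  *-monoʳ-< : ∀ {x y z} → 0# < z → x < y → z * x < z * y
  *-monoʳ-< {x} {y} {z} z>0 x<y =
    <-respʳ-≈ (≈-trans (≈-sym (distribˡ z (y - x) x)) (*-congˡ (≈-sym (y≈y-x+x x y))))
      (<-respˡ-≈ (+-identityˡ _) (+-monoˡ-< (z * x) (*-pos z>0 (0<y-x x<y))))

  recip-pos : ∀ {x} (x>0 : 0# < x) → 0# < recip x>0
  recip-pos {x} x>0 with #⇒<⊎> (invertible⇒# {recip x>0} {0#}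
        (x , ≈-trans (*-congˡ (x-0≈x _)) (recip-inverseʳ x>0)
           , ≈-trans (*-congʳ (x-0≈x _)) (≈-trans (*-comm _ _) (recip-inverseʳ x>0))))
  ... | inj₂ p = p
  ... | inj₁ p = ⊥-elim (<-irrefl ≈-refl (<-trans 0<1
          (<-respˡ-≈ (recip-inverseʳ x>0) (<-respʳ-≈ (zeroʳ x) (*-monoʳ-< x>0 p)))))

  *-cancelˡ-< : ∀ {x y z} → 0# < z → z * x < z * y → x < y
  *-cancelˡ-< {x} {y} {z} z>0 p = <-respˡ-≈ (undo x) (<-respʳ-≈ (undo y) (*-monoʳ-< (recip-pos z>0) p))
    where
    undo : ∀ u → recip z>0 * (z * u) ≈ u
    undo u = ≈-trans (≈-sym (*-assoc _ _ _))
      (≈-trans (*-congʳ (≈-trans (*-comm _ _) (recip-inverseʳ z>0))) (*-identityˡ u))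

  *-cancelˡ-≤ : ∀ {x y z} → 0# < z → z * x ≤ z * y → x ≤ y
  *-cancelˡ-≤ z>0 p y<x = p (*-monoʳ-< z>0 y<x)

  -- Were the inequality to fail, both cases would be refuted; but tightness turns a refutation of
  -- apartness from 0 into equality with 0.
  ≤-case : ∀ {z a b} → 0# ≤ z → (z ≈ 0# → a ≤ b) → (0# < z → a ≤ b) → a ≤ b
  ≤-case {z} z≥0 f g b<a = ¬z≈0 (proj₁ (HeytingField.tight heytingField z 0#) ¬z#0)
    where
    ¬z≈0 : ¬ (z ≈ 0#)
    ¬z≈0 p = f p b<a
    ¬z#0 : ¬ (z # 0#)
    ¬z#0 p = [ z≥0 , (λ q → g q b<a) ]′ (#⇒<⊎> p)

  *-monoʳ-≤ : ∀ {x y z} → 0# ≤ z → x ≤ y → z * x ≤ z * y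
  *-monoʳ-≤ {x} {y} {z} z≥0 x≤y = ≤-case z≥0
    (λ z≈0 → ≤-reflexive (≈-trans (≈-trans (*-congʳ z≈0) (zeroˡ x))
                (≈-sym (≈-trans (*-congʳ z≈0) (zeroˡ y)))))
    (λ z>0 p → x≤y (*-cancelˡ-< z>0 p))

  *-monoˡ-≤ : ∀ {x y z} → 0# ≤ z → x ≤ y → x * z ≤ y * z
  *-monoˡ-≤ z≥0 x≤y = ≤-trans (≤-reflexive (*-comm _ _))
    (≤-trans (*-monoʳ-≤ z≥0 x≤y) (≤-reflexive (*-comm _ _)))

  0≤* : ∀ {x y} → 0# ≤ x → 0# ≤ y → 0# ≤ x * y
  0≤* {x} x≥0 y≥0 = ≤-trans (≤-reflexive (≈-sym (zeroʳ x))) (*-monoʳ-≤ x≥0 y≥0)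

  0≤+ : ∀ {x y} → 0# ≤ x → 0# ≤ y → 0# ≤ x + y
  0≤+ x≥0 y≥0 = ≤-trans (≤-reflexive (≈-sym (+-identityʳ 0#))) (+-mono-≤ x≥0 y≥0)

  x≤x+y : ∀ {x y} → 0# ≤ y → x ≤ x + y
  x≤x+y {x} y≥0 = ≤-trans (≤-reflexive (≈-sym (+-identityʳ x))) (+-monoʳ-≤ x y≥0)

  square-cancel-≤ : ∀ {x y} → 0# ≤ y → x * x ≤ y * y → x ≤ y
  square-cancel-≤ y≥0 p y<x =
    p (≤-<-trans (*-monoʳ-≤ y≥0 (<⇒≤ y<x)) (<-respˡ-≈ (*-comm _ _) (*-monoʳ-< (≤-<-trans y≥0 y<x) y<x)))

  fromℕ-+ : ∀ m n → fromℕ (m ℕ.+ n) ≈ fromℕ m + fromℕ n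
  fromℕ-+ = ×-homo-+ 1#

  fromℕ-* : ∀ m n → fromℕ (m ℕ.* n) ≈ fromℕ m * fromℕ n
  fromℕ-* = ×1-homo-*

  fromℕ-nonneg : ∀ n → 0# ≤ fromℕ n
  fromℕ-nonneg zero    = ≤-refl
  fromℕ-nonneg (suc n) = <⇒≤ (fromℕ-pos n)

  fromℕ-cong : ∀ {m n} → m ≡ n → fromℕ m ≈ fromℕ n
  fromℕ-cong ≡.refl = ≈-refl

  fromℕ-1 : fromℕ 1 ≈ 1#
  fromℕ-1 = +-identityʳ 1#

  fromℕ-mono-≤ : ∀ {m n} → m ℕ.≤ n → fromℕ m ≤ fromℕ n
  fromℕ-mono-≤ {n = n} z≤n = fromℕ-nonneg n
  fromℕ-mono-≤ (s≤s m≤n)   = +-monoʳ-≤ 1# (fromℕ-mono-≤ m≤n)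

  fromℕ-mono-< : ∀ {m n} → m ℕ.< n → fromℕ m < fromℕ n
  fromℕ-mono-< {m} m<n = <-≤-trans
    (<-respˡ-≈ (+-identityˡ _) (+-monoˡ-< (fromℕ m) 0<1)) (fromℕ-mono-≤ m<n)

  sum-mono : ∀ {n} {f g : Fin n → ℝ} → (∀ i → f i ≤ g i) → sum f ≤ sum g
  sum-mono {zero}  f≤g = ≤-refl
  sum-mono {suc n} f≤g = +-mono-≤ (f≤g zero) (sum-mono (f≤g ∘ suc))

  sum-zero : ∀ {n} {f : Fin n → ℝ} → (∀ i → f i ≈ 0#) → sum f ≈ 0#
  sum-zero {n} f≈0 = ≈-trans (sum-cong-≋ f≈0) (sum-replicate-zero n)

  sum-nonneg : ∀ {n} {f : Fin n → ℝ} → (∀ i → 0# ≤ f i) → 0# ≤ sum f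
  sum-nonneg {n} f≥0 = ≤-trans (≤-reflexive (≈-sym (sum-replicate-zero n))) (sum-mono f≥0)

  sum-single : ∀ {n} (f : Fin n → ℝ) i → (∀ j → j ≢ i → f j ≈ 0#) → sum f ≈ f i
  sum-single f zero    p = ≈-trans (+-congˡ (sum-zero (λ j → p (suc j) λ ()))) (+-identityʳ _)
  sum-single f (suc i) p = ≈-trans (+-cong (p zero λ ())
    (sum-single (f ∘ suc) i λ j j≢i → p (suc j) λ { ≡.refl → j≢i ≡.refl })) (+-identityˡ _)

-- Growth of the central binomial coefficient

module Binomial where
  open import Data.Nat using (_+_; _*_; _^_; _≤_; _∸_)
  open ≡ using (refl; sym; trans; cong; cong₂; subst)
  open ℕₚ.≤-Reasoning

  central : ℕ → ℕ
  central m = m C ⌈ m /2⌉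

  -- Induction with Pascal's rule on both sides. Together with the symmetry in `central-even` it
  -- yields the ratios of consecutive central coefficients.
  absorption : ∀ n k → suc k * (suc n C suc k) ≡ suc n * (n C k)
  absorption zero zero = refl
  absorption zero (suc k) = trans (cong (suc (suc k) *_) (k>n⇒nCk≡0 {1} {suc (suc k)} (s≤s (s≤s z≤n))))
    (trans (ℕₚ.*-zeroʳ (suc (suc k))) (sym (cong (1 *_) (k>n⇒nCk≡0 {0} {suc k} (s≤s z≤n)))))
  absorption (suc n) zero = begin-equality
    1 * (suc (suc n) C 1)                      ≡⟨ cong (1 *_) (nCk+nC[k+1]≡[n+1]C[k+1] (suc n) 0) ⟨
    1 * (1 + suc n C 1)                        ≡⟨ split (suc n C 1) ⟩
    1 + 1 * (suc n C 1)                        ≡⟨ cong (1 +_) (absorption n 0) ⟩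
    suc (suc n) * 1                            ∎
    where
    split : ∀ x → 1 * (1 + x) ≡ 1 + 1 * x
    split = solve-∀
  absorption (suc n) (suc k) = begin-equality
    suc (suc k) * (suc (suc n) C suc (suc k))
      ≡⟨ cong (suc (suc k) *_) (nCk+nC[k+1]≡[n+1]C[k+1] (suc n) (suc k)) ⟨
    suc (suc k) * (x + suc n C suc (suc k))
      ≡⟨ split k x (suc n C suc (suc k)) ⟩
    x + (suc k * x + suc (suc k) * (suc n C suc (suc k)))
      ≡⟨ cong (x +_) (cong₂ _+_ (absorption n k) (absorption n (suc k))) ⟩
    x + (suc n * (n C k) + suc n * (n C suc k))
      ≡⟨ cong (x +_) (ℕₚ.*-distribˡ-+ (suc n) (n C k) (n C suc k)) ⟨
    x + suc n * (n C k + n C suc k)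
      ≡⟨ cong (λ y → x + suc n * y) (nCk+nC[k+1]≡[n+1]C[k+1] n k) ⟩
    suc (suc n) * x ∎
    where
    x = suc n C suc k
    split : ∀ k x y → suc (suc k) * (x + y) ≡ x + (suc k * x + suc (suc k) * y)
    split = solve-∀

  ⌈n*2/2⌉ : ∀ n → ⌈ n * 2 /2⌉ ≡ n
  ⌈n*2/2⌉ zero    = refl
  ⌈n*2/2⌉ (suc n) = cong suc (⌈n*2/2⌉ n)

  ⌊n*2/2⌋ : ∀ n → ⌊ n * 2 /2⌋ ≡ n
  ⌊n*2/2⌋ zero    = refl
  ⌊n*2/2⌋ (suc n) = cong suc (⌊n*2/2⌋ n)

  parity : ∀ m → ∃[ n ] (m ≡ n * 2 ⊎ m ≡ suc (n * 2))
  parity zero = 0 , inj₁ refl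
  parity (suc m) with parity m
  ... | n , inj₁ refl = n , inj₂ refl
  ... | n , inj₂ refl = suc n , inj₁ refl

  central-odd : ∀ n → suc n * central (suc (n * 2)) ≡ suc (n * 2) * central (n * 2)
  central-odd n rewrite ⌈n*2/2⌉ n | ⌊n*2/2⌋ n = absorption (n * 2) n

  central-even : ∀ n → central (suc n * 2) ≡ 2 * central (suc (n * 2))
  central-even n rewrite ⌈n*2/2⌉ n | ⌊n*2/2⌋ n = begin-equality
    suc (suc (n * 2)) C suc n                     ≡⟨ nCk+nC[k+1]≡[n+1]C[k+1] (suc (n * 2)) n ⟨
    suc (n * 2) C n + suc (n * 2) C suc n         ≡⟨ cong (_+ suc (n * 2) C suc n) symm ⟩
    suc (n * 2) C suc n + suc (n * 2) C suc n     ≡⟨ twice (suc (n * 2) C suc n) ⟩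
    2 * (suc (n * 2) C suc n)                     ∎
    where
    twice : ∀ x → x + x ≡ 2 * x
    twice = solve-∀
    1+n*2 : ∀ n → suc (n * 2) ≡ n + suc n
    1+n*2 = solve-∀
    symm : suc (n * 2) C n ≡ suc (n * 2) C suc n
    symm = trans (nCk≡nC[n∸k] (subst (n ≤_) (sym (1+n*2 n)) (ℕₚ.m≤m+n n (suc n))))
      (cong (suc (n * 2) C_) (trans (cong (_∸ n) (1+n*2 n)) (ℕₚ.m+n∸m≡n n (suc n))))

  central-suc-≤ : ∀ m → central (suc m) ≤ 2 * central m
  central-suc-≤ m with parity m
  ... | n , inj₁ refl = ℕₚ.*-cancelˡ-≤ (suc n) (begin
    suc n * central (suc (n * 2))      ≡⟨ central-odd n ⟩
    suc (n * 2) * central (n * 2)      ≤⟨ ℕₚ.*-monoˡ-≤ (central (n * 2)) (ℕₚ.n≤1+n (suc (n * 2))) ⟩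
    suc n * 2 * central (n * 2)        ≡⟨ ℕₚ.*-assoc (suc n) 2 (central (n * 2)) ⟩
    suc n * (2 * central (n * 2))      ∎)
  ... | n , inj₂ refl = ℕₚ.≤-reflexive (central-even n)

  central-mono-suc : ∀ m → central m ≤ central (suc m)
  central-mono-suc m with parity m
  ... | n , inj₁ refl = ℕₚ.*-cancelˡ-≤ (suc n) (begin
    suc n * central (n * 2)            ≤⟨ ℕₚ.*-monoˡ-≤ (central (n * 2)) (s≤s (ℕₚ.m≤m*n n 2)) ⟩
    suc (n * 2) * central (n * 2)      ≡⟨ central-odd n ⟨
    suc n * central (suc (n * 2))      ∎)
  ... | n , inj₂ refl = ℕₚ.≤-trans (ℕₚ.m≤m+n (central (suc (n * 2))) (1 * central (suc (n * 2)))) (ℕₚ.≤-reflexive (sym (central-even n)))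

  central-double : ∀ m → 2 * central m ≤ central (suc (suc m))
  central-double m with parity m
  ... | n , inj₁ refl = ℕₚ.≤-trans (ℕₚ.*-monoʳ-≤ 2 (central-mono-suc (n * 2)))
                          (ℕₚ.≤-reflexive (sym (central-even n)))
  ... | n , inj₂ refl = ℕₚ.≤-trans (ℕₚ.≤-reflexive (sym (central-even n))) (central-mono-suc (suc n * 2))

  central-pos : ∀ m → 1 ≤ central m
  central-pos zero    = s≤s z≤n
  central-pos (suc m) = ℕₚ.≤-trans (central-pos m) (central-mono-suc m)

  -- The coefficient doubles every two steps, which beats adding 2. This absorbs the additive `m` of
  -- the upper bound.
  m≤2*central : ∀ m → m ≤ 2 * central m
  m≤2*central zero = z≤n
  m≤2*central (suc zero) = s≤s z≤n
  m≤2*central (suc (suc m)) = begin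
    2 + m                              ≤⟨ ℕₚ.+-mono-≤ (ℕₚ.*-monoʳ-≤ 2 (central-pos m)) (m≤2*central m) ⟩
    2 * central m + 2 * central m      ≡⟨ twice (central m) ⟩
    2 * (2 * central m)                ≤⟨ ℕₚ.*-monoʳ-≤ 2 (central-double m) ⟩
    2 * central (suc (suc m))          ∎
    where
    twice : ∀ x → 2 * x + 2 * x ≡ 2 * (2 * x)
    twice = solve-∀

  even-step : ∀ n → suc n * suc n * (central (suc n * 2) * central (suc n * 2))
                    ≡ 4 * (suc (n * 2) * suc (n * 2)) * (central (n * 2) * central (n * 2))
  even-step n rewrite central-even n = begin-equality
    suc n * suc n * ((2 * y) * (2 * y))   ≡⟨ regroup (suc n) y ⟩
    4 * ((suc n * y) * (suc n * y))       ≡⟨ cong (λ z → 4 * (z * z)) (central-odd n) ⟩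
    4 * ((suc (n * 2) * x) * (suc (n * 2) * x))   ≡⟨ regroup′ (suc (n * 2)) x ⟩
    4 * (suc (n * 2) * suc (n * 2)) * (x * x)     ∎
    where
    x = central (n * 2)
    y = central (suc (n * 2))
    regroup : ∀ a y → a * a * ((2 * y) * (2 * y)) ≡ 4 * ((a * y) * (a * y))
    regroup = solve-∀
    regroup′ : ∀ a x → 4 * ((a * x) * (a * x)) ≡ 4 * (a * a) * (x * x)
    regroup′ = solve-∀

  -- Wallis-type induction. By `even-step` the left side grows by the factor 4 (2n + 1)(2n + 3) / (n
  -- + 1)², which is below 16 because (2n + 1)(2n + 3) = 4 (n + 1)² - 1.
  even-upper : ∀ n → central (n * 2) * central (n * 2) * suc (n * 2) ≤ 4 ^ (n * 2)
  even-upper zero    = s≤s z≤n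
  even-upper (suc n) = ℕₚ.*-cancelˡ-≤ (suc n * suc n) (begin
    a * (y * y * c₃)            ≡⟨ ℕₚ.*-assoc a (y * y) c₃ ⟨
    a * (y * y) * c₃            ≡⟨ cong (_* c₃) (even-step n) ⟩
    4 * (c * c) * (x * x) * c₃  ≡⟨ regroup c (x * x) c₃ ⟩
    4 * (c * c₃) * (x * x * c)  ≤⟨ ℕₚ.*-monoʳ-≤ (4 * (c * c₃)) (even-upper n) ⟩
    4 * (c * c₃) * P            ≤⟨ ℕₚ.*-monoˡ-≤ P poly ⟩
    16 * a * P                  ≡⟨ regroup′ a P ⟩
    a * (4 * (4 * P))           ∎)
    where
    a = suc n * suc n
    c = suc (n * 2)
    c₃ = suc (suc n * 2)
    x = central (n * 2)
    y = central (suc n * 2)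
    P = 4 ^ (n * 2)
    regroup : ∀ c x z → 4 * (c * c) * x * z ≡ 4 * (c * z) * (x * c)
    regroup = solve-∀
    regroup′ : ∀ a p → 16 * a * p ≡ a * (4 * (4 * p))
    regroup′ = solve-∀
    expand : ∀ n → 4 * (suc (n * 2) * suc (suc n * 2)) + 4 ≡ 16 * (suc n * suc n)
    expand = solve-∀
    poly : 4 * (c * c₃) ≤ 16 * a
    poly = ℕₚ.≤-trans (ℕₚ.m≤m+n _ 4) (ℕₚ.≤-reflexive (expand n))

  -- The companion induction: the right side grows by 4 (2k + 1)² / (k (k + 1)), at least 16. It
  -- starts at `suc n` because the right side without the shift vanishes at 0.
  even-lower : ∀ n → 4 ^ (suc n * 2) ≤ 4 * suc n * (central (suc n * 2) * central (suc n * 2))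
  even-lower zero    = ℕₚ.≤-refl
  even-lower (suc n) = ℕₚ.*-cancelˡ-≤ (k₁ * k₁) (begin
    k₁ * k₁ * (4 * (4 * P))              ≤⟨ ℕₚ.*-monoʳ-≤ (k₁ * k₁) (ℕₚ.*-monoʳ-≤ 4 (ℕₚ.*-monoʳ-≤ 4 (even-lower n))) ⟩
    k₁ * k₁ * (4 * (4 * (4 * k * X)))    ≡⟨ regroup k k₁ X ⟩
    16 * k₁ * X * (4 * k * k₁)           ≤⟨ ℕₚ.*-monoʳ-≤ (16 * k₁ * X) poly ⟩
    16 * k₁ * X * (c * c)                ≡⟨ regroup′ k₁ c X ⟩
    4 * k₁ * (4 * (c * c) * X)           ≡⟨ cong (4 * k₁ *_) (even-step k) ⟨
    4 * k₁ * (k₁ * k₁ * Y)               ≡⟨ regroup″ k₁ Y ⟩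
    k₁ * k₁ * (4 * k₁ * Y)               ∎)
    where
    k = suc n
    k₁ = suc k
    c = suc (k * 2)
    P = 4 ^ (k * 2)
    X = central (k * 2) * central (k * 2)
    Y = central (k₁ * 2) * central (k₁ * 2)
    regroup : ∀ k k₁ x → k₁ * k₁ * (4 * (4 * (4 * k * x))) ≡ 16 * k₁ * x * (4 * k * k₁)
    regroup = solve-∀
    regroup′ : ∀ k₁ c x → 16 * k₁ * x * (c * c) ≡ 4 * k₁ * (4 * (c * c) * x)
    regroup′ = solve-∀
    regroup″ : ∀ k₁ y → 4 * k₁ * (k₁ * k₁ * y) ≡ k₁ * k₁ * (4 * k₁ * y)
    regroup″ = solve-∀
    expand : ∀ k → 4 * k * suc k + 1 ≡ suc (k * 2) * suc (k * 2)
    expand = solve-∀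
    poly : 4 * k * k₁ ≤ c * c
    poly = ℕₚ.≤-trans (ℕₚ.m≤m+n _ 1) (ℕₚ.≤-reflexive (expand k))

  four-central-odd² : ∀ n → central (suc n * 2) * central (suc n * 2)
                            ≡ 4 * (central (suc (n * 2)) * central (suc (n * 2)))
  four-central-odd² n rewrite central-even n = square (central (suc (n * 2)))
    where
    square : ∀ y → (2 * y) * (2 * y) ≡ 4 * (y * y)
    square = solve-∀

  central-upper : ∀ m → central m * central m * m ≤ 4 ^ m
  central-upper m with parity m
  ... | n , inj₁ refl = ℕₚ.≤-trans (ℕₚ.*-monoʳ-≤ (central (n * 2) * central (n * 2)) (ℕₚ.n≤1+n (n * 2)))
                          (even-upper n)
  ... | n , inj₂ refl = ℕₚ.*-cancelˡ-≤ 4 (begin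
    4 * (y * y * c)                        ≡⟨ ℕₚ.*-assoc 4 (y * y) c ⟨
    4 * (y * y) * c                        ≡⟨ cong (_* c) (four-central-odd² n) ⟨
    Z * c                                  ≤⟨ ℕₚ.*-monoʳ-≤ Z (ℕₚ.m≤n+m c 2) ⟩
    Z * suc (suc n * 2)                    ≤⟨ even-upper (suc n) ⟩
    4 * 4 ^ suc (n * 2)                    ∎)
    where
    y = central (suc (n * 2))
    c = suc (n * 2)
    Z = central (suc n * 2) * central (suc n * 2)

  central-lower : ∀ m → 1 ≤ m → 4 ^ m ≤ 4 * (central m * central m * m)
  central-lower m 1≤m with parity m
  central-lower _ () | zero , inj₁ refl
  ... | suc n , inj₁ refl = begin
    4 ^ (suc n * 2)                        ≤⟨ even-lower n ⟩
    4 * suc n * Z                          ≡⟨ regroup (suc n) Z ⟩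
    4 * (Z * suc n)                        ≤⟨ ℕₚ.*-monoʳ-≤ 4 (ℕₚ.*-monoʳ-≤ Z (ℕₚ.m≤m*n (suc n) 2)) ⟩
    4 * (Z * (suc n * 2))                  ∎
    where
    Z = central (suc n * 2) * central (suc n * 2)
    regroup : ∀ a z → 4 * a * z ≡ 4 * (z * a)
    regroup = solve-∀
  ... | n , inj₂ refl = ℕₚ.*-cancelˡ-≤ 4 (begin
    4 * 4 ^ suc (n * 2)                    ≤⟨ even-lower n ⟩
    4 * suc n * Z                          ≡⟨ cong (4 * suc n *_) (four-central-odd² n) ⟩
    4 * suc n * (4 * Y)                    ≡⟨ regroup (suc n) Y ⟩
    4 * (4 * (Y * suc n))                  ≤⟨ ℕₚ.*-monoʳ-≤ 4 (ℕₚ.*-monoʳ-≤ 4 (ℕₚ.*-monoʳ-≤ Y (s≤s (ℕₚ.m≤m*n n 2)))) ⟩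
    4 * (4 * (Y * suc (n * 2)))            ∎)
    where
    Y = central (suc (n * 2)) * central (suc (n * 2))
    Z = central (suc n * 2) * central (suc n * 2)
    regroup : ∀ a y → 4 * a * (4 * y) ≡ 4 * (4 * (y * a))
    regroup = solve-∀

-- Layers of the Boolean lattice

module Layers where
  open import Data.Nat using (_≤_)
  open ≡ using (refl; sym; trans; cong)

  infix 4 _⊑_
  _⊑_ : ∀ {n} → Subset n → Subset n → Set
  p ⊑ q = ∀ r → lookup p r ≡ true → lookup q r ≡ true

  ⊑-refl : ∀ {n} (p : Subset n) → p ⊑ p
  ⊑-refl p r e = e

  ⊑-∷ : ∀ {n b} {p q : Subset n} → p ⊑ q → (b ∷ p) ⊑ (b ∷ q)
  ⊑-∷ p⊑q zero    e = e
  ⊑-∷ p⊑q (suc r) e = p⊑q r e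

  ⊑-false : ∀ {n b} {p q : Subset n} → p ⊑ q → (false ∷ p) ⊑ (b ∷ q)
  ⊑-false p⊑q (suc r) e = p⊑q r e

  -- If `p` were contained in `q`, counting would force equality. This makes every layer an
  -- antichain.
  difference : ∀ {n} (p q : Subset n) → ∣ q ∣ ≤ ∣ p ∣ → p ≢ q →
    ∃[ r ] lookup p r ≡ true × lookup q r ≡ false
  difference [] [] _ p≢q = ⊥-elim (p≢q refl)
  difference (true  ∷ p) (false ∷ q) _ _ = zero , refl , refl
  difference (true  ∷ p) (true  ∷ q) (s≤s le) p≢q with difference p q le (p≢q ∘ cong (true ∷_))
  ... | r , e , e′ = suc r , e , e′
  difference (false ∷ p) (false ∷ q) le p≢q with difference p q le (p≢q ∘ cong (false ∷_))
  ... | r , e , e′ = suc r , e , e′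
  difference (false ∷ p) (true  ∷ q) lt p≢q with difference p q (ℕₚ.<⇒≤ lt) (λ { refl → ℕₚ.<-irrefl refl lt })
  ... | r , e , e′ = suc r , e , e′

  -- The recursive clause of `choose` with the split index as an argument, so that later proofs can
  -- reason about that index directly.
  choose-∷ : ∀ n k → Fin (n C k) ⊎ Fin (n C suc k) → (Fin (n C k) → Subset n) →
    (Fin (n C suc k) → Subset n) → Subset (suc n)
  choose-∷ n k i f g = [ (true ∷_) ∘ f , (false ∷_) ∘ g ]′ i

  split : ∀ n k → Fin (suc n C suc k) → Fin (n C k) ⊎ Fin (n C suc k)
  split n k i = splitAt (n C k) (Fin.cast (sym (nCk+nC[k+1]≡[n+1]C[k+1] n k)) i)

  join : ∀ n k → Fin (n C k) ⊎ Fin (n C suc k) → Fin (suc n C suc k)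
  join n k x = Fin.cast (nCk+nC[k+1]≡[n+1]C[k+1] n k) (Fin.join (n C k) (n C suc k) x)

  split-join : ∀ n k x → split n k (join n k x) ≡ x
  split-join n k x = trans
    (cong (splitAt (n C k)) (Finₚ.cast-involutive (sym e) e (Fin.join (n C k) (n C suc k) x)))
    (Finₚ.splitAt-join (n C k) (n C suc k) x)
    where e = nCk+nC[k+1]≡[n+1]C[k+1] n k

  join-split : ∀ n k i → join n k (split n k i) ≡ i
  join-split n k i = trans
    (cong (Fin.cast e) (Finₚ.join-splitAt (n C k) (n C suc k) (Fin.cast (sym e) i)))
    (Finₚ.cast-involutive e (sym e) i)
    where e = nCk+nC[k+1]≡[n+1]C[k+1] n k

  choose : ∀ n k → Fin (n C k) → Subset n
  choose n       zero    i = replicate n false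
  choose (suc n) (suc k) i = choose-∷ n k (split n k i) (choose n k) (choose n (suc k))

  ∣replicate-false∣ : ∀ n → ∣ replicate n false ∣ ≡ 0
  ∣replicate-false∣ zero    = refl
  ∣replicate-false∣ (suc n) = ∣replicate-false∣ n

  ∣choose∣ : ∀ n k i → ∣ choose n k i ∣ ≡ k
  ∣choose∣ n zero i = ∣replicate-false∣ n
  ∣choose∣ (suc n) (suc k) i with split n k i
  ... | inj₁ j = cong suc (∣choose∣ n k j)
  ... | inj₂ j = ∣choose∣ n (suc k) j

  choose-injective : ∀ n k i j → choose n k i ≡ choose n k j → i ≡ j
  choose-injective n zero zero zero _ = refl
  choose-injective (suc n) (suc k) i j e = trans (sym (join-split n k i))
    (trans (cong (join n k) (inj (split n k i) (split n k j) e)) (join-split n k j))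
    where
    inj : ∀ x y → choose-∷ n k x (choose n k) (choose n (suc k)) ≡
                  choose-∷ n k y (choose n k) (choose n (suc k)) → x ≡ y
    inj (inj₁ x) (inj₁ y) e = cong inj₁ (choose-injective n k x y (cong Vec.tail e))
    inj (inj₂ x) (inj₂ y) e = cong inj₂ (choose-injective n (suc k) x y (cong Vec.tail e))
    inj (inj₁ x) (inj₂ y) ()
    inj (inj₂ x) (inj₁ y) ()

  ∣p∣≡0 : ∀ {n} (p : Subset n) → ∣ p ∣ ≡ 0 → replicate n false ≡ p
  ∣p∣≡0 []          _ = refl
  ∣p∣≡0 (false ∷ p) e = cong (false ∷_) (∣p∣≡0 p e)

  choose-surjective : ∀ n k p → ∣ p ∣ ≡ k → ∃[ i ] choose n k i ≡ p
  choose-surjective n zero p e = zero , ∣p∣≡0 p e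
  choose-surjective (suc n) (suc k) (true ∷ p) e with choose-surjective n k p (ℕₚ.suc-injective e)
  ... | i , refl = join n k (inj₁ i) ,
    cong (λ x → choose-∷ n k x (choose n k) (choose n (suc k))) (split-join n k (inj₁ i))
  choose-surjective (suc n) (suc k) (false ∷ p) e with choose-surjective n (suc k) p e
  ... | i , refl = join n k (inj₂ i) ,
    cong (λ x → choose-∷ n k x (choose n k) (choose n (suc k))) (split-join n k (inj₂ i))

-- Hansel's bound on the number of down-closed families

module Hansel where
  open Layers
  open import Data.Nat using (_+_; _^_; _≤_; _<_; _∸_; _≤?_)
  open ≡ using (refl; sym; trans; cong; subst)

  -- The symmetric chain decomposition of the subsets of Fin n.  A chain in
  -- Chain n ℓ has the ℓ + 1 elements element c j for j ≤ ℓ.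
  data Chain : ℕ → ℕ → Set where
    []    : Chain 0 0
    long  : ∀ {n ℓ} → Chain n ℓ → Chain (suc n) (suc ℓ)
    short : ∀ {n ℓ} → Chain n (suc ℓ) → Chain (suc n) ℓ

  -- The recursion of de Bruijn, Tengbergen and Kruyswijk. A new element makes two copies of `c`:
  -- `long` takes the copy without it and the top of the other copy, `short` takes the rest of the
  -- other copy. Positions beyond the end of a chain have meaningless values.
  element : ∀ {n ℓ} → Chain n ℓ → ℕ → Subset n
  element []               j = []
  element (long {ℓ = ℓ} c) j with j ≤? ℓ
  ... | yes _ = false ∷ element c j
  ... | no  _ = true ∷ element c ℓ
  element (short c)        j = true ∷ element c j

  -- The size of the smallest set of the chain. By symmetry the largest set misses as many elements,
  -- whence `deficit-length`.
  deficit : ∀ {n ℓ} → Chain n ℓ → ℕ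
  deficit []        = 0
  deficit (long c)  = deficit c
  deficit (short c) = suc (deficit c)

  deficit-length : ∀ {n ℓ} (c : Chain n ℓ) → n ≡ deficit c + (deficit c + ℓ)
  deficit-length []        = refl
  deficit-length (long {ℓ = ℓ} c) = trans (cong suc (deficit-length c)) (shift (deficit c) ℓ)
    where
    shift : ∀ a l → suc (a + (a + l)) ≡ a + (a + suc l)
    shift = solve-∀
  deficit-length (short {ℓ = ℓ} c) = trans (cong suc (deficit-length c)) (shift (deficit c) ℓ)
    where
    shift : ∀ a l → suc (a + (a + suc l)) ≡ suc a + (suc a + l)
    shift = solve-∀

  ∣element∣ : ∀ {n ℓ} (c : Chain n ℓ) j → j ≤ ℓ → ∣ element c j ∣ ≡ deficit c + j
  ∣element∣ [] zero _ = refl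
  ∣element∣ (long {ℓ = ℓ} c) j j≤1+ℓ with j ≤? ℓ
  ... | yes j≤ℓ = ∣element∣ c j j≤ℓ
  ... | no  j≰ℓ with ℕₚ.≤-antisym j≤1+ℓ (ℕₚ.≰⇒> j≰ℓ)
  ...   | refl = trans (cong suc (∣element∣ c ℓ ℕₚ.≤-refl)) (sym (ℕₚ.+-suc (deficit c) ℓ))
  ∣element∣ (short c) j j≤ℓ = cong suc (∣element∣ c j (ℕₚ.m≤n⇒m≤1+n j≤ℓ))

  Position : ℕ → Set
  Position n = ∃[ ℓ ] Chain n ℓ × ℕ

  extend : ∀ {n} → Bool → Position n → Position (suc n)
  extend false (ℓ , c , j) = suc ℓ , long c , j
  extend true (zero , c , j) = 1 , long c , 1
  extend true (suc ℓ , c , j) with j ≤? ℓ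
  ... | yes _ = ℓ , short c , j
  ... | no  _ = suc (suc ℓ) , long c , suc (suc ℓ)

  -- Inverse to `element`. It allows a chain to be named by any of its sets, in `encode` by the one
  -- in the middle layer.
  locate : ∀ {n} → Subset n → Position n
  locate []      = 0 , [] , 0
  locate (b ∷ p) = extend b (locate p)

  locate-element : ∀ {n ℓ} (c : Chain n ℓ) j → j ≤ ℓ → locate (element c j) ≡ (ℓ , c , j)
  locate-element [] zero _ = refl
  locate-element (long {ℓ = ℓ} c) j j≤1+ℓ with j ≤? ℓ
  ... | yes j≤ℓ = cong (extend false) (locate-element c j j≤ℓ)
  ... | no  j≰ℓ with ℕₚ.≤-antisym j≤1+ℓ (ℕₚ.≰⇒> j≰ℓ)
  ...   | refl = trans (cong (extend true) (locate-element c ℓ ℕₚ.≤-refl)) (top ℓ c)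
    where
    top : ∀ {n} ℓ (c : Chain n ℓ) → extend true (ℓ , c , ℓ) ≡ (suc ℓ , long c , suc ℓ)
    top zero    c = refl
    top (suc ℓ) c with suc ℓ ≤? ℓ
    ... | yes p = ⊥-elim (ℕₚ.<-irrefl refl p)
    ... | no  _ = refl
  locate-element (short {ℓ = ℓ} c) j j≤ℓ =
    trans (cong (extend true) (locate-element c j (ℕₚ.m≤n⇒m≤1+n j≤ℓ))) low
    where
    low : extend true (suc ℓ , c , j) ≡ (ℓ , short c , j)
    low with j ≤? ℓ
    ... | yes _ = refl
    ... | no  q = ⊥-elim (q j≤ℓ)

  covered : ∀ {n} (p : Subset n) → ∃[ ℓ ] Σ (Chain n ℓ) λ c → ∃[ j ] j ≤ ℓ × element c j ≡ p
  covered [] = 0 , [] , 0 , z≤n , refl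
  covered (false ∷ p) with covered p
  ... | ℓ , c , j , j≤ℓ , refl = suc ℓ , long c , j , ℕₚ.m≤n⇒m≤1+n j≤ℓ , eq
    where
    eq : element (long c) j ≡ false ∷ element c j
    eq with j ≤? ℓ
    ... | yes _ = refl
    ... | no  q = ⊥-elim (q j≤ℓ)
  covered (true ∷ p) with covered p
  ... | ℓ , c , j , j≤ℓ , refl with ℕₚ.m≤n⇒m<n∨m≡n j≤ℓ
  ...   | inj₁ (s≤s j≤ℓ′) = _ , short c , j , j≤ℓ′ , refl
  ...   | inj₂ refl = suc ℓ , long c , suc ℓ , ℕₚ.≤-refl , eq
    where
    eq : element (long c) (suc ℓ) ≡ true ∷ element c ℓ
    eq with suc ℓ ≤? ℓ
    ... | yes q = ⊥-elim (ℕₚ.<-irrefl refl q)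
    ... | no  _ = refl

  element-mono : ∀ {n ℓ} (c : Chain n ℓ) {i j} → i ≤ j → j ≤ ℓ → element c i ⊑ element c j
  element-mono [] _ _ = ⊑-refl []
  element-mono (long {ℓ = ℓ} c) {i} {j} i≤j j≤1+ℓ with i ≤? ℓ | j ≤? ℓ
  ... | yes _   | yes j≤ℓ = ⊑-∷ (element-mono c i≤j j≤ℓ)
  ... | yes i≤ℓ | no _    = ⊑-false (element-mono c i≤ℓ ℕₚ.≤-refl)
  ... | no i≰ℓ  | yes j≤ℓ = ⊥-elim (i≰ℓ (ℕₚ.≤-trans i≤j j≤ℓ))
  ... | no _    | no _    = ⊑-refl (true ∷ element c ℓ)
  element-mono (short c) i≤j j≤ℓ = ⊑-∷ (element-mono c i≤j (ℕₚ.m≤n⇒m≤1+n j≤ℓ))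

  -- The key property of the decomposition: between elements `j` and `2 + j` of a chain there is a
  -- set on a chain shorter by two. For `long c` the tail chain supplies it, except when `2 + j` is
  -- the new top; then it comes from `short c`.
  complement : ∀ {n ℓ} (c : Chain n (2 + ℓ)) j → j ≤ ℓ → Σ (Chain n ℓ) λ c′ →
    element c j ⊑ element c′ j × element c′ j ⊑ element c (2 + j)
  complement {ℓ = zero} (long {ℓ = suc zero} c) zero z≤n =
    short c , ⊑-false (⊑-refl (element c 0)) , ⊑-∷ (element-mono c z≤n (s≤s z≤n))
  complement {ℓ = suc ℓ} (long c) j j≤1+ℓ with ℕₚ.m≤n⇒m<n∨m≡n j≤1+ℓ
  ... | inj₁ (s≤s j≤ℓ) with complement c j j≤ℓ
  ...   | c′ , below , above = long c′ , lower , upper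
    where
    lower : element (long c) j ⊑ element (long c′) j
    lower with j ≤? 2 + ℓ | j ≤? ℓ
    ... | yes _ | yes _ = ⊑-∷ below
    ... | no q  | _     = ⊥-elim (q (ℕₚ.m≤n⇒m≤1+n j≤1+ℓ))
    ... | _     | no q  = ⊥-elim (q j≤ℓ)
    upper : element (long c′) j ⊑ element (long c) (2 + j)
    upper with 2 + j ≤? 2 + ℓ | j ≤? ℓ
    ... | yes _ | yes _ = ⊑-∷ above
    ... | no q  | _     = ⊥-elim (q (s≤s (s≤s j≤ℓ)))
    ... | _     | no q  = ⊥-elim (q j≤ℓ)
  complement {ℓ = suc ℓ} (long c) j j≤1+ℓ | inj₂ refl = short c , lower , upper
    where
    lower : element (long c) (suc ℓ) ⊑ (true ∷ element c (suc ℓ))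
    lower with suc ℓ ≤? 2 + ℓ
    ... | yes _ = ⊑-false (⊑-refl (element c (suc ℓ)))
    ... | no q  = ⊥-elim (q (ℕₚ.n≤1+n _))
    upper : (true ∷ element c (suc ℓ)) ⊑ element (long c) (3 + ℓ)
    upper with 3 + ℓ ≤? 2 + ℓ
    ... | yes q = ⊥-elim (ℕₚ.<-irrefl refl q)
    ... | no  _ = ⊑-∷ (element-mono c (ℕₚ.n≤1+n _) ℕₚ.≤-refl)
  complement (short c) j j≤ℓ with complement c j (ℕₚ.m≤n⇒m≤1+n j≤ℓ)
  ... | c′ , below , above = short c′ , ⊑-∷ below , ⊑-∷ above

  firstFalse : (ℕ → Bool) → ℕ → ℕ
  firstFalse P zero    = 0
  firstFalse P (suc b) = if P 0 then suc (firstFalse (P ∘ suc) b) else 0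

  firstFalse-≤ : ∀ P b → firstFalse P b ≤ b
  firstFalse-≤ P zero = z≤n
  firstFalse-≤ P (suc b) with P 0
  ... | true  = s≤s (firstFalse-≤ (P ∘ suc) b)
  ... | false = z≤n

  before-firstFalse : ∀ P b {i} → i < firstFalse P b → P i ≡ true
  before-firstFalse P (suc b) {i} i< with P 0 in eq
  before-firstFalse P (suc b) {zero}  i<       | true = eq
  before-firstFalse P (suc b) {suc i} (s≤s i<) | true = before-firstFalse (P ∘ suc) b i<

  at-firstFalse : ∀ P b → firstFalse P b < b → P (firstFalse P b) ≡ false
  at-firstFalse P (suc b) lt with P 0 in eq
  at-firstFalse P (suc b) (s≤s lt) | true  = at-firstFalse (P ∘ suc) b lt
  at-firstFalse P (suc b) lt       | false = eq

  mod3 : ℕ → Fin 3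
  mod3 0 = zero
  mod3 1 = suc zero
  mod3 2 = suc (suc zero)
  mod3 (suc (suc (suc n))) = mod3 n

  mod3-gap : ∀ m n → mod3 m ≡ mod3 n → m < n → 3 + m ≤ n
  mod3-gap 0 (suc (suc (suc n))) _ _ = s≤s (s≤s (s≤s z≤n))
  mod3-gap 0 1 () _
  mod3-gap 0 2 () _
  mod3-gap 1 1 _ (s≤s ())
  mod3-gap 1 2 () _
  mod3-gap 1 3 () _
  mod3-gap 1 (suc (suc (suc (suc n)))) _ _ = s≤s (s≤s (s≤s (s≤s z≤n)))
  mod3-gap 2 1 () _
  mod3-gap 2 2 _ (s≤s (s≤s ()))
  mod3-gap 2 3 () _
  mod3-gap 2 4 () _
  mod3-gap 2 (suc (suc (suc (suc (suc n))))) _ _ = s≤s (s≤s (s≤s (s≤s (s≤s z≤n))))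
  mod3-gap (suc (suc (suc m))) (suc (suc (suc n))) e (s≤s (s≤s (s≤s lt))) =
    s≤s (s≤s (s≤s (mod3-gap m n e lt)))
  mod3-gap (suc (suc (suc m))) 1 _ (s≤s ())
  mod3-gap (suc (suc (suc m))) 2 _ (s≤s (s≤s ()))

  DownClosed : ∀ {n} → (Subset n → Bool) → Set
  DownClosed f = ∀ p q → p ⊑ q → f q ≡ true → f p ≡ true

  -- For a down-closed `f` this is the number of sets of the chain that lie in `f`, so it determines
  -- `f` on the chain.
  threshold : ∀ {n ℓ} → (Subset n → Bool) → Chain n ℓ → ℕ
  threshold {ℓ = ℓ} f c = firstFalse (f ∘ element c) (suc ℓ)

  -- Hansel's encoding: given f on the shorter chains, the threshold of f on a
  -- chain has at most three possible values, and these are consecutive.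
  encode : ∀ {n} → (Subset n → Bool) → Fin (3 ^ (n C ⌈ n /2⌉))
  encode {n} f = funToFin λ i → mod3 (threshold f (proj₁ (proj₂ (locate (choose n ⌈ n /2⌉ i)))))

  a≤⌈a+a+ℓ/2⌉ : ∀ a ℓ → a ≤ ⌈ a + (a + ℓ) /2⌉ × ⌈ a + (a + ℓ) /2⌉ ≤ a + ℓ
  a≤⌈a+a+ℓ/2⌉ zero ℓ = z≤n , ℕₚ.⌈n/2⌉≤n ℓ
  a≤⌈a+a+ℓ/2⌉ (suc a) ℓ with a≤⌈a+a+ℓ/2⌉ a ℓ
  ... | lo , hi rewrite ℕₚ.+-suc a (a + ℓ) = s≤s lo , s≤s hi

  -- A chain is symmetric about the middle layer and skips no size in its range, so it meets that
  -- layer. Hence one ternary digit per middle set covers all chains.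
  middle : ∀ {n ℓ} (c : Chain n ℓ) → ∃[ j ] j ≤ ℓ × ∣ element c j ∣ ≡ ⌈ n /2⌉
  middle {n} {ℓ} c = j , j≤ℓ , trans (∣element∣ c j j≤ℓ) (ℕₚ.m+[n∸m]≡n (proj₁ bounds))
    where
    a = deficit c
    j = ⌈ n /2⌉ ∸ a
    bounds : a ≤ ⌈ n /2⌉ × ⌈ n /2⌉ ≤ a + ℓ
    bounds = subst (λ x → a ≤ ⌈ x /2⌉ × ⌈ x /2⌉ ≤ a + ℓ) (sym (deficit-length c)) (a≤⌈a+a+ℓ/2⌉ a ℓ)
    j≤ℓ : j ≤ ℓ
    j≤ℓ = subst (j ≤_) (ℕₚ.m+n∸m≡n a ℓ) (ℕₚ.∸-monoˡ-≤ a (proj₂ bounds))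

  encode-threshold : ∀ {n} f g → encode {n} f ≡ encode g → ∀ {ℓ} (c : Chain n ℓ) →
    mod3 (threshold f c) ≡ mod3 (threshold g c)
  encode-threshold {n} f g e c with middle c
  ... | j , j≤ℓ , size with choose-surjective n ⌈ n /2⌉ (element c j) size
  ...   | i , chosen = subst (λ P → code f P ≡ code g P)
            (trans (cong locate chosen) (locate-element c j j≤ℓ)) codes
    where
    code : (Subset n → Bool) → Position n → Fin 3
    code h (_ , c , _) = mod3 (threshold h c)
    codeᵢ : (Subset n → Bool) → Fin (n C ⌈ n /2⌉) → Fin 3
    codeᵢ h i = code h (locate (choose n ⌈ n /2⌉ i))
    codes : codeᵢ f i ≡ codeᵢ g i
    codes = trans (sym (Finₚ.finToFun-funToFin (codeᵢ f) i))
      (trans (cong (λ x → finToFun x i) e) (Finₚ.finToFun-funToFin (codeᵢ g) i))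

  -- Congruent thresholds that differ do so by at least 3, so `f` fails at θ while `g` holds at 2 +
  -- θ. The set from `complement` lies between them on a shorter chain: `g` holds there, hence so
  -- does `f` by agreement, hence `f` holds at θ.
  threshold-≮ : ∀ {n} f g → DownClosed f → DownClosed g → ∀ {ℓ} (c : Chain n ℓ) →
    mod3 (threshold f c) ≡ mod3 (threshold g c) →
    (∀ {ℓ′} (c′ : Chain n ℓ′) → ℓ′ < ℓ → ∀ j → j ≤ ℓ′ → f (element c′ j) ≡ g (element c′ j)) →
    ¬ (threshold f c < threshold g c)
  threshold-≮ f g f↓ g↓ {ℓ} c e shorter lt
    with ℕₚ.≤-trans (mod3-gap (threshold f c) (threshold g c) e lt) (firstFalse-≤ (g ∘ element c) (suc ℓ))
  threshold-≮ f g f↓ g↓ {suc (suc ℓ)} c e shorter lt | s≤s (s≤s (s≤s θ≤ℓ))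
    with complement c (threshold f c) θ≤ℓ
  ... | c′ , below , above = case trans (sym f-low) (f↓ _ _ below f-mid) of λ ()
    where
    θ = threshold f c
    f-low : f (element c θ) ≡ false
    f-low = at-firstFalse (f ∘ element c) (3 + ℓ) (s≤s (ℕₚ.m≤n⇒m≤1+n (ℕₚ.m≤n⇒m≤1+n θ≤ℓ)))
    g-high : g (element c (2 + θ)) ≡ true
    g-high = before-firstFalse (g ∘ element c) (3 + ℓ) (mod3-gap θ (threshold g c) e lt)
    f-mid : f (element c′ θ) ≡ true
    f-mid = trans (shorter c′ (ℕₚ.n≤1+n (suc ℓ)) θ θ≤ℓ) (g↓ _ _ above g-high)

  ≡-below-threshold : ∀ {n} f g → DownClosed f → DownClosed g → ∀ {ℓ} (c : Chain n ℓ) →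
    threshold f c ≡ threshold g c → ∀ j → j ≤ ℓ → f (element c j) ≡ g (element c j)
  ≡-below-threshold f g f↓ g↓ {ℓ} c e j j≤ℓ with j ℕ.<? threshold f c
  ... | yes j<θ = trans (before-firstFalse (f ∘ element c) (suc ℓ) j<θ)
                    (sym (before-firstFalse (g ∘ element c) (suc ℓ) (subst (j <_) e j<θ)))
  ... | no  j≮θ = trans (above f f↓ (ℕₚ.≮⇒≥ j≮θ)) (sym (above g g↓ (subst (_≤ j) e (ℕₚ.≮⇒≥ j≮θ))))
    where
    above : ∀ h → DownClosed h → threshold h c ≤ j → h (element c j) ≡ false
    above h h↓ θ≤j with h (element c j) in hj
    ... | false = refl
    ... | true  = trans (sym (h↓ _ _ (element-mono c θ≤j j≤ℓ) hj))
                    (at-firstFalse (h ∘ element c) (suc ℓ) (s≤s (ℕₚ.≤-trans θ≤j j≤ℓ)))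

  -- Induction on chain length, bounded by `b`: agreement on all shorter chains turns equal residues
  -- of the thresholds into equal thresholds.
  encode-injective : ∀ {n} f g → DownClosed f → DownClosed g → encode {n} f ≡ encode g → f ≗ g
  encode-injective {n} f g f↓ g↓ e p with covered p
  ... | ℓ , c , j , j≤ℓ , refl = agree (suc ℓ) c ℕₚ.≤-refl j j≤ℓ
    where
    agree : ∀ b {ℓ} (c : Chain n ℓ) → ℓ < b → ∀ j → j ≤ ℓ → f (element c j) ≡ g (element c j)
    agree (suc b) {ℓ} c (s≤s ℓ≤b) = ≡-below-threshold f g f↓ g↓ c θ≡
      where
      mod≡ = encode-threshold f g e c
      shorter : ∀ {ℓ′} (c′ : Chain n ℓ′) → ℓ′ < ℓ → ∀ j → j ≤ ℓ′ → f (element c′ j) ≡ g (element c′ j)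
      shorter c′ ℓ′<ℓ = agree b c′ (ℕₚ.≤-trans ℓ′<ℓ ℓ≤b)
      θ≡ : threshold f c ≡ threshold g c
      θ≡ with ℕₚ.<-cmp (threshold f c) (threshold g c)
      ... | tri< lt _ _ = ⊥-elim (threshold-≮ f g f↓ g↓ c mod≡ shorter lt)
      ... | tri≈ _ eq _ = eq
      ... | tri> _ _ gt = ⊥-elim (threshold-≮ g f g↓ f↓ c (sym mod≡)
                            (λ c′ lt j le → sym (shorter c′ lt j le)) gt)

-- Expectations over the leaves of a tree

module Leaves (R : RealNumbers) where
  open Ordered R

  sumLeaves-cong : ∀ {k} (t : Tree k) {f g : Leaf t → ℝ} → (∀ x → f x ≈ g x) →
    sumLeaves R t f ≈ sumLeaves R t g
  sumLeaves-cong leaf       f≈g = f≈g tt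
  sumLeaves-cong (node n t) f≈g = sum-cong-≋ λ i → sumLeaves-cong (t i) λ x → f≈g (i , x)

  sumLeaves-mono : ∀ {k} (t : Tree k) {f g : Leaf t → ℝ} → (∀ x → f x ≤ g x) →
    sumLeaves R t f ≤ sumLeaves R t g
  sumLeaves-mono leaf       f≤g = f≤g tt
  sumLeaves-mono (node n t) f≤g = sum-mono λ i → sumLeaves-mono (t i) λ x → f≤g (i , x)

  sumLeaves-+ : ∀ {k} (t : Tree k) (f g : Leaf t → ℝ) →
    sumLeaves R t (λ x → f x + g x) ≈ sumLeaves R t f + sumLeaves R t g
  sumLeaves-+ leaf       f g = ≈-refl
  sumLeaves-+ (node n t) f g = ≈-trans (sum-cong-≋ λ i → sumLeaves-+ (t i) (λ x → f (i , x)) (λ x → g (i , x)))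
    (∑-distrib-+ (λ i → sumLeaves R (t i) λ x → f (i , x)) (λ i → sumLeaves R (t i) λ x → g (i , x)))

  sumLeaves-* : ∀ {k} (t : Tree k) c (f : Leaf t → ℝ) →
    sumLeaves R t (λ x → c * f x) ≈ c * sumLeaves R t f
  sumLeaves-* leaf       c f = ≈-refl
  sumLeaves-* (node n t) c f = ≈-trans (sum-cong-≋ λ i → sumLeaves-* (t i) c (λ x → f (i , x)))
    (≈-sym (*-distribˡ-sum c (λ i → sumLeaves R (t i) λ x → f (i , x))))

  module _ {k m} {H : HST R k} {K : RequestTypes R H m} {r : Fin m} (μ : Distribution R H K r) where
    open Distribution μ
    open HST H
    open RequestTypes K

    expectation-lower : ∀ (f : Point → ℝ) b → (∀ x → member r x ≡ true → b ≤ f x) →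
      b ≤ sumLeaves R tree (λ x → prob x * f x)
    expectation-lower f b b≤f = ≤-trans (≤-reflexive b≈) (sumLeaves-mono tree pointwise)
      where
      b≈ : b ≈ sumLeaves R tree (λ x → b * prob x)
      b≈ = ≈-trans (≈-sym (≈-trans (*-congˡ total) (*-identityʳ b))) (≈-sym (sumLeaves-* tree b prob))
      pointwise : ∀ x → b * prob x ≤ prob x * f x
      pointwise x with member r x Boolₚ.≟ true
      ... | yes x∈r = ≤-trans (≤-reflexive (*-comm _ _)) (*-monoʳ-≤ (nonNegative x) (b≤f x x∈r))
      ... | no  x∉r = ≤-reflexive (≈-trans (≈-trans (*-congˡ p≈0) (zeroʳ b))
                        (≈-sym (≈-trans (*-congʳ p≈0) (zeroˡ _))))
        where p≈0 = supported x x∉r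

-- Yao's principle for coin-tossing adversaries

module RandomAdversary (R : RealNumbers) {m : ℕ} where
  open Ordered R
  open Leaves R

  -- A randomised oblivious adversary: toss branches on a fair coin.
  data Game : Set where
    done : Game
    ask  : Fin m → Game → Game
    toss : Game → Game → Game

  data Play : Game → List (Fin m) → Set where
    done  : Play done []
    ask   : ∀ {r g ρ} → Play g ρ → Play (ask r g) (r ∷ ρ)
    left  : ∀ {g h ρ} → Play g ρ → Play (toss g h) ρ
    right : ∀ {g h ρ} → Play h ρ → Play (toss g h) ρ

  half : ℝ
  half = recip (fromℕ-pos 1)

  2*half : fromℕ 2 * half ≈ 1#
  2*half = recip-inverseʳ (fromℕ-pos 1)

  half+half : half + half ≈ 1#
  half+half = ≈-trans (solve 1 (λ h → h :+ h := (con 1 :+ con 1) :* h) ≈-refl half)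
    (≈-trans (*-congʳ (+-congˡ (≈-sym (+-identityʳ 1#)))) 2*half)

  half≥0 : 0# ≤ half
  half≥0 = <⇒≤ (recip-pos (fromℕ-pos 1))

  mean : Game → (List (Fin m) → ℝ) → ℝ
  mean done       f = f []
  mean (ask r g)  f = mean g (f ∘ (r ∷_))
  mean (toss g h) f = half * (mean g f + mean h f)

  mean-+ : ∀ g f f′ → mean g (λ ρ → f ρ + f′ ρ) ≈ mean g f + mean g f′
  mean-+ done       f f′ = ≈-refl
  mean-+ (ask r g)  f f′ = mean-+ g (f ∘ (r ∷_)) (f′ ∘ (r ∷_))
  mean-+ (toss g h) f f′ = ≈-trans (*-congˡ (+-cong (mean-+ g f f′) (mean-+ h f f′)))
    (solve 5 (λ k a b c d → k :* ((a :+ b) :+ (c :+ d)) := k :* (a :+ c) :+ k :* (b :+ d)) ≈-refl half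
      (mean g f) (mean g f′) (mean h f) (mean h f′))

  mean-* : ∀ g c f → mean g (λ ρ → c * f ρ) ≈ c * mean g f
  mean-* done       c f = ≈-refl
  mean-* (ask r g)  c f = mean-* g c (f ∘ (r ∷_))
  mean-* (toss g h) c f = ≈-trans (*-congˡ (+-cong (mean-* g c f) (mean-* h c f)))
    (solve 4 (λ k c a b → k :* (c :* a :+ c :* b) := c :* (k :* (a :+ b))) ≈-refl half c (mean g f) (mean h f))

  half-average : ∀ c → half * (c + c) ≈ c
  half-average c = ≈-trans (solve 2 (λ k c → k :* (c :+ c) := (k :+ k) :* c) ≈-refl half c)
    (≈-trans (*-congʳ half+half) (*-identityˡ c))

  mean-const : ∀ g c → mean g (λ _ → c) ≈ c
  mean-const done       c = ≈-refl
  mean-const (ask r g)  c = mean-const g c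
  mean-const (toss g h) c = ≈-trans (*-congˡ (+-cong (mean-const g c) (mean-const h c))) (half-average c)

  mean-upper : ∀ g {f} b → (∀ {ρ} → Play g ρ → f ρ ≤ b) → mean g f ≤ b
  mean-upper done       b f≤b = f≤b done
  mean-upper (ask r g)  b f≤b = mean-upper g b (f≤b ∘ ask)
  mean-upper (toss g h) b f≤b = ≤-trans
    (*-monoʳ-≤ half≥0 (+-mono-≤ (mean-upper g b (f≤b ∘ left)) (mean-upper h b (f≤b ∘ right))))
    (≤-reflexive (half-average b))

  mean-sum : ∀ g {n} (f : Fin n → List (Fin m) → ℝ) →
    mean g (λ ρ → sum (λ i → f i ρ)) ≈ sum (λ i → mean g (f i))
  mean-sum g {zero}  f = mean-const g 0#
  mean-sum g {suc n} f = ≈-trans (mean-+ g (f zero) (λ ρ → sum λ i → f (suc i) ρ)) (+-congˡ (mean-sum g (f ∘ suc)))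

  mean-sumLeaves : ∀ g {k} (t : Tree k) (f : Leaf t → List (Fin m) → ℝ) →
    mean g (λ ρ → sumLeaves R t (λ x → f x ρ)) ≈ sumLeaves R t (λ x → mean g (f x))
  mean-sumLeaves g leaf       f = ≈-refl
  mean-sumLeaves g (node n t) f = ≈-trans (mean-sum g (λ i ρ → sumLeaves R (t i) λ x → f (i , x) ρ))
    (sum-cong-≋ λ i → mean-sumLeaves g (t i) λ x → f (i , x))

  module Yao {k} (H : HST R k) (K : RequestTypes R H m) (dist : HST.Point H → HST.Point H → ℕ)
    (d≈dist : ∀ x y → d R H x y ≈ fromℕ (dist x y)) where
    open HST H
    open RequestTypes K

    -- n bounds from below the mean cost of any online algorithm in state s.
    Forces : Game → Point → ℕ → Set
    Forces done       s n = n ≡ 0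
    Forces (ask r g)  s n = ∀ x → member r x ≡ true → ∃[ n′ ] Forces g x n′ × n ℕ.≤ dist s x ℕ.+ n′
    Forces (toss g h) s n = ∃[ p ] ∃[ q ] Forces g s p × Forces h s q × 2 ℕ.* n ℕ.≤ p ℕ.+ q

    -- The law of the answer to `r` is fixed before later coins fall, so the mean over coins can be
    -- moved inside the expectation over the next state (`commute`).
    forced : ∀ g {s n} → Forces g s n → ∀ A s₀ h → fromℕ n ≤ mean g (expectedCostFrom R H K A s₀ h s)
    forced done ≡.refl A s₀ h = ≤-refl
    forced (ask r g) {s} {n} φ A s₀ h = ≤-trans
      (expectation-lower μ (λ x → d R H s x + mean g (future x)) (fromℕ n) pointwise) (≤-reflexive (≈-sym commute))
      where
      μ = A s₀ h r
      open Distribution μ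
      future : Point → List (Fin m) → ℝ
      future x = expectedCostFrom R H K A s₀ ((r , x) ∷ h) x
      commute : mean g (λ ρ → sumLeaves R tree (λ x → prob x * (d R H s x + future x ρ)))
              ≈ sumLeaves R tree (λ x → prob x * (d R H s x + mean g (future x)))
      commute = ≈-trans (mean-sumLeaves g tree (λ x ρ → prob x * (d R H s x + future x ρ))) (sumLeaves-cong tree λ x →
        ≈-trans (mean-* g (prob x) (λ ρ → d R H s x + future x ρ)) (*-congˡ (≈-trans (mean-+ g (λ _ → d R H s x) (future x)) (+-congʳ (mean-const g (d R H s x))))))
      pointwise : ∀ x → member r x ≡ true → fromℕ n ≤ d R H s x + mean g (future x)
      pointwise x x∈r with φ x x∈r
      ... | n′ , ψ , le = ≤-trans (fromℕ-mono-≤ le) (≤-trans (≤-reflexive (fromℕ-+ (dist s x) n′))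
              (+-mono-≤ (≤-reflexive (≈-sym (d≈dist s x))) (forced g ψ A s₀ ((r , x) ∷ h))))
    forced (toss g h) {s} {n} (p , q , φ , ψ , le) A s₀ his = ≤-trans (≤-reflexive twice)
      (*-monoʳ-≤ half≥0 (≤-trans (fromℕ-mono-≤ le) (≤-trans (≤-reflexive (fromℕ-+ p q))
        (+-mono-≤ (forced g φ A s₀ his) (forced h ψ A s₀ his)))))
      where
      twice : fromℕ n ≈ half * fromℕ (2 ℕ.* n)
      twice = ≈-trans (≈-sym (half-average (fromℕ n))) (*-congˡ (≈-trans
        (≈-sym (fromℕ-+ n n)) (fromℕ-cong (≡.cong (n ℕ.+_) (≡.sym (ℕₚ.+-identityʳ n))))))

    Forces-asks : ∀ rs {g n} → (∀ x → Forces g x n) → ∀ x → Forces (List.foldr ask g rs) x n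
    Forces-asks []       φ x = φ x
    Forces-asks (r ∷ rs) {n = n} φ s x _ = n , Forces-asks rs φ x , ℕₚ.m≤n+m n (dist s x)

    costℕ : Point → List Point → ℕ
    costℕ s []       = 0
    costℕ s (x ∷ σ) = dist s x ℕ.+ costℕ x σ

    cost≈costℕ : ∀ s σ → solutionCost R H s σ ≈ fromℕ (costℕ s σ)
    cost≈costℕ s []      = ≈-refl
    cost≈costℕ s (x ∷ σ) = ≈-trans (+-cong (d≈dist s x) (cost≈costℕ x σ)) (≈-sym (fromℕ-+ (dist s x) (costℕ x σ)))

    -- A least cost exists by well-founded induction on natural costs. The double negation avoids
    -- deciding at each cost whether a cheaper solution exists.
    ¬¬optimal : ∀ s ρ {σ} → Feasible R H K ρ σ →
      ¬ ¬ (∃[ n ] n ℕ.≤ costℕ s σ × IsOptimalCost R H K s ρ (fromℕ n))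
    ¬¬optimal s ρ {σ₀} feas₀ none = <-rec (λ n → n ℕ.≤ costℕ s σ₀ → ∀ σ → Feasible R H K ρ σ → costℕ s σ ≢ n)
      (λ n rec n≤ σ feas eq → none (n , n≤ , (σ , feas , ≈-trans (cost≈costℕ s σ) (fromℕ-cong eq)) ,
        λ σ′ feas′ → ≤-trans (fromℕ-mono-≤ (ℕₚ.≮⇒≥ λ lt →
            rec lt (ℕₚ.≤-trans (ℕₚ.<⇒≤ lt) n≤) σ′ feas′ ≡.refl))
          (≤-reflexive (≈-sym (cost≈costℕ s σ′)))))
      (costℕ s σ₀) ℕₚ.≤-refl σ₀ feas₀ ≡.refl

    -- The bound is stated with a nonnegative `a` above `c` because replacing the optimal cost by
    -- its bound `b` requires a nonnegative factor, and the sign of `c` is not known.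
    yao : ∀ A g {n b s a c β} → Forces g s n →
      (∀ {ρ} → Play g ρ → ∃[ σ ] Feasible R H K ρ σ × costℕ s σ ℕ.≤ b) →
      0# ≤ a → c ≤ a →
      (∀ s₀ ρ v → IsOptimalCost R H K s₀ ρ v → expectedCost R H K A s₀ ρ ≤ c * v + β) →
      fromℕ n ≤ a * fromℕ b + β
    yao A g {n} {b} {s} {a} {c} {β} φ offline a≥0 c≤a ratio =
      ≤-trans (forced g φ A s []) (mean-upper g _ λ play → ¬¬-≤ λ ¬le → case offline play of λ
        (σ , feas , le) → ¬¬optimal s _ feas λ (v , v≤ , opt) → ¬le (≤-trans (ratio s _ _ opt)
          (+-monoˡ-≤ β (≤-trans (*-monoˡ-≤ (fromℕ-nonneg v) c≤a)
            (*-monoʳ-≤ a≥0 (fromℕ-mono-≤ (ℕₚ.≤-trans v≤ le)))))))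

-- The hard instance for the lower bound

-- Each subtree of the root picks one bit per set S i, and has for every i a
-- leaf (i , bit) of the types in S i and of the type of its bit.  Two further
-- request types stand for the bits.
module HardInstance (R : RealNumbers) {n M′ : ℕ} (S : Fin (suc M′) → Subset n)
  (antichain : ∀ i j → i ≢ j → ∃[ r ] lookup (S i) r ≡ true × lookup (S j) r ≡ false) where
  open Ordered R
  open RandomAdversary R {2 ℕ.+ n}

  M : ℕ
  M = suc M′

  toBit : Fin 2 → Bool
  toBit zero    = false
  toBit (suc _) = true

  fromBit : Bool → Fin 2
  fromBit false = zero
  fromBit true  = suc zero

  -- `node` has a successor number of children, so one extra subtree, number zero, carries the
  -- all-false bits; the others run through all bit vectors.
  bits : Fin (suc (2 ℕ.^ M)) → Fin M → Bool
  bits zero    i = false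
  bits (suc a) i = toBit (finToFun {2} {M} a i)

  subtree : (Fin M → Bool) → Fin (suc (2 ℕ.^ M))
  subtree b = suc (funToFin (fromBit ∘ b))

  bits-subtree : ∀ b i → bits (subtree b) i ≡ b i
  bits-subtree b i = ≡.trans (≡.cong toBit (Finₚ.finToFun-funToFin (fromBit ∘ b) i)) (inverse (b i))
    where
    inverse : ∀ x → toBit (fromBit x) ≡ x
    inverse false = ≡.refl
    inverse true  = ≡.refl

  H : HST R 2
  H = record
    { tree = node (2 ℕ.^ M) λ _ → node M λ _ → leaf
    ; weight = λ { zero → 1# ; (suc _) → fromℕ M }
    ; weight-pos = λ { zero → 0<1 ; (suc _) → fromℕ-pos M′ } }
  open HST H

  -- Leaf `zero` of a subtree lies in all set types, which keeps these non-empty for any `S`, but in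
  -- neither bit type, so it serves no complete block.
  contains : Fin (2 ℕ.+ n) → Point → Bool
  contains zero          (a , zero  , _) = false
  contains (suc zero)    (a , zero  , _) = false
  contains (suc (suc r)) (a , zero  , _) = true
  contains zero          (a , suc i , _) = not (bits a i)
  contains (suc zero)    (a , suc i , _) = bits a i
  contains (suc (suc r)) (a , suc i , _) = lookup (S i) r

  K : RequestTypes R H (2 ℕ.+ n)
  K = record { member = contains ; nonEmpty = λ
    { zero          → (zero , suc zero , tt) , ≡.refl
    ; (suc zero)    → (subtree (λ _ → true) , suc zero , tt) , bits-subtree (λ _ → true) zero
    ; (suc (suc r)) → (zero , zero , tt) , ≡.refl } }

  near far : ℕ
  near = 2
  far  = 2 ℕ.+ 2 ℕ.* M

  dist : Point → Point → ℕ
  dist (a , l , _) (a′ , l′ , _) with a Fin.≟ a′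
  ... | no  _ = far
  ... | yes _ with l Fin.≟ l′
  ...   | yes _ = 0
  ...   | no  _ = near

  d≈dist : ∀ x y → d R H x y ≈ fromℕ (dist x y)
  d≈dist (a , l , _) (a′ , l′ , _) with a Fin.≟ a′
  ... | no  _ = ≈-trans (solve 1 (λ w → ((con 0 :+ con 1) :+ w) :+ ((con 0 :+ con 1) :+ w)
                                      := con 1 :+ (con 1 :+ (w :+ (w :+ con 0)))) ≈-refl (fromℕ M))
                  (+-congˡ (+-congˡ (≈-trans (+-congˡ (≈-sym (fromℕ-+ M 0))) (≈-sym (fromℕ-+ M (M ℕ.+ 0))))))
  ... | yes ≡.refl with l Fin.≟ l′
  ...   | yes ≡.refl = ≈-refl
  ...   | no  _ = solve 0 ((con 0 :+ con 1) :+ (con 0 :+ con 1) := con 1 :+ (con 1 :+ con 0)) ≈-refl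

  dist-refl : ∀ x → dist x x ≡ 0
  dist-refl (a , l , _) with a Fin.≟ a
  ... | no ¬p = ⊥-elim (¬p ≡.refl)
  ... | yes _ with l Fin.≟ l
  ...   | yes _ = ≡.refl
  ...   | no ¬p = ⊥-elim (¬p ≡.refl)

  dist-near : ∀ a l l′ → dist (a , l) (a , l′) ℕ.≤ near
  dist-near a (l , _) (l′ , _) with a Fin.≟ a
  ... | no ¬p = ⊥-elim (¬p ≡.refl)
  ... | yes _ with l Fin.≟ l′
  ...   | yes _ = z≤n
  ...   | no _  = ℕₚ.≤-refl

  dist-far : ∀ x y → dist x y ℕ.≤ far
  dist-far (a , l , _) (a′ , l′ , _) with a Fin.≟ a′
  ... | no  _ = ℕₚ.≤-refl
  ... | yes _ with l Fin.≟ l′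
  ...   | yes _ = z≤n
  ...   | no  _ = ℕₚ.m≤m+n 2 (2 ℕ.* M)

  data Move : Point → Point → ℕ → Set where
    stay  : ∀ {x} → Move x x 0
    local : ∀ {a l l′} → Move (a , l) (a , l′) near
    jump  : ∀ {x y} → Move x y far

  move : ∀ x y → Move x y (dist x y)
  move (a , l , _) (a′ , l′ , _) with a Fin.≟ a′
  ... | no  _ = jump
  ... | yes ≡.refl with l Fin.≟ l′
  ...   | yes ≡.refl = stay
  ...   | no  _ = local

  open Yao H K dist d≈dist

  bitType : Bool → Fin (2 ℕ.+ n)
  bitType false = zero
  bitType true  = suc zero

  setType : Fin n → Fin (2 ℕ.+ n)
  setType r = suc (suc r)

  inSet? : ∀ i (r : Fin n) → Dec (lookup (S i) r ≡ true)
  inSet? i r = lookup (S i) r Boolₚ.≟ true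

  block : Fin M → Bool → List (Fin (2 ℕ.+ n))
  block i b = bitType b ∷ List.map setType (List.filter (inSet? i) (List.allFin n))

  block-served : ∀ i b a → bits a i ≡ b → ∀ {r} → r ∈ block i b → contains r (a , suc i , tt) ≡ true
  block-served i false a e (here ≡.refl) = ≡.cong not e
  block-served i true  a e (here ≡.refl) = e
  block-served i b     a e (there r∈) with ∈-map⁻ setType r∈
  ... | r , r∈′ , ≡.refl = proj₂ (∈-filter⁻ (inSet? i) {xs = List.allFin n} r∈′)

  -- In a subtree with the wrong bit, leaf `zero` and the leaf of `i` miss the bit type, and the
  -- leaf of another `j` misses a type of `S i` by the antichain property.
  block-missed : ∀ i b a → bits a i ≢ b → ∀ l → ∃[ r ] r ∈ block i b × contains r (a , l) ≡ false
  block-missed i false a ≢b (zero , _) = zero , here ≡.refl , ≡.refl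
  block-missed i true  a ≢b (zero , _) = suc zero , here ≡.refl , ≡.refl
  block-missed i b a ≢b (suc j , _) with i Fin.≟ j
  block-missed i false a ≢b (suc j , _) | yes ≡.refl = zero , here ≡.refl , flip
    where
    flip : not (bits a i) ≡ false
    flip with bits a i
    ... | true  = ≡.refl
    ... | false = ⊥-elim (≢b ≡.refl)
  block-missed i true a ≢b (suc j , _) | yes ≡.refl = suc zero , here ≡.refl , flip
    where
    flip : bits a i ≡ false
    flip with bits a i
    ... | true  = ⊥-elim (≢b ≡.refl)
    ... | false = ≡.refl
  ... | no i≢j with antichain i j i≢j
  ...   | r , r∈ , r∉ = suc (suc r) , there (∈-map⁺ setType (∈-filter⁺ (inSet? i) (∈-allFin r) r∈)) , r∉

  asks : List (Fin (2 ℕ.+ n)) → Game → Game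
  asks rs g = List.foldr ask g rs

  module _ {i : Fin M} {b : Bool} {g : Game} {N : ℕ} (φ : ∀ x → Forces g x N) where

    -- Both claims are proved together. A leaf that misses a request still to come must be left at
    -- cost 2 or more; after a local move only the cheap claim is needed, and a jump is covered by
    -- the hypothesis on `far`.
    Forces-missing : ∀ rs {g′ Q} → (∀ x → Forces g′ x N) → 2 ℕ.+ Q ℕ.≤ far ℕ.+ N →
      (∀ {a} l → bits a i ≢ b → Forces g′ (a , l) Q) → ∀ {a} l → bits a i ≢ b →
      Forces (asks rs g′) (a , l) Q ×
      (∀ {r} → r ∈ rs → contains r (a , l) ≡ false → Forces (asks rs g′) (a , l) (2 ℕ.+ Q))
    Forces-missing [] ψ le φ′ l ≢b = φ′ l ≢b , λ ()
    Forces-missing (r ∷ rs) {g′} {Q} ψ le φ′ {a} l ≢b = cheap , dear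
      where
      rec = λ l → Forces-missing rs ψ le φ′ {a} l ≢b
      cheap : Forces (asks (r ∷ rs) g′) (a , l) Q
      cheap x x∈r with dist (a , l) x | move (a , l) x
      ... | _ | stay {.(a , l)} = Q , proj₁ (rec l) , ℕₚ.≤-refl
      ... | _ | local {l′ = l′} = Q , proj₁ (rec l′) , ℕₚ.m≤n+m Q 2
      ... | _ | jump = N , Forces-asks rs ψ x , ℕₚ.≤-trans (ℕₚ.m≤n+m Q 2) le
      dear : ∀ {r′} → r′ ∈ (r ∷ rs) → contains r′ (a , l) ≡ false →
        Forces (asks (r ∷ rs) g′) (a , l) (2 ℕ.+ Q)
      dear r′∈ r′∌ x x∈r with dist (a , l) x | move (a , l) x
      dear (here ≡.refl) r′∌ x x∈r | _ | stay = case ≡.trans (≡.sym x∈r) r′∌ of λ ()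
      dear (there r′∈)   r′∌ x x∈r | _ | stay = 2 ℕ.+ Q , proj₂ (rec l) r′∈ r′∌ , ℕₚ.≤-refl
      ... | _ | local {l′ = l′} = Q , proj₁ (rec l′) , ℕₚ.≤-refl
      ... | _ | jump = N , Forces-asks rs ψ x , le

  blocks : Fin M → Bool → ℕ → List (Fin (2 ℕ.+ n))
  blocks i b q = List.concat (List.replicate q (block i b))

  Forces-blocks : ∀ {i b g N} → (∀ x → Forces g x N) → ∀ q → q ℕ.≤ suc M → ∀ {a} l → bits a i ≢ b →
    Forces (asks (blocks i b q) g) (a , l) (2 ℕ.* q ℕ.+ N)
  Forces-blocks φ zero _ {a} l ≢b = φ (a , l)
  Forces-blocks {i} {b} {g} {N} φ (suc q) (s≤s q≤M) {a} l ≢b = ≡.subst₂ (λ g n → Forces g (a , l) n)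
    (≡.sym (Listₚ.foldr-++ ask g (block i b) (blocks i b q))) (budget q N)
    (case block-missed i b a ≢b l of λ (r , r∈ , r∌) →
      proj₂ (Forces-missing φ (block i b) (Forces-asks (blocks i b q) φ)
        (≡.subst (ℕ._≤ far ℕ.+ N) (ℕₚ.+-assoc 2 (2 ℕ.* q) N)
          (ℕₚ.+-monoˡ-≤ N (ℕₚ.+-monoʳ-≤ 2 (ℕₚ.*-monoʳ-≤ 2 q≤M))))
        (Forces-blocks φ q (ℕₚ.m≤n⇒m≤1+n q≤M)) l ≢b) r∈ r∌)
    where
    budget : ∀ q N → 2 ℕ.+ (2 ℕ.* q ℕ.+ N) ≡ 2 ℕ.* suc q ℕ.+ N
    budget = solve-∀

  -- With `suc M` repetitions, staying in a wrong subtree costs 2 (M + 1), which is exactly `far`: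
  -- it gains nothing over jumping.
  round : Fin M → Bool → List (Fin (2 ℕ.+ n))
  round i b = blocks i b (suc M)

  roundGame : Fin M → Game → Game
  roundGame i g = toss (asks (round i false) g) (asks (round i true) g)

  -- The subtree occupied when the coin falls has the wrong bit with probability 1/2, so half of 2
  -- (M + 1) is forced.
  Forces-round : ∀ i {g N} → (∀ x → Forces g x N) → ∀ x → Forces (roundGame i g) x (N ℕ.+ suc M)
  Forces-round i {g} {N} φ (a , l) with bits a i in eq
  ... | true = 2 ℕ.* suc M ℕ.+ N , N
             , Forces-blocks φ (suc M) ℕₚ.≤-refl {a} l (λ e → case ≡.trans (≡.sym eq) e of λ ())
             , Forces-asks (round i true) φ (a , l) , ℕₚ.≤-reflexive (budget N (suc M))
    where
    budget : ∀ N m → 2 ℕ.* (N ℕ.+ m) ≡ 2 ℕ.* m ℕ.+ N ℕ.+ N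
    budget = solve-∀
  ... | false = N , 2 ℕ.* suc M ℕ.+ N , Forces-asks (round i false) φ (a , l)
              , Forces-blocks φ (suc M) ℕₚ.≤-refl {a} l (λ e → case ≡.trans (≡.sym eq) e of λ ())
              , ℕₚ.≤-reflexive (budget N (suc M))
    where
    budget : ∀ N m → 2 ℕ.* (N ℕ.+ m) ≡ N ℕ.+ (2 ℕ.* m ℕ.+ N)
    budget = solve-∀

  roundsGame : ∀ {k} → (Fin k → Fin M) → Game → Game
  roundsGame {zero}  ι g = g
  roundsGame {suc k} ι g = roundGame (ι zero) (roundsGame (ι ∘ suc) g)

  Forces-rounds : ∀ {k} (ι : Fin k → Fin M) {g N} → (∀ x → Forces g x N) →
    ∀ x → Forces (roundsGame ι g) x (k ℕ.* suc M ℕ.+ N)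
  Forces-rounds {zero}  ι φ = φ
  Forces-rounds {suc k} ι {g} {N} φ x = ≡.subst (Forces (roundsGame ι g) x) (budget (k ℕ.* suc M) N (suc M))
    (Forces-round (ι zero) (Forces-rounds (ι ∘ suc) φ) x)
    where
    budget : ∀ a N m → a ℕ.+ N ℕ.+ m ≡ m ℕ.+ a ℕ.+ N
    budget = solve-∀

  phases : ℕ → Game
  phases zero    = done
  phases (suc L) = roundsGame id (phases L)

  Forces-phases : ∀ L x → Forces (phases L) x (L ℕ.* (M ℕ.* suc M))
  Forces-phases zero    x = ≡.refl
  Forces-phases (suc L) x = Forces-rounds id (Forces-phases L) x

  Servable : List (Fin (2 ℕ.+ n)) → Point → ℕ → Set
  Servable ρ s c = ∃[ σ ] Feasible R H K ρ σ × costℕ s σ ℕ.≤ c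

  serve : ∀ {r rs x ρ c} → (∀ {r′} → r′ ∈ (r ∷ rs) → contains r′ x ≡ true) → Servable ρ x c →
    ∀ s → Servable ((r ∷ rs) ++ ρ) s (dist s x ℕ.+ c)
  serve {rs = []} {x} {c = c} ok (σ , feas , le) s =
    x ∷ σ , ok (here ≡.refl) ∷ feas , ℕₚ.+-monoʳ-≤ (dist s x) le
  serve {rs = r ∷ rs} {x} {c = c} ok srv s with serve {r = r} {rs = rs} (ok ∘ there) srv x
  ... | σ , feas , le = x ∷ σ , ok (here ≡.refl) ∷ feas ,
        ℕₚ.+-monoʳ-≤ (dist s x) (≡.subst (λ z → costℕ x σ ℕ.≤ z ℕ.+ c) (dist-refl x) le)

  round-served : ∀ i b a → bits a i ≡ b → ∀ q {r} → r ∈ blocks i b q → contains r (a , suc i , tt) ≡ true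
  round-served i b a e (suc q) r∈ with ∈-++⁻ (block i b) r∈
  ... | inj₁ r∈′ = block-served i b a e r∈′
  ... | inj₂ r∈′ = round-served i b a e q r∈′

  Play-asks : ∀ rs {g ρ} → Play (asks rs g) ρ → ∃[ ρ′ ] ρ ≡ rs ++ ρ′ × Play g ρ′
  Play-asks []       play       = _ , ≡.refl , play
  Play-asks (r ∷ rs) (ask play) with Play-asks rs play
  ... | ρ′ , ≡.refl , play′ = ρ′ , ≡.refl , play′

  Play-round : ∀ i {g ρ} → Play (roundGame i g) ρ → ∃[ b ] ∃[ ρ′ ] ρ ≡ round i b ++ ρ′ × Play g ρ′
  Play-round i (left play)  = false , Play-asks (round i false) play
  Play-round i (right play) = true , Play-asks (round i true) play

  cons : ∀ {k} → Bool → (Fin k → Bool) → Fin (suc k) → Bool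
  cons b f zero    = b
  cons b f (suc i) = f i

  -- Knowing all coin tosses of the phase, the offline player only needs a
  -- single subtree a.
  play-bits : ∀ {k} (ι : Fin k → Fin M) {g ρ} → Play (roundsGame ι g) ρ → ∀ {B} →
    (∀ {ρ} → Play g ρ → ∀ s → Servable ρ s B) →
    Σ (Fin k → Bool) λ b → ∀ a → (∀ i → bits a (ι i) ≡ b i) → ∀ s c → (∀ l → dist s (a , l) ℕ.≤ near ℕ.+ c) →
      Servable ρ s (c ℕ.+ k ℕ.* near ℕ.+ B)
  play-bits {zero} ι play {B} srv = (λ ()) , λ a _ s c _ → case srv play s of λ
    (σ , feas , le) → σ , feas , ℕₚ.≤-trans le (ℕₚ.m≤n+m B (c ℕ.+ 0))
  play-bits {suc k} ι {g} play {B} srv with Play-round (ι zero) play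
  ... | b , ρ′ , ≡.refl , play′ with play-bits (ι ∘ suc) play′ srv
  ...   | bs , srv′ = cons b bs , λ a ok s c near-s →
    case serve (round-served (ι zero) b a (ok zero) (suc M))
      (srv′ a (ok ∘ suc) (a , suc (ι zero) , tt) 0 (λ l → dist-near a _ l)) s of λ
    (σ , feas , le) → σ , feas , ℕₚ.≤-trans le (ℕₚ.≤-trans
      (ℕₚ.+-monoˡ-≤ (k ℕ.* near ℕ.+ B) (near-s (suc (ι zero) , tt)))
      (ℕₚ.≤-reflexive (budget near c (k ℕ.* near) B)))
    where
    budget : ∀ d c e B → d ℕ.+ c ℕ.+ (e ℕ.+ B) ≡ c ℕ.+ (d ℕ.+ e) ℕ.+ B
    budget = solve-∀

  -- Per phase: the first move costs at most `far`, which is `near` plus 2 M, and each other round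
  -- one move of cost `near`, in all 4 M.
  offline : ∀ L {ρ} → Play (phases L) ρ → ∀ s → Servable ρ s (L ℕ.* (4 ℕ.* M))
  offline zero    done s = [] , [] , z≤n
  offline (suc L) play s with play-bits id play (offline L)
  ... | b , srv with srv (subtree b) (bits-subtree b) s (2 ℕ.* M) (λ l → dist-far s (subtree b , l))
  ...   | σ , feas , le = σ , feas , ℕₚ.≤-trans le (ℕₚ.≤-reflexive (budget M (L ℕ.* (4 ℕ.* M))))
    where
    budget : ∀ m B → 2 ℕ.* m ℕ.+ m ℕ.* 2 ℕ.+ B ≡ 4 ℕ.* m ℕ.+ B
    budget = solve-∀

  -- Over L phases the ratio is at least (M + 1) / 4 up to the additive
  -- constant, which is negligible for large L.
  ratio-lower : ∀ {c} → Ratios R 2 (2 ℕ.+ n) c → fromℕ M ≤ fromℕ 8 * c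
  ratio-lower {c} ratios 8c<M with ratios H K
  ... | A , β , ratio with archimedean (fromℕ 8 * β)
  ...   | L , 8β<L = ≤-trans (fromℕ-mono-≤ enough) (≤-trans (≤-reflexive (fromℕ-* 8 forcedCost)) scaled)
            (<-respʳ-≈ (≈-sym (fromℕ-+ (M ℕ.* served) L))
              (<-respˡ-≈ (+-comm _ _) (<-respʳ-≈ (+-comm _ _) (+-monoˡ-< (fromℕ (M ℕ.* served)) 8β<L))))
    where
    forcedCost = L ℕ.* (M ℕ.* suc M)
    served = L ℕ.* (4 ℕ.* M)
    8>0 = fromℕ-pos 7
    a = recip 8>0 * fromℕ M
    8a≈M : fromℕ 8 * a ≈ fromℕ M
    8a≈M = ≈-trans (≈-sym (*-assoc _ _ _)) (≈-trans (*-congʳ (recip-inverseʳ 8>0)) (*-identityˡ _))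
    a≥0 : 0# ≤ a
    a≥0 = 0≤* (<⇒≤ (recip-pos 8>0)) (fromℕ-nonneg M)
    c≤a : c ≤ a
    c≤a = *-cancelˡ-≤ 8>0 (≤-trans (<⇒≤ 8c<M) (≤-reflexive (≈-sym 8a≈M)))
    bound : fromℕ forcedCost ≤ a * fromℕ served + β
    bound = yao A (phases L) {s = zero , zero , tt} (Forces-phases L (zero , zero , tt))
      (λ play → offline L play (zero , zero , tt)) a≥0 c≤a ratio
    scaled : fromℕ 8 * fromℕ forcedCost ≤ fromℕ (M ℕ.* served) + fromℕ 8 * β
    scaled = ≤-trans (*-monoʳ-≤ (<⇒≤ 8>0) bound) (≤-reflexive (≈-trans
      (solve 4 (λ e a f b → e :* (a :* f :+ b) := (e :* a) :* f :+ e :* b) ≈-refl (fromℕ 8) a (fromℕ served) β)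
      (+-congʳ (≈-trans (*-congʳ 8a≈M) (≈-sym (fromℕ-* M served))))))
    split : ∀ L m → 8 ℕ.* (L ℕ.* (suc m ℕ.* suc (suc m)))
          ≡ suc m ℕ.* (L ℕ.* (4 ℕ.* suc m)) ℕ.+ L ℕ.+ L ℕ.* (4 ℕ.* m ℕ.* m ℕ.+ 16 ℕ.* m ℕ.+ 11)
    split = solve-∀
    enough : M ℕ.* served ℕ.+ L ℕ.≤ 8 ℕ.* forcedCost
    enough = ℕₚ.≤-trans (ℕₚ.m≤m+n _ _) (ℕₚ.≤-reflexive (≡.sym (split L M′)))

-- Natural weights and random choice among tokens

total : ∀ {n} → (Fin n → ℕ) → ℕ
total {zero}  f = 0
total {suc n} f = f zero ℕ.+ total (f ∘ suc)

≤-total : ∀ {n} (f : Fin n → ℕ) i → f i ℕ.≤ total f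
≤-total f zero    = ℕₚ.m≤m+n (f zero) _
≤-total f (suc i) = ℕₚ.≤-trans (≤-total (f ∘ suc) i) (ℕₚ.m≤n+m _ (f zero))

total-≤ : ∀ {n} (f : Fin n → ℕ) b → (∀ i → f i ℕ.≤ b) → total f ℕ.≤ n ℕ.* b
total-≤ {zero}  f b f≤b = z≤n
total-≤ {suc n} f b f≤b = ℕₚ.+-mono-≤ (f≤b zero) (total-≤ (f ∘ suc) b (f≤b ∘ suc))

total-cong : ∀ {n} {f g : Fin n → ℕ} → (∀ i → f i ≡ g i) → total f ≡ total g
total-cong {zero}  f≡g = ≡.refl
total-cong {suc n} f≡g = ≡.cong₂ ℕ._+_ (f≡g zero) (total-cong (f≡g ∘ suc))

total-+ : ∀ {n} (f g : Fin n → ℕ) → total (λ i → f i ℕ.+ g i) ≡ total f ℕ.+ total g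
total-+ {zero}  f g = ≡.refl
total-+ {suc n} f g = ≡.trans (≡.cong (f zero ℕ.+ g zero ℕ.+_) (total-+ (f ∘ suc) (g ∘ suc)))
  (interchange (f zero) (g zero) (total (f ∘ suc)) (total (g ∘ suc)))
  where
  interchange : ∀ a b c d → a ℕ.+ b ℕ.+ (c ℕ.+ d) ≡ a ℕ.+ c ℕ.+ (b ℕ.+ d)
  interchange = solve-∀

total-nonzero : ∀ {n} (f : Fin n → ℕ) → total f ≢ 0 → ∃[ i ] f i ≢ 0
total-nonzero {zero}  f ≢0 = ⊥-elim (≢0 ≡.refl)
total-nonzero {suc n} f ≢0 with f zero in eq
... | suc _ = zero , λ e → case ≡.trans (≡.sym eq) e of λ ()
... | zero with total-nonzero (f ∘ suc) ≢0
...   | i , p = suc i , p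

module Mixtures (R : RealNumbers) where
  open Ordered R
  open Leaves R

  fromℕ-total : ∀ {n} (f : Fin n → ℕ) → sum (fromℕ ∘ f) ≈ fromℕ (total f)
  fromℕ-total {zero}  f = ≈-refl
  fromℕ-total {suc n} f = ≈-trans (+-congˡ (fromℕ-total (f ∘ suc))) (≈-sym (fromℕ-+ (f zero) _))

  pointMass : ∀ {k} (t : Tree k) → Leaf t → Leaf t → ℝ
  pointMass leaf       _       _       = 1#
  pointMass (node n t) (i , x) (j , y) with i Fin.≟ j
  ... | yes ≡.refl = pointMass (t i) x y
  ... | no  _      = 0#

  pointMass-nonneg : ∀ {k} (t : Tree k) x y → 0# ≤ pointMass t x y
  pointMass-nonneg leaf       _       _       = <⇒≤ 0<1
  pointMass-nonneg (node n t) (i , x) (j , y) with i Fin.≟ j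
  ... | yes ≡.refl = pointMass-nonneg (t i) x y
  ... | no  _      = ≤-refl

  pointMass-≢ : ∀ {k} (t : Tree k) x y → x ≢ y → pointMass t x y ≈ 0#
  pointMass-≢ leaf       _       _       x≢y = ⊥-elim (x≢y ≡.refl)
  pointMass-≢ (node n t) (i , x) (j , y) x≢y with i Fin.≟ j
  ... | yes ≡.refl = pointMass-≢ (t i) x y (x≢y ∘ ≡.cong (i ,_))
  ... | no  _      = ≈-refl

  sumLeaves-zero : ∀ {k} (t : Tree k) {f : Leaf t → ℝ} → (∀ x → f x ≈ 0#) → sumLeaves R t f ≈ 0#
  sumLeaves-zero leaf       f≈0 = f≈0 tt
  sumLeaves-zero (node n t) f≈0 = sum-zero λ i → sumLeaves-zero (t i) λ x → f≈0 (i , x)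

  sumLeaves-pointMass : ∀ {k} (t : Tree k) x (f : Leaf t → ℝ) →
    sumLeaves R t (λ y → pointMass t x y * f y) ≈ f x
  sumLeaves-pointMass leaf       x       f = *-identityˡ (f x)
  sumLeaves-pointMass (node n t) (i , x) f = ≈-trans (sum-single branch i off) on
    where
    branch : Fin (suc n) → ℝ
    branch j = sumLeaves R (t j) λ y → pointMass (node n t) (i , x) (j , y) * f (j , y)
    off : ∀ j → j ≢ i → branch j ≈ 0#
    off j j≢i = sumLeaves-zero (t j) λ y → ≈-trans
      (*-congʳ (pointMass-≢ (node n t) (i , x) (j , y) λ { ≡.refl → j≢i ≡.refl })) (zeroˡ _)
    on : branch i ≈ f (i , x)
    on with i Fin.≟ i
    ... | yes ≡.refl = sumLeaves-pointMass (t i) x (λ y → f (i , y))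
    ... | no  i≢i    = ⊥-elim (i≢i ≡.refl)

  sumLeaves-sum : ∀ {k} (t : Tree k) {n} (g : Fin n → Leaf t → ℝ) →
    sumLeaves R t (λ x → sum λ c → g c x) ≈ sum λ c → sumLeaves R t (g c)
  sumLeaves-sum t {zero}  g = sumLeaves-zero t λ _ → ≈-refl
  sumLeaves-sum t {suc n} g = ≈-trans (sumLeaves-+ t (g zero) (λ x → sum λ c → g (suc c) x))
    (+-congˡ (sumLeaves-sum t (g ∘ suc)))

  module _ {k m} {H : HST R k} {K : RequestTypes R H m} {r : Fin m} where
    open HST H
    open RequestTypes K

    module Mixture {n} (p : Fin n → ℝ) (p≥0 : ∀ c → 0# ≤ p c) (Σp≈1 : sum p ≈ 1#)
      (point : Fin n → Point) (served : ∀ c → member r (point c) ≡ true) where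

      prob : Point → ℝ
      prob x = sum λ c → p c * pointMass tree (point c) x

      expectation : ∀ f → sumLeaves R tree (λ x → prob x * f x) ≈ sum λ c → p c * f (point c)
      expectation f = ≈-trans (sumLeaves-cong tree swap)
        (≈-trans (sumLeaves-sum tree (λ c x → p c * (pointMass tree (point c) x * f x)))
          (sum-cong-≋ λ c → ≈-trans (sumLeaves-* tree (p c) (λ x → pointMass tree (point c) x * f x))
            (*-congˡ (sumLeaves-pointMass tree (point c) f))))
        where
        swap : ∀ x → prob x * f x ≈ sum λ c → p c * (pointMass tree (point c) x * f x)
        swap x = ≈-trans (*-comm _ _) (≈-trans (*-distribˡ-sum (f x) (λ c → p c * pointMass tree (point c) x))
          (sum-cong-≋ λ c → solve 3 (λ f p q → f :* (p :* q) := p :* (q :* f)) ≈-refl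
            (f x) (p c) (pointMass tree (point c) x)))

      mixture : Distribution R H K r
      mixture = record
        { prob        = prob
        ; nonNegative = λ x → sum-nonneg λ c → 0≤* (p≥0 c) (pointMass-nonneg tree (point c) x)
        ; total       = ≈-trans (sumLeaves-cong tree λ x → ≈-sym (*-identityʳ (prob x)))
            (≈-trans (expectation (λ _ → 1#)) (≈-trans (sum-cong-≋ λ c → *-identityʳ (p c)) Σp≈1))
        ; supported   = λ x x∉r → sum-zero λ c → ≈-trans
            (*-congˡ (pointMass-≢ tree (point c) x λ { ≡.refl → x∉r (served c) })) (zeroʳ (p c)) }

  record Coin : Set where
    field
      keep leave : ℝ
      keep≥0     : 0# ≤ keep
      leave≥0    : 0# ≤ leave
      keep+leave : keep + leave ≈ 1#

  leaveCoin : Coin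
  leaveCoin = record { keep = 0# ; leave = 1# ; keep≥0 = ≤-refl ; leave≥0 = <⇒≤ 0<1
                     ; keep+leave = +-identityˡ 1# }

  -- Keeps with probability `w′` / `w`. If tokens are held in proportion to old weights, those kept
  -- retain their new weights and the rest is resampled by new weights, so the proportion is
  -- maintained. A zero or growing weight gets the default `leaveCoin`.
  survival : ℕ → ℕ → Coin
  survival zero    w′ = leaveCoin
  survival (suc w) w′ with w′ ℕ.≤? suc w
  ... | no  _  = leaveCoin
  ... | yes le = record
    { keep    = fromℕ w′ * u
    ; leave   = fromℕ (suc w ℕ.∸ w′) * u
    ; keep≥0  = 0≤* (fromℕ-nonneg w′) u≥0
    ; leave≥0 = 0≤* (fromℕ-nonneg (suc w ℕ.∸ w′)) u≥0
    ; keep+leave = ≈-trans (≈-sym (distribʳ u _ _)) (≈-trans (*-congʳ (≈-trans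
        (≈-sym (fromℕ-+ w′ (suc w ℕ.∸ w′))) (fromℕ-cong (ℕₚ.m+[n∸m]≡n le))))
        (recip-inverseʳ (fromℕ-pos w))) }
    where
    u = recip (fromℕ-pos w)
    u≥0 = <⇒≤ (recip-pos (fromℕ-pos w))

  survival-keep : ∀ w w′ → w′ ℕ.≤ w → fromℕ w * Coin.keep (survival w w′) ≈ fromℕ w′
  survival-keep zero    zero z≤n = zeroʳ 0#
  survival-keep (suc w) w′   le with w′ ℕ.≤? suc w
  ... | no  nle = ⊥-elim (nle le)
  ... | yes _   = ≈-trans (solve 3 (λ w a u → w :* (a :* u) := a :* (w :* u)) ≈-refl (fromℕ (suc w)) (fromℕ w′) _)
                    (≈-trans (*-congˡ (recip-inverseʳ (fromℕ-pos w))) (*-identityʳ _))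

  survival-leave : ∀ w w′ → w′ ℕ.≤ w → fromℕ w * Coin.leave (survival w w′) ≈ fromℕ (w ℕ.∸ w′)
  survival-leave zero    zero z≤n = zeroˡ 1#
  survival-leave (suc w) w′   le with w′ ℕ.≤? suc w
  ... | no  nle = ⊥-elim (nle le)
  ... | yes _   = ≈-trans (solve 3 (λ w a u → w :* (a :* u) := a :* (w :* u)) ≈-refl
                      (fromℕ (suc w)) (fromℕ (suc w ℕ.∸ w′)) _)
                    (≈-trans (*-congˡ (recip-inverseʳ (fromℕ-pos w))) (*-identityʳ _))

  module Resampling {n} (w : Fin n → ℕ) (mass : total w ≢ 0) where

    inverse : ∃[ u ] 0# ≤ u × u * fromℕ (total w) ≈ 1#
    inverse = invert (total w) mass
      where
      invert : ∀ a → a ≢ 0 → ∃[ u ] 0# ≤ u × u * fromℕ a ≈ 1#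
      invert zero    a≢0 = ⊥-elim (a≢0 ≡.refl)
      invert (suc a) _   = recip (fromℕ-pos a) , <⇒≤ (recip-pos (fromℕ-pos a)) ,
        ≈-trans (*-comm _ _) (recip-inverseʳ (fromℕ-pos a))

    u : ℝ
    u = proj₁ inverse

    u≥0 : 0# ≤ u
    u≥0 = proj₁ (proj₂ inverse)

    u*total : u * fromℕ (total w) ≈ 1#
    u*total = proj₂ (proj₂ inverse)

    average : (Fin n → ℝ) → ℝ
    average f = u * sum λ j → fromℕ (w j) * f j

    average-upper : ∀ f b → sum (λ j → fromℕ (w j) * f j) ≤ fromℕ (total w) * b → average f ≤ b
    average-upper f b le = ≤-trans (*-monoʳ-≤ u≥0 le) (≤-reflexive
      (≈-trans (≈-sym (*-assoc _ _ _)) (≈-trans (*-congʳ u*total) (*-identityˡ b))))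

    module _ (coin : Coin) (c : Fin n) where
      open Coin coin

      indicator : Fin n → ℝ
      indicator j with j Fin.≟ c
      ... | yes _ = 1#
      ... | no  _ = 0#

      law : Fin n → ℝ
      law j = keep * indicator j + leave * (u * fromℕ (w j))

      law≥0 : ∀ j → 0# ≤ law j
      law≥0 j = 0≤+ (0≤* keep≥0 ind≥0) (0≤* leave≥0 (0≤* u≥0 (fromℕ-nonneg (w j))))
        where
        ind≥0 : 0# ≤ indicator j
        ind≥0 with j Fin.≟ c
        ... | yes _ = <⇒≤ 0<1
        ... | no  _ = ≤-refl

      sum-indicator : ∀ (f : Fin n → ℝ) → sum (λ j → indicator j * f j) ≈ f c
      sum-indicator f = ≈-trans (sum-single (λ j → indicator j * f j) c off) on
        where
        off : ∀ j → j ≢ c → indicator j * f j ≈ 0#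
        off j j≢c with j Fin.≟ c
        ... | yes e = ⊥-elim (j≢c e)
        ... | no  _ = zeroˡ (f j)
        on : indicator c * f c ≈ f c
        on with c Fin.≟ c
        ... | yes _ = *-identityˡ (f c)
        ... | no  p = ⊥-elim (p ≡.refl)

      sum-law : ∀ (f : Fin n → ℝ) → sum (λ j → law j * f j) ≈ keep * f c + leave * average f
      sum-law f = ≈-trans (sum-cong-≋ λ j → solve 6 (λ k i l u w f →
            (k :* i :+ l :* (u :* w)) :* f := k :* (i :* f) :+ (l :* u) :* (w :* f)) ≈-refl
            keep (indicator j) leave u (fromℕ (w j)) (f j))
        (≈-trans (∑-distrib-+ (λ j → keep * (indicator j * f j)) (λ j → (leave * u) * (fromℕ (w j) * f j)))
          (+-cong (≈-trans (≈-sym (*-distribˡ-sum keep (λ j → indicator j * f j))) (*-congˡ (sum-indicator f)))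
            (≈-trans (≈-sym (*-distribˡ-sum (leave * u) (λ j → fromℕ (w j) * f j))) (*-assoc _ _ _))))

      sum-law-1 : sum law ≈ 1#
      sum-law-1 = ≈-trans (sum-cong-≋ λ j → ≈-sym (*-identityʳ (law j))) (≈-trans (sum-law (λ _ → 1#))
        (≈-trans (+-cong (*-identityʳ keep) (≈-trans (*-congˡ avg1) (*-identityʳ leave))) keep+leave))
        where
        avg1 : average (λ _ → 1#) ≈ 1#
        avg1 = ≈-trans (*-congˡ (≈-trans (sum-cong-≋ λ j → *-identityʳ (fromℕ (w j))) (fromℕ-total w))) u*total

-- A harmonic sum in place of the logarithm

module Harmonic (R : RealNumbers) (y : ℕ) where
  open Ordered R

  -- The sum of 1 / max(j, suc y) over 1 ≤ j ≤ n: a rational logarithm.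
  Λ : ℕ → ℝ
  Λ zero    = 0#
  Λ (suc j) = recip (fromℕ-pos (j ℕ.⊔ y)) + Λ j

  Λ-cong : ∀ {a b} → a ≡ b → Λ a ≈ Λ b
  Λ-cong ≡.refl = ≈-refl

  Λ-mono : ∀ z a → Λ a ≤ Λ (z ℕ.+ a)
  Λ-mono zero    a = ≤-refl
  Λ-mono (suc z) a = ≤-trans (Λ-mono z a) (≤-trans (x≤x+y (<⇒≤ (recip-pos (fromℕ-pos ((z ℕ.+ a) ℕ.⊔ y)))))
    (≤-reflexive (+-comm _ _)))

  Λ-nonneg : ∀ a → 0# ≤ Λ a
  Λ-nonneg a = ≤-trans (Λ-mono a 0) (≤-reflexive (Λ-cong (ℕₚ.+-identityʳ a)))

  -- Each of the `z` terms removed is at least 1 / b, as its denominator is at most `b`. So when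
  -- weight `z` leaves a total of `b`, the decrease of Λ pays the fraction z / b that moves.
  Λ-drop : ∀ {b} z a → suc y ℕ.≤ b → z ℕ.+ a ℕ.≤ b → fromℕ z + fromℕ b * Λ a ≤ fromℕ b * Λ (z ℕ.+ a)
  Λ-drop {b} zero    a _ _ = ≤-reflexive (+-identityˡ _)
  Λ-drop {b} (suc z) a y<b z+a<b = ≤-trans (≤-reflexive (+-assoc 1# (fromℕ z) _))
    (≤-trans (+-mono-≤ one (Λ-drop z a y<b (ℕₚ.<⇒≤ z+a<b))) (≤-reflexive (≈-sym (distribˡ _ _ _))))
    where
    pos = fromℕ-pos ((z ℕ.+ a) ℕ.⊔ y)
    one : 1# ≤ fromℕ b * recip pos
    one = ≤-trans (≤-reflexive (≈-sym (recip-inverseʳ pos)))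
      (*-monoˡ-≤ (<⇒≤ (recip-pos pos)) (fromℕ-mono-≤ (ℕₚ.⊔-lub z+a<b y<b)))

  Λ-rise : ∀ {b} z a → (∀ j → a ℕ.≤ j → b ℕ.≤ suc (j ℕ.⊔ y)) → fromℕ b * Λ (z ℕ.+ a) ≤ fromℕ z + fromℕ b * Λ a
  Λ-rise zero    a _  = ≤-reflexive (≈-sym (+-identityˡ _))
  Λ-rise {b} (suc z) a b≤ = ≤-trans (≤-reflexive (distribˡ _ _ _))
    (≤-trans (+-mono-≤ one (Λ-rise z a b≤)) (≤-reflexive (≈-sym (+-assoc 1# (fromℕ z) _))))
    where
    pos = fromℕ-pos ((z ℕ.+ a) ℕ.⊔ y)
    one : fromℕ b * recip pos ≤ 1#
    one = ≤-trans (*-monoˡ-≤ (<⇒≤ (recip-pos pos)) (fromℕ-mono-≤ (b≤ (z ℕ.+ a) (ℕₚ.m≤n+m a z))))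
      (≤-reflexive (recip-inverseʳ pos))

  Λ-double : ∀ a → 1 ℕ.≤ a → Λ (2 ℕ.* a) ≤ 1# + Λ a
  Λ-double (suc a) _ = *-cancelˡ-≤ (fromℕ-pos a) (≤-trans
    (≤-trans (≤-reflexive (*-congˡ (Λ-cong (≡.cong (suc a ℕ.+_) (ℕₚ.+-identityʳ (suc a))))))
      (Λ-rise {suc a} (suc a) (suc a) λ j le → ℕₚ.≤-trans (ℕₚ.m≤n⇒m≤1+n le) (s≤s (ℕₚ.m≤m⊔n j y))))
    (≤-reflexive (≈-trans (+-congʳ (≈-sym (*-identityʳ _))) (≈-sym (distribˡ _ _ _)))))

  Λ-suc-y : Λ (suc y) ≤ 1#
  Λ-suc-y = *-cancelˡ-≤ (fromℕ-pos y) (≤-trans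
    (≤-trans (≤-reflexive (*-congˡ (Λ-cong (≡.sym (ℕₚ.+-identityʳ (suc y))))))
      (Λ-rise {suc y} (suc y) 0 λ j _ → s≤s (ℕₚ.m≤n⊔m j y)))
    (≤-reflexive (≈-trans (+-congˡ (zeroʳ _)) (≈-trans (+-identityʳ _) (≈-sym (*-identityʳ _))))))

  -- The first `suc y` terms add up to at most 1, and each doubling adds at most 1.
  Λ-power : ∀ τ → Λ (2 ℕ.^ τ ℕ.* suc y) ≤ fromℕ (suc τ)
  Λ-power zero    = ≤-trans (≤-reflexive (Λ-cong (ℕₚ.*-identityˡ (suc y)))) (≤-trans Λ-suc-y (≤-reflexive (≈-sym fromℕ-1)))
  Λ-power (suc τ) = ≤-trans (≤-reflexive (Λ-cong (ℕₚ.*-assoc 2 (2 ℕ.^ τ) (suc y))))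
    (≤-trans (Λ-double (2 ℕ.^ τ ℕ.* suc y) (ℕₚ.*-mono-≤ (ℕₚ.m^n>0 2 τ) (s≤s (z≤n {y})))) (+-monoʳ-≤ 1# (Λ-power τ)))

  Λ-upper : ∀ τ a → a ℕ.≤ 2 ℕ.^ τ ℕ.* suc y → Λ a ≤ fromℕ (suc τ)
  Λ-upper τ a le = ≤-trans (Λ-mono (2 ℕ.^ τ ℕ.* suc y ℕ.∸ a) a)
    (≤-trans (≤-reflexive (Λ-cong (ℕₚ.m∸n+n≡m le))) (Λ-power τ))

true⊎false : ∀ b → b ≡ true ⊎ b ≡ false
true⊎false true  = inj₁ ≡.refl
true⊎false false = inj₂ ≡.refl

-- A competitive algorithm from decreasing weights

module WeightedTracking (R : RealNumbers) {k m : ℕ} {H : HST R k} (K : RequestTypes R H m) where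
  open Ordered R
  open Leaves R
  open Mixtures R
  open HST H using (tree; Point)
  open RequestTypes K

  -- An algorithm that keeps its state distributed over tokens proportionally
  -- to their weights.  Weights decrease until all are 0, when they are reset.
  -- The field progress compares an arbitrary offline player with credit.
  record Scheme : Set₁ where
    field
      tokens    : ℕ
      Info      : Set
      initial   : Info
      step      : Fin m → Info → Info
      continues : Fin m → Info → Bool
      weight    : Info → Fin tokens → ℕ
      position  : Fin m → Info → Fin tokens → Point
      token     : Point → Fin tokens
      credit    : Info → Point → ℕ

      diameter relocation unit : ℝ
      y τ span : ℕ

    mass : Info → ℕ
    mass ι = total (weight ι)

    field
      d≥0            : ∀ s x → 0# ≤ d R H s x
      d≤diameter     : ∀ s x → d R H s x ≤ diameter
      diameter≥0     : 0# ≤ diameter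
      relocation≥0   : 0# ≤ relocation
      unit≥0         : 0# ≤ unit
      initial-reset  : ∀ r → continues r initial ≡ false
      served         : ∀ r ι c → member r (position r ι c) ≡ true
      token-position : ∀ r ι c → weight (step r ι) c ≢ 0 → token (position r (step r ι) c) ≡ c
      mass-lower     : ∀ r ι → suc y ℕ.≤ mass (step r ι)
      mass-upper     : ∀ r ι → mass (step r ι) ℕ.≤ 2 ℕ.^ τ ℕ.* suc y
      decreasing     : ∀ r ι c → continues r ι ≡ true → weight (step r ι) c ℕ.≤ weight ι c
      relocate       : ∀ r r₀ ι₀ c → let ι = step r₀ ι₀ in continues r ι ≡ true →
        fromℕ (weight (step r ι) c) * d R H (position r₀ ι c) (position r (step r ι) c)
          ≤ fromℕ (weight ι c ℕ.∸ weight (step r ι) c) * relocation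
      progress       : ∀ r ι s x → member r x ≡ true → continues r ι ≡ true →
        fromℕ (credit (step r ι) x) * unit ≤ fromℕ (credit ι s) * unit + d R H s x
      progress-reset : ∀ r ι s x → member r x ≡ true → continues r ι ≡ false →
        fromℕ span * unit ≤ fromℕ (credit ι s) * unit + d R H s x
      credit-reset   : ∀ r ι x → member r x ≡ true → continues r ι ≡ false → credit (step r ι) x ≡ 0

  module _ (S : Scheme) where
    open Scheme S
    open Harmonic R y

    nonempty : ∀ r ι → mass (step r ι) ≢ 0
    nonempty r ι e = ℕₚ.<-irrefl (≡.sym e) (ℕₚ.≤-trans (s≤s z≤n) (mass-lower r ι))

    module Next (r : Fin m) (ι : Info) where
      ι′ : Info
      ι′ = step r ι
      open Resampling (weight ι′) (nonempty r ι) public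

      coin : Fin tokens → Coin
      coin c = if continues r ι then survival (weight ι c) (weight ι′ c) else leaveCoin

    info : History R H K → Info
    info []            = initial
    info ((r , _) ∷ h) = step r (info h)

    current : Point → History R H K → Point
    current s₀ []            = s₀
    current s₀ ((_ , x) ∷ _) = x

    module Choice (s₀ : Point) (h : History R H K) (r : Fin m) where
      open Next r (info h) public
      from : Fin tokens
      from = token (current s₀ h)
      open Mixture {K = K} {r = r} (law (coin from) from) (law≥0 (coin from) from) (sum-law-1 (coin from) from)
        (position r ι′) (served r ι′) public

    algorithm : Algorithm R H K
    algorithm s₀ h r = Choice.mixture s₀ h r

    -- The expected cost depends on the history only through `info` and the current state; this
    -- recursion expresses it over tokens instead of leaves.
    value : Info → Point → List (Fin m) → ℝ
    cost-to-go : ∀ r → Info → Point → List (Fin m) → Fin tokens → ℝ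
    value ι s []      = 0#
    value ι s (r ∷ ρ) = Coin.keep coin * cost-to-go r ι s ρ (token s)
                      + Coin.leave coin * average (cost-to-go r ι s ρ)
      where
      open Next r ι using (average)
      coin = Next.coin r ι (token s)
    cost-to-go r ι s ρ j = d R H s x + value (step r ι) x ρ
      where x = position r (step r ι) j

    expected≈value : ∀ s₀ ρ h → expectedCostFrom R H K algorithm s₀ h (current s₀ h) ρ ≈ value (info h) (current s₀ h) ρ
    expected≈value s₀ []      h = ≈-refl
    expected≈value s₀ (r ∷ ρ) h = ≈-trans
      (sumLeaves-cong tree λ x → *-congˡ (+-congˡ (expected≈value s₀ ρ ((r , x) ∷ h))))
      (≈-trans (expectation λ x → d R H (current s₀ h) x + value ι′ x ρ)
        (sum-law (coin from) from (cost-to-go r (info h) (current s₀ h) ρ)))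
      where open Choice s₀ h r

    -- The charge per unit of lost weight: a jump for the lost unit itself, and its share in the
    -- local moves of the weight that stays.
    move : ℝ
    move = diameter + relocation

    move≥0 : 0# ≤ move
    move≥0 = 0≤+ diameter≥0 relocation≥0

    weighted-upper : ∀ {n} (w : Fin n → ℕ) (f : Fin n → ℝ) b → (∀ c → w c ≢ 0 → f c ≤ b) →
      sum (λ c → fromℕ (w c) * f c) ≤ fromℕ (total w) * b
    weighted-upper w f b f≤b = ≤-trans (sum-mono pointwise) (≤-reflexive
      (≈-trans (sum-cong-≋ λ c → *-comm (fromℕ (w c)) b) (≈-trans (≈-sym (*-distribˡ-sum b (fromℕ ∘ w)))
        (≈-trans (*-congˡ (fromℕ-total w)) (*-comm b _)))))
      where
      pointwise : ∀ c → fromℕ (w c) * f c ≤ fromℕ (w c) * b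
      pointwise c with w c in eq
      ... | zero  = ≤-reflexive (≈-trans (zeroˡ _) (≈-sym (zeroˡ _)))
      ... | suc a = *-monoʳ-≤ (fromℕ-nonneg (suc a)) (f≤b c λ e → case ≡.trans (≡.sym eq) e of λ ())

    module _ {ratio : ℝ} (ratio≥0 : 0# ≤ ratio)
      (ratio-large : move * fromℕ (2 ℕ.+ τ) ≤ ratio * (fromℕ span * unit)) where

      -- The potential. Its first term pays for the rest of the phase; in the second, the credit
      -- records what the offline player has already paid in the phase.
      budget : Info → Point → ℝ → ℝ
      budget ι s c = move * Λ (mass ι) + ratio * (c + fromℕ (credit ι s) * unit)

      credit≥0 : ∀ ι s → 0# ≤ fromℕ (credit ι s) * unit
      credit≥0 ι s = 0≤* (fromℕ-nonneg (credit ι s)) unit≥0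

      budget≥0 : ∀ ι s {c} → 0# ≤ c → 0# ≤ budget ι s c
      budget≥0 ι s c≥0 = 0≤+ (0≤* move≥0 (Λ-nonneg (mass ι))) (0≤* ratio≥0 (0≤+ c≥0 (credit≥0 ι s)))

      module Round (r : Fin m) (ι : Info) (ρ : List (Fin m)) (b : ℝ)
        (ih : sum (λ j → fromℕ (weight (step r ι) j) * value (step r ι) (position r (step r ι) j) ρ)
                ≤ fromℕ (mass (step r ι)) * b) where
        open Next r ι

        W : ℝ
        W = fromℕ (mass ι′)

        average-jump : ∀ s → average (cost-to-go r ι s ρ) ≤ diameter + b
        average-jump s = average-upper (cost-to-go r ι s ρ) (diameter + b) (≤-trans (≤-reflexive split)
          (≤-trans (+-mono-≤ (weighted-upper (weight ι′) dist diameter λ j _ → d≤diameter s (position r ι′ j)) ih)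
            (≤-reflexive (≈-sym (distribˡ W diameter b)))))
          where
          dist future : Fin tokens → ℝ
          dist j   = d R H s (position r ι′ j)
          future j = value ι′ (position r ι′ j) ρ
          split : sum (λ j → fromℕ (weight ι′ j) * (dist j + future j)) ≈
                  sum (λ j → fromℕ (weight ι′ j) * dist j) + sum (λ j → fromℕ (weight ι′ j) * future j)
          split = ≈-trans (sum-cong-≋ λ j → distribˡ (fromℕ (weight ι′ j)) (dist j) (future j))
            (∑-distrib-+ (λ j → fromℕ (weight ι′ j) * dist j) (λ j → fromℕ (weight ι′ j) * future j))

        value-reset : continues r ι ≡ false → ∀ s → value ι s (r ∷ ρ) ≤ diameter + b
        value-reset e s rewrite e = ≤-trans (≤-reflexive (≈-trans (+-cong (zeroˡ _) (*-identityˡ _)) (+-identityˡ _)))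
          (average-jump s)

        lost : Fin tokens → ℕ
        lost c = weight ι c ℕ.∸ weight ι′ c

        weighted-continue : continues r ι ≡ true → ∀ r₀ ι₀ → ι ≡ step r₀ ι₀ →
          sum (λ c → fromℕ (weight ι c) * value ι (position r₀ ι c) (r ∷ ρ))
            ≤ W * b + fromℕ (total lost) * (move + b)
        weighted-continue e r₀ ι₀ ≡.refl = ≤-trans (sum-mono pointwise) (≤-trans (≤-reflexive
          (∑-distrib-+ (λ c → fromℕ (weight ι′ c) * value ι′ (position r ι′ c) ρ) (λ c → fromℕ (lost c) * (move + b))))
          (+-mono-≤ ih (weighted-upper lost (λ _ → move + b) (move + b) λ _ _ → ≤-refl)))
          where
          pointwise : ∀ c → fromℕ (weight ι c) * value ι (position r₀ ι c) (r ∷ ρ)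
                          ≤ fromℕ (weight ι′ c) * value ι′ (position r ι′ c) ρ + fromℕ (lost c) * (move + b)
          pointwise c with weight ι c ℕ.≟ 0
          ... | yes w≡0 = ≤-reflexive (≈-trans (≈-trans (*-congʳ (fromℕ-cong w≡0)) (zeroˡ _))
                  (≈-sym (≈-trans (+-cong (≈-trans (*-congʳ (fromℕ-cong w′≡0)) (zeroˡ _))
                    (≈-trans (*-congʳ (fromℕ-cong lost≡0)) (zeroˡ _))) (+-identityʳ 0#))))
            where
            w′≡0 : weight ι′ c ≡ 0
            w′≡0 = ℕₚ.n≤0⇒n≡0 (≡.subst (weight ι′ c ℕ.≤_) w≡0 (decreasing r ι c e))
            lost≡0 : lost c ≡ 0
            lost≡0 = ℕₚ.n≤0⇒n≡0 (≡.subst (lost c ℕ.≤_) w≡0 (ℕₚ.m∸n≤m (weight ι c) (weight ι′ c)))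
          -- A positive weight lets the position identify its token, so the coin tossed is the one
          -- of `c`. For weight zero this may fail, but there both sides vanish.
          ... | no w≢0 rewrite token-position r₀ ι₀ c w≢0 | e = ≤-trans (≤-reflexive expand)
              (≤-trans (+-mono-≤ (+-monoʳ-≤ _ (relocate r r₀ ι₀ c e)) (*-monoʳ-≤ (fromℕ-nonneg (lost c)) (average-jump s)))
                (≤-reflexive (solve 5 (λ p q l d b → (p :+ l :* q) :+ l :* (d :+ b) := p :+ l :* ((d :+ q) :+ b))
                  ≈-refl (fromℕ (weight ι′ c) * F) relocation (fromℕ (lost c)) diameter b)))
            where
            s = position r₀ ι c
            D = d R H s (position r ι′ c)
            F = value ι′ (position r ι′ c) ρ
            κ = survival (weight ι c) (weight ι′ c)
            le = decreasing r ι c e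
            avg = average (cost-to-go r ι s ρ)
            expand : fromℕ (weight ι c) * (Coin.keep κ * (D + F) + Coin.leave κ * avg)
                   ≈ (fromℕ (weight ι′ c) * F + fromℕ (weight ι′ c) * D) + fromℕ (lost c) * avg
            expand = ≈-trans (solve 6 (λ w k D F l a → w :* (k :* (D :+ F) :+ l :* a)
                                  := ((w :* k) :* F :+ (w :* k) :* D) :+ (w :* l) :* a) ≈-refl
                                (fromℕ (weight ι c)) (Coin.keep κ) D F (Coin.leave κ) avg)
              (+-cong (+-cong (*-congʳ (survival-keep (weight ι c) (weight ι′ c) le))
                              (*-congʳ (survival-keep (weight ι c) (weight ι′ c) le)))
                      (*-congʳ (survival-leave (weight ι c) (weight ι′ c) le)))

      -- A new phase costs one jump and then at most Λ ≤ 1 + τ times `move`; this is the 2 + τ of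
      -- `ratio-large`, paid by the `span` that the offline player spent on the old phase.
      budget-reset : ∀ r ι x {c} → member r x ≡ true → continues r ι ≡ false →
        diameter + budget (step r ι) x c ≤ ratio * (c + fromℕ span * unit)
      budget-reset r ι x {c} x∈r e = ≤-trans
        (+-mono-≤ (x≤x+y relocation≥0) (+-mono-≤ (*-monoʳ-≤ move≥0 (Λ-upper τ (mass (step r ι)) (mass-upper r ι)))
          (≤-reflexive (*-congˡ (≈-trans (+-congˡ (≈-trans (*-congʳ (fromℕ-cong (credit-reset r ι x x∈r e))) (zeroˡ unit)))
            (+-identityʳ c))))))
        (≤-trans (≤-reflexive (solve 4 (λ M t R c → M :+ (M :* t :+ R :* c) := M :* (con 1 :+ t) :+ R :* c) ≈-refl
            move (fromℕ (suc τ)) ratio c))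
          (≤-trans (+-monoˡ-≤ (ratio * c) ratio-large)
            (≤-reflexive (≈-trans (+-comm _ _) (≈-sym (distribˡ ratio c _))))))

      -- The induction behind the ratio. Averaging over tokens is essential: only on average does a
      -- drop of weight cost in proportion to the drop. The offline solution is arbitrary, so no
      -- optimum enters.
      weighted-value : ∀ r₀ ι₀ s ρ {σ} → Feasible R H K ρ σ →
        sum (λ c → fromℕ (weight (step r₀ ι₀) c) * value (step r₀ ι₀) (position r₀ (step r₀ ι₀) c) ρ)
          ≤ fromℕ (mass (step r₀ ι₀)) * budget (step r₀ ι₀) s (solutionCost R H s σ)
      weighted-value r₀ ι₀ s [] [] = ≤-trans (≤-reflexive (sum-zero λ c → zeroʳ (fromℕ (weight (step r₀ ι₀) c))))
        (0≤* (fromℕ-nonneg (mass (step r₀ ι₀))) (budget≥0 (step r₀ ι₀) s ≤-refl))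
      weighted-value r₀ ι₀ s (r ∷ ρ) {x ∷ σ} (x∈r ∷ feas) with true⊎false (continues r (step r₀ ι₀))
      ... | inj₂ e = weighted-upper (weight ι) (λ c → value ι (position r₀ ι c) (r ∷ ρ)) (budget ι s (δ + later)) λ c _ →
          ≤-trans (value-reset e (position r₀ ι c)) (≤-trans (budget-reset r ι x x∈r e)
            (≤-trans (*-monoʳ-≤ ratio≥0 (≤-trans (+-monoʳ-≤ later (progress-reset r ι s x x∈r e))
                (≤-reflexive (solve 3 (λ later k d → later :+ (k :+ d) := (d :+ later) :+ k) ≈-refl later (fromℕ (credit ι s) * unit) δ))))
              (≤-trans (x≤x+y (0≤* move≥0 (Λ-nonneg (mass ι)))) (≤-reflexive (+-comm _ _)))))
        where
        ι = step r₀ ι₀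
        δ = d R H s x
        later = solutionCost R H x σ
        open Round r ι ρ (budget (step r ι) x later) (weighted-value r ι x ρ feas)
      ... | inj₁ e = ≤-trans (weighted-continue e r₀ ι₀ ≡.refl) (≤-trans (≤-reflexive collect)
          (≤-trans (+-mono-≤ (*-monoʳ-≤ move≥0 drop) (*-monoʳ-≤ (fromℕ-nonneg (mass ι)) (*-monoʳ-≤ ratio≥0 offline)))
            (≤-reflexive (solve 4 (λ M A l x → M :* (A :* l) :+ A :* x := A :* (M :* l :+ x)) ≈-refl
              move (fromℕ (mass ι)) (Λ (mass ι)) _))))
        where
        ι = step r₀ ι₀
        δ = d R H s x
        later = solutionCost R H x σ
        open Round r ι ρ (budget (step r ι) x later) (weighted-value r ι x ρ feas)
        ι″ = step r ι
        Z = total lost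
        offline-term = ratio * (later + fromℕ (credit ι″ x) * unit)
        mass-split : Z ℕ.+ mass ι″ ≡ mass ι
        mass-split = ≡.trans (≡.sym (total-+ lost (weight ι″))) (total-cong λ c → ℕₚ.m∸n+n≡m (decreasing r ι c e))
        mass≈ : fromℕ (mass ι) ≈ fromℕ Z + fromℕ (mass ι″)
        mass≈ = ≈-trans (fromℕ-cong (≡.sym mass-split)) (fromℕ-+ Z (mass ι″))
        collect : fromℕ (mass ι″) * budget ι″ x later + fromℕ Z * (move + budget ι″ x later)
                ≈ move * (fromℕ Z + fromℕ (mass ι) * Λ (mass ι″)) + fromℕ (mass ι) * offline-term
        collect = ≈-trans (solve 5 (λ A z M l o → A :* (M :* l :+ o) :+ z :* (M :+ (M :* l :+ o))
                      := M :* (z :+ (z :+ A) :* l) :+ (z :+ A) :* o) ≈-refl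
                      (fromℕ (mass ι″)) (fromℕ Z) move (Λ (mass ι″)) offline-term)
          (+-cong (*-congˡ (+-congˡ (*-congʳ (≈-sym mass≈)))) (*-congʳ (≈-sym mass≈)))
        drop : fromℕ Z + fromℕ (mass ι) * Λ (mass ι″) ≤ fromℕ (mass ι) * Λ (mass ι)
        drop = ≤-trans (Λ-drop Z (mass ι″) (mass-lower r₀ ι₀) (ℕₚ.≤-reflexive mass-split))
          (≤-reflexive (*-congˡ (Λ-cong mass-split)))
        offline : later + fromℕ (credit ι″ x) * unit ≤ (δ + later) + fromℕ (credit ι s) * unit
        offline = ≤-trans (+-monoʳ-≤ later (progress r ι s x x∈r e))
          (≤-reflexive (solve 3 (λ later k d → later :+ (k :+ d) := (d :+ later) :+ k) ≈-refl later (fromℕ (credit ι s) * unit) δ))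

      value-initial : ∀ s ρ {σ} → Feasible R H K ρ σ →
        value initial s ρ ≤ ratio * (solutionCost R H s σ + fromℕ span * unit)
      value-initial s [] [] = 0≤* ratio≥0 (0≤+ ≤-refl (0≤* (fromℕ-nonneg span) unit≥0))
      value-initial s (r ∷ ρ) {x ∷ σ} (x∈r ∷ feas) = ≤-trans (value-reset (initial-reset r) s)
        (≤-trans (budget-reset r initial x x∈r (initial-reset r))
          (*-monoʳ-≤ ratio≥0 (+-monoˡ-≤ _ (≤-trans (x≤x+y (d≥0 s x)) (≤-reflexive (+-comm _ _))))))
        where open Round r initial ρ (budget (step r initial) x (solutionCost R H x σ)) (weighted-value r initial x ρ feas)

      competitive : HasCompetitiveRatio R H K algorithm ratio
      competitive = ratio * (fromℕ span * unit) , λ { s₀ ρ v ((σ , feas , cost≈v) , _) →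
        ≤-trans (≤-reflexive (expected≈value s₀ ρ [])) (≤-trans (value-initial s₀ ρ feas)
          (≤-reflexive (≈-trans (distribˡ ratio _ _) (+-congʳ (*-congˡ cost≈v))))) }

-- Geometric weights

-- With E = 2 D = suc e, the weights e ^ v * E ^ (V ∸ v) for v ≤ V = m * D
-- decrease by a factor 1 - 1 / E when v increases, and by at most 2 ^ m in all.
module GeometricWeights (D₀ : ℕ) (V : ℕ) where
  open import Data.Nat using (_+_; _*_; _^_; _≤_; _<_; _∸_)
  open ≡ using (sym; trans; cong)
  open ℕₚ.≤-Reasoning

  D e E : ℕ
  D = suc D₀
  e = suc (D₀ + D₀)
  E = suc e

  E≡2D : E ≡ 2 * D
  E≡2D = expand D₀
    where
    expand : ∀ k → suc (suc (k + k)) ≡ 2 * suc k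
    expand = solve-∀

  geometric : ℕ → ℕ
  geometric v = e ^ v * E ^ (V ∸ v)

  geometric-lower : ∀ v → v ≤ V → e ^ V ≤ geometric v
  geometric-lower v v≤V = begin
    e ^ V                  ≡⟨ cong (e ^_) (ℕₚ.m+[n∸m]≡n v≤V) ⟨
    e ^ (v + (V ∸ v))      ≡⟨ ℕₚ.^-distribˡ-+-* e v (V ∸ v) ⟩
    e ^ v * e ^ (V ∸ v)    ≤⟨ ℕₚ.*-monoʳ-≤ (e ^ v) (ℕₚ.^-monoˡ-≤ (V ∸ v) (ℕₚ.n≤1+n e)) ⟩
    e ^ v * E ^ (V ∸ v)    ∎

  geometric-upper : ∀ v → v ≤ V → geometric v ≤ E ^ V
  geometric-upper v v≤V = begin
    e ^ v * E ^ (V ∸ v)    ≤⟨ ℕₚ.*-monoˡ-≤ (E ^ (V ∸ v)) (ℕₚ.^-monoˡ-≤ v (ℕₚ.n≤1+n e)) ⟩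
    E ^ v * E ^ (V ∸ v)    ≡⟨ ℕₚ.^-distribˡ-+-* E v (V ∸ v) ⟨
    E ^ (v + (V ∸ v))      ≡⟨ cong (E ^_) (ℕₚ.m+[n∸m]≡n v≤V) ⟩
    E ^ V                  ∎

  geometric-pos : ∀ v → geometric v ≢ 0
  geometric-pos v eq = ℕₚ.<-irrefl (sym eq) (ℕₚ.*-mono-≤ (ℕₚ.m^n>0 e v) (ℕₚ.m^n>0 E (V ∸ v)))

  geometric-drop : ∀ {v v′} → v < v′ → v′ ≤ V → E * geometric v′ ≤ e * geometric v
  geometric-drop {v} {v′} v<v′ v′≤V = begin
    E * (e ^ v′ * E ^ j)              ≡⟨ cong (λ x → E * (e ^ x * E ^ j)) (ℕₚ.m+[n∸m]≡n v<v′) ⟨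
    E * (e ^ (suc v + k) * E ^ j)     ≡⟨ cong (λ x → E * (x * E ^ j)) (ℕₚ.^-distribˡ-+-* e (suc v) k) ⟩
    E * (e * e ^ v * e ^ k * E ^ j)   ≤⟨ ℕₚ.*-monoʳ-≤ E (ℕₚ.*-monoˡ-≤ (E ^ j) (ℕₚ.*-monoʳ-≤ (e * e ^ v)
                                           (ℕₚ.^-monoˡ-≤ k (ℕₚ.n≤1+n e)))) ⟩
    E * (e * e ^ v * E ^ k * E ^ j)   ≡⟨ regroup E e (e ^ v) (E ^ k) (E ^ j) ⟩
    e * (e ^ v * (E * (E ^ k * E ^ j))) ≡⟨ cong (λ x → e * (e ^ v * (E * x))) (ℕₚ.^-distribˡ-+-* E k j) ⟨
    e * (e ^ v * E ^ suc (k + j))     ≡⟨ cong (λ x → e * (e ^ v * E ^ x)) exponent ⟩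
    e * (e ^ v * E ^ (V ∸ v))         ∎
    where
    j = V ∸ v′
    k = v′ ∸ suc v
    regroup : ∀ E e a b c → E * (e * a * b * c) ≡ e * (a * (E * (b * c)))
    regroup = solve-∀
    exponent : suc (k + j) ≡ V ∸ v
    exponent = ℕₚ.+-cancelˡ-≡ v _ _ (trans (ℕₚ.+-suc v (k + j)) (trans (sym (ℕₚ.+-assoc (suc v) k j))
      (trans (cong (_+ j) (ℕₚ.m+[n∸m]≡n v<v′)) (trans (ℕₚ.m+[n∸m]≡n v′≤V)
        (sym (ℕₚ.m+[n∸m]≡n (ℕₚ.≤-trans (ℕₚ.<⇒≤ v<v′) v′≤V)))))))

  -- Bernoulli's inequality (1 - 1 / E) ^ k ≥ 1 - k / E, cleared of denominators.
  bernoulli : ∀ k → E ^ k * E ≤ e ^ k * E + k * E ^ k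
  bernoulli zero    = ℕₚ.m≤m+n (1 * E) 0
  bernoulli (suc k) = begin
    E * E ^ k * E                                ≡⟨ regroup₁ E (E ^ k) ⟩
    E * (E ^ k * E)                              ≤⟨ ℕₚ.*-monoʳ-≤ E (bernoulli k) ⟩
    E * (e ^ k * E + k * E ^ k)                  ≡⟨ regroup₂ e (e ^ k) k (E ^ k) ⟩
    e * e ^ k * E + (e ^ k * E + k * (E * E ^ k))
      ≤⟨ ℕₚ.+-monoʳ-≤ (e * e ^ k * E) (ℕₚ.+-monoˡ-≤ (k * (E * E ^ k))
           (ℕₚ.≤-trans (ℕₚ.*-monoˡ-≤ E (ℕₚ.^-monoˡ-≤ k (ℕₚ.n≤1+n e))) (ℕₚ.≤-reflexive (ℕₚ.*-comm (E ^ k) E)))) ⟩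
    e * e ^ k * E + (E * E ^ k + k * (E * E ^ k)) ∎
    where
    regroup₁ : ∀ E a → E * a * E ≡ E * (a * E)
    regroup₁ = solve-∀
    regroup₂ : ∀ e a k b → suc e * (a * suc e + k * b) ≡ e * a * suc e + (a * suc e + k * (suc e * b))
    regroup₂ = solve-∀

  -- Bernoulli at k = D, where k / E is 1/2: the reason for choosing E = 2 D.
  E^D≤2*e^D : E ^ D ≤ 2 * e ^ D
  E^D≤2*e^D = ℕₚ.*-cancelˡ-≤ D (ℕₚ.+-cancelʳ-≤ (D * E ^ D) _ _ (begin
    D * E ^ D + D * E ^ D     ≡⟨ regroup D (E ^ D) ⟩
    E ^ D * (2 * D)           ≡⟨ cong (E ^ D *_) E≡2D ⟨
    E ^ D * E                 ≤⟨ bernoulli D ⟩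
    e ^ D * E + D * E ^ D     ≡⟨ cong (λ x → e ^ D * x + D * E ^ D) E≡2D ⟩
    e ^ D * (2 * D) + D * E ^ D ≡⟨ cong (_+ D * E ^ D) (regroup′ D (e ^ D)) ⟩
    D * (2 * e ^ D) + D * E ^ D ∎))
    where
    regroup : ∀ D x → D * x + D * x ≡ x * (2 * D)
    regroup = solve-∀
    regroup′ : ∀ D x → x * (2 * D) ≡ D * (2 * x)
    regroup′ = solve-∀

  E^mD≤2^m*e^mD : ∀ m → E ^ (m * D) ≤ 2 ^ m * e ^ (m * D)
  E^mD≤2^m*e^mD zero    = ℕₚ.≤-refl
  E^mD≤2^m*e^mD (suc m) = begin
    E ^ (D + m * D)                        ≡⟨ ℕₚ.^-distribˡ-+-* E D (m * D) ⟩
    E ^ D * E ^ (m * D)                    ≤⟨ ℕₚ.*-mono-≤ E^D≤2*e^D (E^mD≤2^m*e^mD m) ⟩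
    2 * e ^ D * (2 ^ m * e ^ (m * D))      ≡⟨ regroup (e ^ D) (2 ^ m) (e ^ (m * D)) ⟩
    2 * 2 ^ m * (e ^ D * e ^ (m * D))      ≡⟨ cong (2 * 2 ^ m *_) (ℕₚ.^-distribˡ-+-* e D (m * D)) ⟨
    2 * 2 ^ m * e ^ (D + m * D)            ∎
    where
    regroup : ∀ a b c → 2 * a * (b * c) ≡ 2 * b * (a * c)
    regroup = solve-∀

3^n≤2^[2n] : ∀ n → 3 ℕ.^ n ℕ.≤ 2 ℕ.^ (2 ℕ.* n)
3^n≤2^[2n] n = ℕₚ.≤-trans (ℕₚ.^-monoˡ-≤ n (s≤s (s≤s (s≤s (z≤n {1}))))) (ℕₚ.≤-reflexive (ℕₚ.^-*-assoc 2 2 n))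

anyLeaf? : ∀ {k} (t : Tree k) {P : Leaf t → Set} → (∀ x → Dec (P x)) → Dec (∃ P)
anyLeaf? leaf P? with P? tt
... | yes p = yes (tt , p)
... | no ¬p = no λ { (tt , p) → ¬p p }
anyLeaf? (node n t) P? with Finₚ.any? (λ i → anyLeaf? (t i) (λ x → P? (i , x)))
... | yes (i , x , p) = yes ((i , x) , p)
... | no ¬p = no λ { ((i , x) , p) → ¬p (i , x , p) }

-- Bookkeeping of the requests in one subtree

module Insertion where
  open Layers

  insert : ∀ {m} → Fin m → Subset m → Subset m
  insert r S = S [ r ]≔ true

  singleton : ∀ {m} → Fin m → Subset m
  singleton r = insert r (replicate _ false)

  ∈-insert : ∀ {m} r (S : Subset m) → lookup (insert r S) r ≡ true
  ∈-insert r S = Vecₚ.lookup∘update r S true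

  ∈-insert⁻ : ∀ {m} r (S : Subset m) r′ → lookup (insert r S) r′ ≡ true → r′ ≡ r ⊎ lookup S r′ ≡ true
  ∈-insert⁻ r S r′ r′∈ with r′ Fin.≟ r
  ... | yes r′≡r = inj₁ r′≡r
  ... | no  r′≢r = inj₂ (≡.trans (≡.sym (Vecₚ.lookup∘update′ r′≢r S true)) r′∈)

  ∈-singleton⁻ : ∀ {m} (r r′ : Fin m) → lookup (singleton r) r′ ≡ true → r′ ≡ r
  ∈-singleton⁻ r r′ r′∈ with ∈-insert⁻ r (replicate _ false) r′ r′∈
  ... | inj₁ r′≡r = r′≡r
  ... | inj₂ r′∈∅ = case ≡.trans (≡.sym r′∈∅) (Vecₚ.lookup-replicate r′ false) of λ ()

  insert-size : ∀ {m} r (S : Subset m) → insert r S ≡ S ⊎ ∣ insert r S ∣ ≡ suc ∣ S ∣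
  insert-size zero    (true  ∷ S) = inj₁ ≡.refl
  insert-size zero    (false ∷ S) = inj₂ ≡.refl
  insert-size (suc r) (b ∷ S) with insert-size r S
  ... | inj₁ e = inj₁ (≡.cong (b ∷_) e)
  insert-size (suc r) (true  ∷ S) | inj₂ e = inj₂ (≡.cong suc e)
  insert-size (suc r) (false ∷ S) | inj₂ e = inj₂ e

  ∣singleton∣≥1 : ∀ {m} (r : Fin m) → 1 ℕ.≤ ∣ singleton r ∣
  ∣singleton∣≥1 zero    = s≤s z≤n
  ∣singleton∣≥1 (suc r) = ∣singleton∣≥1 r

-- The bookkeeping of one subtree, whose requests with a common leaf are those
-- accepted by f.  In alive q S, the subtree has exhausted q successive sets of
-- requests, and S is the set requested since.  At D it is dead.
module SubtreeState (D : ℕ) {m : ℕ} where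
  open Insertion

  data State : Set where
    dead  : State
    alive : (q : ℕ) (S : Subset m) → State

  Face : Set
  Face = Subset m → Bool

  start : Face → Fin m → State
  start f r = if f (singleton r) then alive 0 (singleton r) else dead

  -- The request that exhausts a set opens the next one. A subtree without a leaf for `r` dies
  -- whatever its count, since the offline player cannot be in it.
  renew : Face → Fin m → ℕ → State
  renew f r q with suc q ℕ.<? D
  ... | yes _ = if f (singleton r) then alive (suc q) (singleton r) else dead
  ... | no  _ = dead

  next : Face → Fin m → State → State
  next f r dead        = dead
  next f r (alive q S) = if f (insert r S) then alive q (insert r S) else renew f r q

  start-cong : ∀ {f g} → f ≗ g → ∀ r → start f r ≡ start g r
  start-cong f≗g r rewrite f≗g (singleton r) = ≡.refl

  next-cong : ∀ {f g} → f ≗ g → ∀ r s → next f r s ≡ next g r s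
  next-cong f≗g r dead = ≡.refl
  next-cong {f} {g} f≗g r (alive q S) rewrite f≗g (insert r S) with g (insert r S)
  ... | true  = ≡.refl
  ... | false with suc q ℕ.<? D
  ...   | yes _ rewrite f≗g (singleton r) = ≡.refl
  ...   | no  _ = ≡.refl

  Valid : Face → State → Set
  Valid f dead        = ⊤
  Valid f (alive q S) = q ℕ.< D × f S ≡ true

  Recent : Fin m → State → Set
  Recent r dead        = ⊤
  Recent r (alive q S) = lookup S r ≡ true

  data Next (f : Face) (r : Fin m) (q : ℕ) (S : Subset m) : State → Set where
    grow    : f (insert r S) ≡ true → Next f r q S (alive q (insert r S))
    restart : f (insert r S) ≡ false → suc q ℕ.< D → f (singleton r) ≡ true →
              Next f r q S (alive (suc q) (singleton r))
    unfit   : f (singleton r) ≡ false → Next f r q S dead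
    die     : f (insert r S) ≡ false → D ℕ.≤ suc q → Next f r q S dead

  next-view : ∀ f r q S → Next f r q S (next f r (alive q S))
  next-view f r q S with f (insert r S) in eq
  ... | true  = grow eq
  ... | false with suc q ℕ.<? D
  ...   | no  q≮D = die eq (ℕₚ.≮⇒≥ q≮D)
  ...   | yes q<D with f (singleton r) in eq′
  ...     | true  = restart eq q<D eq′
  ...     | false = unfit eq′

  start-valid : 0 ℕ.< D → ∀ f r → Valid f (start f r)
  start-valid D>0 f r with f (singleton r) in eq
  ... | true  = D>0 , eq
  ... | false = tt

  start-recent : ∀ f r → Recent r (start f r)
  start-recent f r with f (singleton r)
  ... | true  = ∈-insert r (replicate m false)
  ... | false = tt

  next-valid : ∀ f r s → Valid f s → Valid f (next f r s)
  next-valid f r dead _ = tt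
  next-valid f r (alive q S) (q<D , _) with next f r (alive q S) | next-view f r q S
  ... | _ | grow eq          = q<D , eq
  ... | _ | restart _ q<D eq = q<D , eq
  ... | _ | unfit _          = tt
  ... | _ | die _ _          = tt

  next-recent : ∀ f r s → Recent r (next f r s)
  next-recent f r dead = tt
  next-recent f r (alive q S) with next f r (alive q S) | next-view f r q S
  ... | _ | grow _        = ∈-insert r S
  ... | _ | restart _ _ _ = ∈-insert r (replicate m false)
  ... | _ | unfit _       = tt
  ... | _ | die _ _       = tt

  -- Orders the states lexicographically by `q` and the size of `S`. Every change of an alive state
  -- into another alive one raises it; on a restart this is strict because the new set is non-empty.
  age : ℕ → Subset m → ℕ
  age q S = m ℕ.* q ℕ.+ ∣ S ∣

  age-≤ : ∀ q S → q ℕ.< D → age q S ℕ.≤ m ℕ.* D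
  age-≤ q S q<D = ℕₚ.≤-trans (ℕₚ.+-monoʳ-≤ (m ℕ.* q) (Subsetₚ.∣p∣≤n S))
    (ℕₚ.≤-trans (ℕₚ.≤-reflexive (≡.trans (ℕₚ.+-comm (m ℕ.* q) m) (≡.sym (ℕₚ.*-suc m q)))) (ℕₚ.*-monoʳ-≤ m q<D))

  next-age : ∀ f r q S {q′ S′} → next f r (alive q S) ≡ alive q′ S′ → S ≡ S′ × q ≡ q′ ⊎ age q S ℕ.< age q′ S′
  next-age f r q S eq with next f r (alive q S) | next-view f r q S
  next-age f r q S ≡.refl | _ | grow _ with insert-size r S
  ... | inj₁ same = inj₁ (≡.sym same , ≡.refl)
  ... | inj₂ more = inj₂ (ℕₚ.+-monoʳ-< (m ℕ.* q) (ℕₚ.≤-reflexive (≡.sym more)))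
  next-age f r q S ≡.refl | _ | restart _ _ _ = inj₂ (ℕₚ.≤-<-trans (ℕₚ.+-monoʳ-≤ (m ℕ.* q) (Subsetₚ.∣p∣≤n S))
    (ℕₚ.<-≤-trans (ℕₚ.m<m+n (m ℕ.* q ℕ.+ m) (∣singleton∣≥1 r))
      (ℕₚ.≤-reflexive (≡.cong (ℕ._+ ∣ singleton r ∣) (≡.trans (ℕₚ.+-comm (m ℕ.* q) m) (≡.sym (ℕₚ.*-suc m q)))))))

  -- In units of the short distance, what an offline player now at the leaf `c` must have paid since
  -- the last reset: one unit per exhausted set, and one more if the leaf does not serve all of `S`.
  debt : State → (Subset m → Bool) → ℕ
  debt dead        c = D
  debt (alive q S) c = if c S then q else suc q

  debt-≤ : ∀ {f} s → Valid f s → ∀ c → debt s c ℕ.≤ D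
  debt-≤ dead        _         c = ℕₚ.≤-refl
  debt-≤ (alive q S) (q<D , _) c with c S
  ... | true  = ℕₚ.<⇒≤ q<D
  ... | false = q<D

  debt-alive : ∀ q S c → q ℕ.≤ debt (alive q S) c × debt (alive q S) c ℕ.≤ suc q
  debt-alive q S c with c S
  ... | true  = ℕₚ.≤-refl , ℕₚ.n≤1+n q
  ... | false = ℕₚ.n≤1+n q , ℕₚ.≤-refl

  -- c S says whether the leaf of the offline player lies in all types of S.
  record Serves (f : Face) (r : Fin m) (c : Subset m → Bool) : Set where
    field
      serves-face      : ∀ S → c S ≡ true → f S ≡ true
      serves-insert    : ∀ S → c S ≡ true → c (insert r S) ≡ true
      serves-singleton : c (singleton r) ≡ true

  -- If the leaf serves `S` and `r`, it witnesses `f (insert r S)`. So the set can be exhausted only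
  -- when the leaf misses part of `S`, and then the debt is already `suc q`.
  debt-stay : ∀ {f r c} s → Serves f r c → debt (next f r s) c ℕ.≤ debt s c
  debt-stay dead _ = ℕₚ.≤-refl
  debt-stay {f} {r} {c} (alive q S) sv with next f r (alive q S) | next-view f r q S
  ... | _ | unfit ¬f = case ≡.trans (≡.sym ¬f) (serves-face _ serves-singleton) of λ ()
    where open Serves sv
  ... | _ | grow _ with c S in eq
  ...   | true  rewrite Serves.serves-insert sv S eq = ℕₚ.≤-refl
  ...   | false = proj₂ (debt-alive q (insert r S) c)
  debt-stay {f} {r} {c} (alive q S) sv | _ | restart ¬f _ _ with c S in eq
  ...   | true  = case ≡.trans (≡.sym ¬f) (serves-face _ (serves-insert S eq)) of λ ()
    where open Serves sv
  ...   | false rewrite Serves.serves-singleton sv = ℕₚ.≤-refl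
  debt-stay {f} {r} {c} (alive q S) sv | _ | die ¬f D≤ with c S in eq
  ...   | true  = case ≡.trans (≡.sym ¬f) (serves-face _ (serves-insert S eq)) of λ ()
    where open Serves sv
  ...   | false = D≤

  debt-local : ∀ {f r c} s c₀ → Serves f r c → debt (next f r s) c ℕ.≤ suc (debt s c₀)
  debt-local dead _ _ = ℕₚ.n≤1+n D
  debt-local {f} {r} {c} (alive q S) c₀ sv with next f r (alive q S) | next-view f r q S
  ... | _ | unfit ¬f = case ≡.trans (≡.sym ¬f) (serves-face _ serves-singleton) of λ ()
    where open Serves sv
  ... | _ | grow _ = ℕₚ.≤-trans (proj₂ (debt-alive q (insert r S) c)) (s≤s (proj₁ (debt-alive q S c₀)))
  ... | _ | restart _ _ _ rewrite Serves.serves-singleton sv = s≤s (proj₁ (debt-alive q S c₀))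
  ... | _ | die _ D≤ = ℕₚ.≤-trans D≤ (s≤s (proj₁ (debt-alive q S c₀)))

-- Distances in a two-level tree

module TwoLevelDistance (R : RealNumbers) (weight : ℕ → RealNumbers.ℝ R)
  (weight-pos : ∀ ℓ → RealNumbers._<_ R (RealNumbers.0# R) (weight ℓ)) where
  open Ordered R

  short long : ℝ
  short = height R weight 1 + height R weight 1
  long  = height R weight 2 + height R weight 2

  height-1>0 : 0# < height R weight 1
  height-1>0 = <-respʳ-≈ (≈-sym (+-identityˡ (weight 0))) (weight-pos 0)

  short>0 : 0# < short
  short>0 = <-≤-trans height-1>0 (x≤x+y (<⇒≤ height-1>0))

  short≤long : short ≤ long
  short≤long = +-mono-≤ (x≤x+y (<⇒≤ (weight-pos 1))) (x≤x+y (<⇒≤ (weight-pos 1)))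

  distance₀ : (t : Tree 0) (x y : Leaf t) → pathDistance R weight t x y ≈ 0#
  distance₀ leaf _ _ = ≈-refl

  leaf₀-unique : (t : Tree 0) (x y : Leaf t) → x ≡ y
  leaf₀-unique leaf _ _ = ≡.refl

  distance₁ : (t : Tree 1) (x y : Leaf t) →
    x ≡ y × pathDistance R weight t x y ≈ 0# ⊎ pathDistance R weight t x y ≈ short
  distance₁ (node n t) (i , x) (j , y) with i Fin.≟ j
  ... | yes ≡.refl = inj₁ (≡.cong (i ,_) (leaf₀-unique (t i) x y) , distance₀ (t i) x y)
  ... | no  _      = inj₂ ≈-refl

  data Distance {n} (t : Fin (suc n) → Tree 1) : (x y : Leaf (node n t)) → ℝ → Set where
    same    : ∀ {x δ} → δ ≈ 0# → Distance t x x δ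
    sibling : ∀ {i x y δ} → δ ≈ short → Distance t (i , x) (i , y) δ
    distant : ∀ {x y δ} → δ ≈ long → Distance t x y δ

  distance₂ : ∀ {n} (t : Fin (suc n) → Tree 1) x y → Distance t x y (pathDistance R weight (node n t) x y)
  distance₂ t (i , x) (j , y) with i Fin.≟ j
  ... | no  _ = distant ≈-refl
  ... | yes ≡.refl with distance₁ (t i) x y
  ...   | inj₁ (≡.refl , δ≈0) = same δ≈0
  ...   | inj₂ δ≈short        = sibling δ≈short

  distance-bounds : ∀ {n} {t : Fin (suc n) → Tree 1} {x y δ} → Distance t x y δ → 0# ≤ δ × δ ≤ long
  distance-bounds (same e)    = ≤-reflexive (≈-sym e) , ≤-trans (≤-reflexive e) (≤-trans (<⇒≤ short>0) short≤long)
  distance-bounds (sibling e) = ≤-trans (<⇒≤ short>0) (≤-reflexive (≈-sym e)) , ≤-trans (≤-reflexive e) short≤long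
  distance-bounds (distant e) = ≤-trans (≤-trans (<⇒≤ short>0) short≤long) (≤-reflexive (≈-sym e)) , ≤-reflexive e

  distance-sibling : ∀ {n} (t : Fin (suc n) → Tree 1) i x y → pathDistance R weight (node n t) (i , x) (i , y) ≤ short
  distance-sibling t i x y with i Fin.≟ i
  ... | no i≢i = ⊥-elim (i≢i ≡.refl)
  ... | yes ≡.refl with distance₁ (t i) x y
  ...   | inj₁ (_ , e) = ≤-trans (≤-reflexive e) (<⇒≤ short>0)
  ...   | inj₂ e       = ≤-reflexive e

  distance-refl : ∀ {n} (t : Fin (suc n) → Tree 1) x → pathDistance R weight (node n t) x x ≈ 0#
  distance-refl t (i , x) with i Fin.≟ i
  ... | no i≢i = ⊥-elim (i≢i ≡.refl)
  ... | yes ≡.refl = refl₁ (t i) x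
    where
    refl₁ : (t : Tree 1) (x : Leaf t) → pathDistance R weight t x x ≈ 0#
    refl₁ (node n t) (i , x) with i Fin.≟ i
    ... | no i≢i     = ⊥-elim (i≢i ≡.refl)
    ... | yes ≡.refl = distance₀ (t i) x x

  -- Exact rounding of the quotient would need a decidable order. The search compares `long` with
  -- two consecutive multiples of `short` by `cotrans`; the factor 3 covers the remaining slack, as
  -- 3 + k ≤ 3 (k + 1).
  integer-ratio : ∃[ D₀ ] fromℕ (suc D₀) * short ≤ long × long ≤ fromℕ (3 ℕ.* suc D₀) * short
  integer-ratio with archimedean (long * recip short>0)
  ... | n , lt = search n (<-≤-trans long<n (*-monoˡ-≤ (<⇒≤ short>0) (fromℕ-mono-≤ (ℕₚ.m≤n+m n 2))))
    where
    long<n : long < fromℕ n * short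
    long<n = <-respʳ-≈ (*-comm _ _) (<-respˡ-≈
      (≈-trans (solve 3 (λ s l r → s :* (l :* r) := (s :* r) :* l) ≈-refl short long (recip short>0))
        (≈-trans (*-congʳ (recip-inverseʳ short>0)) (*-identityˡ long)))
      (*-monoʳ-< short>0 lt))
    search : ∀ k → long < fromℕ (2 ℕ.+ k) * short →
      ∃[ D₀ ] fromℕ (suc D₀) * short ≤ long × long ≤ fromℕ (3 ℕ.* suc D₀) * short
    search zero lt = 0 , ≤-trans (≤-reflexive (≈-trans (*-congʳ fromℕ-1) (*-identityˡ short))) short≤long ,
      <⇒≤ (<-≤-trans lt (*-monoˡ-≤ (<⇒≤ short>0) (fromℕ-mono-≤ (ℕₚ.n≤1+n 2))))
    search (suc k) lt with cotrans (<-respʳ-≈ (*-comm short _) (<-respˡ-≈ (*-comm short _)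
        (*-monoʳ-< short>0 (fromℕ-mono-< (ℕₚ.n<1+n (suc k)))))) long
    ... | inj₂ lt′ = search k lt′
    ... | inj₁ gt  = k , <⇒≤ gt , <⇒≤ (<-≤-trans lt (*-monoˡ-≤ (<⇒≤ short>0) (fromℕ-mono-≤ (bound k))))
      where
      expand : ∀ k → 3 ℕ.+ k ℕ.+ 2 ℕ.* k ≡ 3 ℕ.* suc k
      expand = solve-∀
      bound : ∀ k → 3 ℕ.+ k ℕ.≤ 3 ℕ.* suc k
      bound k = ℕₚ.≤-trans (ℕₚ.m≤m+n (3 ℕ.+ k) (2 ℕ.* k)) (ℕₚ.≤-reflexive (expand k))

holds : ∀ {A : Set} (a? : Dec A) → does a? ≡ true → A
holds (yes a) _ = a

nonzero : ℕ → Bool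
nonzero zero    = false
nonzero (suc _) = true

nonzero-true : ∀ k → nonzero k ≡ true → k ≢ 0
nonzero-true (suc k) _ ()

nonzero-false : ∀ k → nonzero k ≡ false → k ≡ 0
nonzero-false zero _ = ≡.refl

-- The algorithm on a two-level tree

module UpperBound (R : RealNumbers) {m n : ℕ} (t : Fin (suc n) → Tree 1) (edge : ℕ → RealNumbers.ℝ R)
  (edge-pos : ∀ ℓ → RealNumbers._<_ R (RealNumbers.0# R) (edge ℓ)) where
  open Ordered R
  open Layers
  open Insertion
  open TwoLevelDistance R edge edge-pos

  H : HST R 2
  H = record { tree = node n t ; weight = edge ; weight-pos = edge-pos }
  open HST H using (Point)

  module Requests (K : RequestTypes R H m) where
    open RequestTypes K
    open WeightedTracking R K

    Common : Subset m → Point → Set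
    Common S x = ∀ r → lookup S r ≡ true → member r x ≡ true

    common? : ∀ S x → Dec (Common S x)
    common? S x = Finₚ.all? λ r → (lookup S r Boolₚ.≟ true) →-dec (member r x Boolₚ.≟ true)

    commonLeaf? : ∀ i S → Dec (∃[ x ] Common S (i , x))
    commonLeaf? i S = anyLeaf? (t i) λ x → common? S (i , x)

    face : Fin (suc n) → Subset m → Bool
    face i S = does (commonLeaf? i S)

    face-true : ∀ {i S x} → Common S (i , x) → face i S ≡ true
    face-true {i} {S} {x} c = dec-true (commonLeaf? i S) (x , c)

    face-leaf : ∀ {i S} → face i S ≡ true → ∃[ x ] Common S (i , x)
    face-leaf {i} {S} = holds (commonLeaf? i S)

    face-downClosed : ∀ i → Hansel.DownClosed (face i)
    face-downClosed i p q p⊑q f = case face-leaf {i} {q} f of λ (x , c) → face-true {i} {p} {x} λ r r∈p → c r (p⊑q r r∈p)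

    module Tokens (D₀ : ℕ) (D-lower : fromℕ (suc D₀) * short ≤ long) (D-upper : long ≤ fromℕ (3 ℕ.* suc D₀) * short)
      (T κ : ℕ) (T≤2^κ : T ℕ.≤ 2 ℕ.^ κ) (code : Fin (suc n) → Fin T)
      (code-injective : ∀ i j → code i ≡ code j → face i ≗ face j) where

      open GeometricWeights D₀ (m ℕ.* suc D₀)
      open SubtreeState D {m}

      -- A state is kept for every subtree, so that the credit of an offline player in any of them
      -- is defined; `coherent` ties it to the weight of the representative of its code.
      record Info : Set where
        field
          state    : Fin (suc n) → State
          valid    : ∀ i → Valid (face i) (state i)
          coherent : ∀ i j → code i ≡ code j → state i ≡ state j
      open Info

      initialInfo : Info
      initialInfo = record { state = λ _ → dead ; valid = λ _ → tt ; coherent = λ _ _ _ → ≡.refl }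

      advance : Fin m → Info → Info
      advance r ι = record
        { state    = λ i → next (face i) r (state ι i)
        ; valid    = λ i → next-valid (face i) r (state ι i) (valid ι i)
        ; coherent = λ i j e → ≡.trans (≡.cong (next (face i) r) (coherent ι i j e))
                                 (next-cong (code-injective i j e) r (state ι j)) }

      reset : Fin m → Info
      reset r = record
        { state    = λ i → start (face i) r
        ; valid    = λ i → start-valid (s≤s z≤n) (face i) r
        ; coherent = λ i j e → start-cong (code-injective i j e) r }

      stateWeight : State → ℕ
      stateWeight dead        = 0
      stateWeight (alive q S) = geometric (age q S)

      representative : ∀ c → Dec (∃[ i ] code i ≡ c)
      representative c = Finₚ.any? λ i → code i Fin.≟ c

      weight : Info → Fin (T) → ℕ
      weight ι c with representative c
      ... | yes (i , _) = stateWeight (state ι i)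
      ... | no  _       = 0

      fallback : Fin m → Point
      fallback r = proj₁ (nonEmpty r)

      -- In an alive state the leaf depends on `S` only, so an unchanged state causes no move. The
      -- test for `r` makes the answer legal for every `Info`, reachable or not.
      statePosition : Fin m → Fin (suc n) → State → Point
      statePosition r i dead = fallback r
      statePosition r i (alive q S) with commonLeaf? i S
      ... | no  _       = fallback r
      ... | yes (x , _) with member r (i , x) Boolₚ.≟ true
      ...   | yes _ = i , x
      ...   | no  _ = fallback r

      statePosition-served : ∀ r i s → member r (statePosition r i s) ≡ true
      statePosition-served r i dead = proj₂ (nonEmpty r)
      statePosition-served r i (alive q S) with commonLeaf? i S
      ... | no  _       = proj₂ (nonEmpty r)
      ... | yes (x , _) with member r (i , x) Boolₚ.≟ true
      ...   | yes e = e
      ...   | no  _ = proj₂ (nonEmpty r)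

      home : ∀ i S → face i S ≡ true → Leaf (t i)
      home i S f = proj₁ (face-leaf {i} {S} f)

      statePosition-alive : ∀ r i q S (f : face i S ≡ true) → lookup S r ≡ true →
        statePosition r i (alive q S) ≡ (i , home i S f)
      statePosition-alive r i q S f r∈S with commonLeaf? i S
      ... | yes (x , c) with member r (i , x) Boolₚ.≟ true
      ...   | yes _ = ≡.refl
      ...   | no ¬e = ⊥-elim (¬e (c r r∈S))

      position : Fin m → Info → Fin (T) → Point
      position r ι c with representative c
      ... | yes (i , _) = statePosition r i (state ι i)
      ... | no  _       = fallback r

      continues : Fin m → Info → Bool
      continues r ι = nonzero (total (weight (advance r ι)))

      step : Fin m → Info → Info
      step r ι = if continues r ι then advance r ι else reset r

      step-recent : ∀ r ι i → Recent r (state (step r ι) i)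
      step-recent r ι i with continues r ι
      ... | true  = next-recent (face i) r (state ι i)
      ... | false = start-recent (face i) r

      token : Point → Fin (T)
      token (i , _) = code i

      credit : Info → Point → ℕ
      credit ι x = debt (state ι (proj₁ x)) (λ S → does (common? S x))

      alive-weight : ∀ ι {i} → state ι i ≢ dead → weight ι (code i) ≢ 0
      alive-weight ι {i} ≢dead with representative (code i)
      ... | no  ¬p      = ⊥-elim (¬p (i , ≡.refl))
      ... | yes (j , e) rewrite coherent ι j i e with state ι i
      ...   | dead      = ⊥-elim (≢dead ≡.refl)
      ...   | alive q S = geometric-pos (age q S)

      stateWeight-bounds : ∀ {i} s → Valid (face i) s → stateWeight s ≢ 0 →
        e ℕ.^ (m ℕ.* D) ℕ.≤ stateWeight s
      stateWeight-bounds dead        _         w≢0 = ⊥-elim (w≢0 ≡.refl)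
      stateWeight-bounds (alive q S) (q<D , _) _   = geometric-lower (age q S) (age-≤ q S q<D)

      stateWeight-upper : ∀ {i} s → Valid (face i) s → stateWeight s ℕ.≤ E ℕ.^ (m ℕ.* D)
      stateWeight-upper dead        _         = z≤n
      stateWeight-upper (alive q S) (q<D , _) = geometric-upper (age q S) (age-≤ q S q<D)

      weight-lower : ∀ ι c → weight ι c ≢ 0 → e ℕ.^ (m ℕ.* D) ℕ.≤ weight ι c
      weight-lower ι c w≢0 with representative c
      ... | yes (i , _) = stateWeight-bounds {i} (state ι i) (valid ι i) w≢0
      ... | no  _       = ⊥-elim (w≢0 ≡.refl)

      weight-upper : ∀ ι c → weight ι c ℕ.≤ E ℕ.^ (m ℕ.* D)
      weight-upper ι c with representative c
      ... | yes (i , _) = stateWeight-upper {i} (state ι i) (valid ι i)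
      ... | no  _       = z≤n

      y : ℕ
      y = ℕ.pred (e ℕ.^ (m ℕ.* D))

      suc-y : suc y ≡ e ℕ.^ (m ℕ.* D)
      suc-y = ℕₚ.suc-pred (e ℕ.^ (m ℕ.* D)) {{ℕ.>-nonZero (ℕₚ.m^n>0 e (m ℕ.* D))}}

      singleton-common : ∀ {r x} → member r x ≡ true → Common (singleton r) x
      singleton-common {r} {x} x∈r r′ r′∈ rewrite ∈-singleton⁻ r r′ r′∈ = x∈r

      reset-alive : ∀ r {i x} → member r (i , x) ≡ true → state (reset r) i ≡ alive 0 (singleton r)
      reset-alive r {i} {x} x∈r rewrite face-true {i} {singleton r} (singleton-common {r} {i , x} x∈r) = ≡.refl

      step-continues : ∀ r ι → continues r ι ≡ true → step r ι ≡ advance r ι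
      step-continues r ι e rewrite e = ≡.refl

      step-reset : ∀ r ι → continues r ι ≡ false → step r ι ≡ reset r
      step-reset r ι e rewrite e = ≡.refl

      step-mass≢0 : ∀ r ι → total (weight (step r ι)) ≢ 0
      step-mass≢0 r ι with true⊎false (continues r ι)
      ... | inj₁ e = ≡.subst (λ ι′ → total (weight ι′) ≢ 0) (≡.sym (step-continues r ι e)) (nonzero-true _ e)
      ... | inj₂ e = ≡.subst (λ ι′ → total (weight ι′) ≢ 0) (≡.sym (step-reset r ι e)) λ total≡0 →
        case nonEmpty r of λ ((i , x) , x∈r) →
          alive-weight (reset r) {i} (λ e → case ≡.trans (≡.sym (reset-alive r {i} {x} x∈r)) e of λ ())
            (ℕₚ.n≤0⇒n≡0 (ℕₚ.≤-trans (≤-total (weight (reset r)) (code i)) (ℕₚ.≤-reflexive total≡0)))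

      step-mass-lower : ∀ r ι → suc y ℕ.≤ total (weight (step r ι))
      step-mass-lower r ι with total-nonzero (weight (step r ι)) (step-mass≢0 r ι)
      ... | c , w≢0 = ≡.subst (ℕ._≤ total (weight (step r ι))) (≡.sym suc-y)
            (ℕₚ.≤-trans (weight-lower (step r ι) c w≢0) (≤-total (weight (step r ι)) c))

      -- At most 2 ^ κ tokens, whose weights exceed the least positive one, `suc y`, by a factor of
      -- at most 2 ^ m.
      τ : ℕ
      τ = κ ℕ.+ m

      mass-bound : ∀ ι → total (weight ι) ℕ.≤ 2 ℕ.^ τ ℕ.* suc y
      mass-bound ι = begin
        total (weight ι)                             ≤⟨ total-≤ (weight ι) _ (weight-upper ι) ⟩
        T ℕ.* E ℕ.^ (m ℕ.* D)                        ≤⟨ ℕₚ.*-mono-≤ T≤2^κ (E^mD≤2^m*e^mD m) ⟩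
        2 ℕ.^ κ ℕ.* (2 ℕ.^ m ℕ.* e ℕ.^ (m ℕ.* D))
                                                     ≡⟨ ℕₚ.*-assoc (2 ℕ.^ κ) (2 ℕ.^ m) _ ⟨
        2 ℕ.^ κ ℕ.* 2 ℕ.^ m ℕ.* e ℕ.^ (m ℕ.* D)
                                                     ≡⟨ ≡.cong₂ ℕ._*_ (ℕₚ.^-distribˡ-+-* 2 κ m) suc-y ⟨
        2 ℕ.^ τ ℕ.* suc y                            ∎
        where open ℕₚ.≤-Reasoning

      token-step : ∀ r ι c → weight (step r ι) c ≢ 0 → token (position r (step r ι) c) ≡ c
      token-step r ι c w≢0 with representative c
      ... | no  _       = ⊥-elim (w≢0 ≡.refl)
      ... | yes (i , e) with state (step r ι) i | valid (step r ι) i | step-recent r ι i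
      ...   | dead      | _       | _   = ⊥-elim (w≢0 ≡.refl)
      ...   | alive q S | _ , f | r∈S = ≡.trans (≡.cong token (statePosition-alive r i q S f r∈S)) e

      next-weight : ∀ i r s → Valid (face i) s →
        next (face i) r s ≡ s ⊎ E ℕ.* stateWeight (next (face i) r s) ℕ.≤ e ℕ.* stateWeight s
      next-weight i r dead _ = inj₁ ≡.refl
      next-weight i r (alive q S) v with next (face i) r (alive q S) in eq | next-valid (face i) r (alive q S) v
      ... | dead        | _ = inj₂ (≡.subst (ℕ._≤ e ℕ.* geometric (age q S)) (≡.sym (ℕₚ.*-zeroʳ E)) z≤n)
      ... | alive q′ S′ | q′<D , _ with next-age (face i) r q S eq
      ...   | inj₁ (≡.refl , ≡.refl) = inj₁ ≡.refl
      ...   | inj₂ older             = inj₂ (geometric-drop older (age-≤ q′ S′ q′<D))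

      -- Losing at least the fraction 1 / E of a weight means that what stays is at most `E` times
      -- what is lost, so `E * short` per lost unit pays for the local move.
      shrink : ∀ w w′ → E ℕ.* w′ ℕ.≤ e ℕ.* w → w′ ℕ.≤ w × w′ ℕ.≤ (w ℕ.∸ w′) ℕ.* E
      shrink w w′ le = w′≤w , ℕₚ.≤-trans w′≤w (ℕₚ.+-cancelʳ-≤ (E ℕ.* w′) w _ (begin
        w ℕ.+ E ℕ.* w′                          ≤⟨ ℕₚ.+-monoʳ-≤ w le ⟩
        E ℕ.* w                                 ≡⟨ ≡.cong (E ℕ.*_) (ℕₚ.m∸n+n≡m w′≤w) ⟨
        E ℕ.* (w ℕ.∸ w′ ℕ.+ w′)                 ≡⟨ ℕₚ.*-distribˡ-+ E (w ℕ.∸ w′) w′ ⟩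
        E ℕ.* (w ℕ.∸ w′) ℕ.+ E ℕ.* w′           ≡⟨ ≡.cong (ℕ._+ E ℕ.* w′) (ℕₚ.*-comm E (w ℕ.∸ w′)) ⟩
        (w ℕ.∸ w′) ℕ.* E ℕ.+ E ℕ.* w′           ∎))
        where
        open ℕₚ.≤-Reasoning
        w′≤w : w′ ℕ.≤ w
        w′≤w = ℕₚ.*-cancelˡ-≤ E (ℕₚ.≤-trans le (ℕₚ.*-monoˡ-≤ w (ℕₚ.n≤1+n e)))

      advance-decreasing : ∀ r ι c → weight (advance r ι) c ℕ.≤ weight ι c
      advance-decreasing r ι c with representative c
      ... | no  _       = z≤n
      ... | yes (i , _) with next-weight i r (state ι i) (valid ι i)
      ...   | inj₁ eq = ℕₚ.≤-reflexive (≡.cong stateWeight eq)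
      ...   | inj₂ le = proj₁ (shrink _ _ le)

      d₂ : Point → Point → ℝ
      d₂ = d R H

      relocation : ℝ
      relocation = fromℕ E * short

      advance-relocate : ∀ r r₀ ι c → (∀ i → Recent r₀ (state ι i)) →
        fromℕ (weight (advance r ι) c) * d₂ (position r₀ ι c) (position r (advance r ι) c)
          ≤ fromℕ (weight ι c ℕ.∸ weight (advance r ι) c) * relocation
      advance-relocate r r₀ ι c recent with representative c
      ... | no  _       = ≤-reflexive (≈-trans (zeroˡ _) (≈-sym (zeroˡ _)))
      ... | yes (i , _) = relocate (state ι i) (valid ι i) (recent i)
        where
        reloc≥0 : ∀ k → 0# ≤ fromℕ k * relocation
        reloc≥0 k = 0≤* (fromℕ-nonneg k) (0≤* (fromℕ-nonneg E) (<⇒≤ short>0))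
        relocate : ∀ s → Valid (face i) s → Recent r₀ s → let s′ = next (face i) r s in
          fromℕ (stateWeight s′) * d₂ (statePosition r₀ i s) (statePosition r i s′)
            ≤ fromℕ (stateWeight s ℕ.∸ stateWeight s′) * relocation
        relocate dead _ _ = ≤-reflexive (≈-trans (zeroˡ _) (≈-sym (zeroˡ _)))
        relocate (alive q S) v@(_ , f) r₀∈S
          with next (face i) r (alive q S) in eq | next-valid (face i) r (alive q S) v | next-recent (face i) r (alive q S)
             | next-weight i r (alive q S) v
        ... | dead | _ | _ | _ = ≤-trans (≤-reflexive (zeroˡ _)) (reloc≥0 (geometric (age q S)))
        ... | alive q′ S′ | _ , f′ | r∈S′ | inj₁ ≡.refl
          rewrite statePosition-alive r₀ i q S f r₀∈S | statePosition-alive r i q S f r∈S′ =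
            ≤-trans (≤-reflexive (≈-trans (*-congˡ (distance-refl t (i , home i S f))) (zeroʳ _))) (reloc≥0 (geometric (age q S) ℕ.∸ geometric (age q S)))
        ... | alive q′ S′ | _ , f′ | r∈S′ | inj₂ le
          rewrite statePosition-alive r₀ i q S f r₀∈S | statePosition-alive r i q′ S′ f′ r∈S′ =
            ≤-trans (*-monoʳ-≤ (fromℕ-nonneg w′) (distance-sibling t i (home i S f) (home i S′ f′)))
              (≤-trans (*-monoˡ-≤ (<⇒≤ short>0) (fromℕ-mono-≤ (proj₂ (shrink w w′ le))))
                (≤-reflexive (≈-trans (*-congʳ (fromℕ-* (w ℕ.∸ w′) E)) (*-assoc _ _ _))))
          where
          w  = geometric (age q S)
          w′ = geometric (age q′ S′)

      -- A local move pays the one unit by which the debt can rise. A jump pays `D` units, and no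
      -- debt exceeds `D`, so arriving from another subtree is always paid for.
      advance-progress : ∀ r ι s x → member r x ≡ true →
        fromℕ (credit (advance r ι) x) * short ≤ fromℕ (credit ι s) * short + d₂ s x
      advance-progress r ι s x x∈r = compare (distance₂ t s x)
        where
        serves : ∀ {i z} → member r (i , z) ≡ true → Serves (face i) r (λ S → does (common? S (i , z)))
        serves {i} {z} x∈r = record
          { serves-face = λ S e → face-true {i} {S} {z} (holds (common? S (i , z)) e)
          ; serves-insert = λ S e → dec-true (common? (insert r S) (i , z)) λ r′ r′∈ →
              [ (λ { ≡.refl → x∈r }) , holds (common? S (i , z)) e r′ ]′ (∈-insert⁻ r S r′ r′∈)
          ; serves-singleton = dec-true (common? (singleton r) (i , z)) (singleton-common {r} {i , z} x∈r) }
        compare : ∀ {δ} → Distance t s x δ → fromℕ (credit (advance r ι) x) * short ≤ fromℕ (credit ι s) * short + δ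
        compare (same e) = ≤-trans (*-monoˡ-≤ (<⇒≤ short>0) (fromℕ-mono-≤
            (debt-stay (state ι (proj₁ x)) (serves x∈r)))) (x≤x+y (≤-reflexive (≈-sym e)))
        compare (sibling {i} {z} e) = ≤-trans (*-monoˡ-≤ (<⇒≤ short>0) (fromℕ-mono-≤
            (debt-local (state ι i) (λ S → does (common? S (i , z))) (serves x∈r))))
          (≤-reflexive (≈-trans (distribʳ short 1# _) (≈-trans (+-comm _ _) (+-congˡ (≈-trans (*-identityˡ short) (≈-sym e))))))
        compare (distant e) = ≤-trans (*-monoˡ-≤ (<⇒≤ short>0) (fromℕ-mono-≤
            (debt-≤ (state (advance r ι) (proj₁ x)) (valid (advance r ι) (proj₁ x)) _)))
          (≤-trans (≤-trans D-lower (≤-reflexive (≈-sym e)))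
            (≤-trans (x≤x+y (0≤* (fromℕ-nonneg (credit ι s)) (<⇒≤ short>0))) (≤-reflexive (+-comm _ _))))

      -- When the weights vanish, every leaf carries the full debt `D`: wherever the offline player
      -- is, it has paid for the phase.
      all-dead : ∀ r ι → continues r ι ≡ false → ∀ x → credit (advance r ι) x ≡ D
      all-dead r ι e x with state (advance r ι) (proj₁ x) in eq
      ... | dead      = ≡.refl
      ... | alive q S = ⊥-elim (alive-weight (advance r ι) {proj₁ x} (λ e′ → case ≡.trans (≡.sym eq) e′ of λ ())
          (ℕₚ.n≤0⇒n≡0 (ℕₚ.≤-trans (≤-total (weight (advance r ι)) (token x)) (ℕₚ.≤-reflexive (nonzero-false _ e)))))

      initial-mass : ∀ r → total (weight (advance r initialInfo)) ≡ 0
      initial-mass r = ℕₚ.n≤0⇒n≡0 (≡.subst (total (weight (advance r initialInfo)) ℕ.≤_) (ℕₚ.*-zeroʳ (T))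
        (total-≤ (weight (advance r initialInfo)) 0 zero-weight))
        where
        zero-weight : ∀ c → weight (advance r initialInfo) c ℕ.≤ 0
        zero-weight c with representative c
        ... | yes _ = z≤n
        ... | no  _ = z≤n

      initial-resets : ∀ r → continues r initialInfo ≡ false
      initial-resets r = ≡.cong nonzero (initial-mass r)

      scheme : Scheme
      scheme = record
        { tokens = T ; Info = Info ; initial = initialInfo ; step = step ; continues = continues
        ; weight = weight ; position = position ; token = token ; credit = credit
        ; diameter = long ; relocation = relocation ; unit = short ; y = y ; τ = τ ; span = D
        ; d≥0 = λ s x → proj₁ (distance-bounds (distance₂ t s x))
        ; d≤diameter = λ s x → proj₂ (distance-bounds (distance₂ t s x))
        ; diameter≥0 = ≤-trans (<⇒≤ short>0) short≤long
        ; relocation≥0 = 0≤* (fromℕ-nonneg E) (<⇒≤ short>0)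
        ; unit≥0 = <⇒≤ short>0
        ; initial-reset = initial-resets
        ; served = position-served
        ; token-position = token-step
        ; mass-lower = step-mass-lower
        ; mass-upper = λ r ι → mass-bound (step r ι)
        ; decreasing = λ r ι c e → ≡.subst (λ ι′ → weight ι′ c ℕ.≤ weight ι c) (≡.sym (step-continues r ι e))
            (advance-decreasing r ι c)
        ; relocate = λ r r₀ ι₀ c e → ≡.subst (λ ι′ → fromℕ (weight ι′ c) * d₂ (position r₀ (step r₀ ι₀) c) (position r ι′ c)
              ≤ fromℕ (weight (step r₀ ι₀) c ℕ.∸ weight ι′ c) * relocation) (≡.sym (step-continues r (step r₀ ι₀) e))
            (advance-relocate r r₀ (step r₀ ι₀) c (step-recent r₀ ι₀))
        ; progress = λ r ι s x x∈r e → ≡.subst (λ ι′ → fromℕ (credit ι′ x) * short ≤ fromℕ (credit ι s) * short + d₂ s x)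
            (≡.sym (step-continues r ι e)) (advance-progress r ι s x x∈r)
        ; progress-reset = λ r ι s x x∈r e → ≡.subst (λ k → fromℕ k * short ≤ fromℕ (credit ι s) * short + d₂ s x)
            (all-dead r ι e x) (advance-progress r ι s x x∈r)
        ; credit-reset = λ r ι x x∈r e → ≡.trans (≡.cong (λ ι′ → credit ι′ x) (step-reset r ι e)) (reset-credit r x x∈r)
        }
        where
        position-served : ∀ r ι c → member r (position r ι c) ≡ true
        position-served r ι c with representative c
        ... | yes (i , _) = statePosition-served r i (state ι i)
        ... | no  _       = proj₂ (nonEmpty r)
        reset-credit : ∀ r x → member r x ≡ true → credit (reset r) x ≡ 0
        reset-credit r (i , z) x∈r rewrite reset-alive r {i} {z} x∈r
          | dec-true (common? (singleton r) (i , z)) (singleton-common {r} {i , z} x∈r) = ≡.refl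

      -- The 5 is 3 + 2: `long` is at most 3 D short distances, and `relocation` is `E`, that is 2
      -- D, of them.
      ratio : ℕ
      ratio = 5 ℕ.* (2 ℕ.+ τ)

      ratio-suffices : (long + relocation) * fromℕ (2 ℕ.+ τ) ≤ fromℕ ratio * (fromℕ D * short)
      ratio-suffices = ≤-trans (*-monoˡ-≤ (fromℕ-nonneg (2 ℕ.+ τ)) move≤) (≤-reflexive
        (≈-trans (solve 4 (λ f D s z → (f :* (D :* s)) :* z := (f :* z) :* (D :* s)) ≈-refl
                   (fromℕ 5) (fromℕ D) short (fromℕ (2 ℕ.+ τ)))
          (*-congʳ (≈-sym (fromℕ-* 5 (2 ℕ.+ τ))))))
        where
        move≤ : long + relocation ≤ fromℕ 5 * (fromℕ D * short)
        move≤ = ≤-trans (+-monoˡ-≤ relocation D-upper) (≤-reflexive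
          (≈-trans (≈-sym (distribʳ short _ _)) (≈-trans (*-congʳ (≈-trans (≈-sym (fromℕ-+ (3 ℕ.* D) E))
            (≈-trans (fromℕ-cong (≡.trans (≡.cong (3 ℕ.* D ℕ.+_) E≡2D) (five D))) (fromℕ-* 5 D)))) (*-assoc _ _ _))))
          where
          five : ∀ D → 3 ℕ.* D ℕ.+ 2 ℕ.* D ≡ 5 ℕ.* D
          five = solve-∀

      upper : ∃[ A ] HasCompetitiveRatio R H K A (fromℕ ratio)
      upper = algorithm scheme , competitive scheme (fromℕ-nonneg ratio) ratio-suffices

    upper-bound : ∃[ A ] HasCompetitiveRatio R H K A (fromℕ (5 ℕ.* (2 ℕ.+ (2 ℕ.* (m C ⌈ m /2⌉) ℕ.+ m))))
    upper-bound = Tokens.upper (proj₁ integer-ratio) (proj₁ (proj₂ integer-ratio)) (proj₂ (proj₂ integer-ratio))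
      (3 ℕ.^ N) (2 ℕ.* N) (3^n≤2^[2n] N) (λ i → Hansel.encode (face i))
      λ i j → Hansel.encode-injective (face i) (face j) (face-downClosed i) (face-downClosed j)
      where
      N : ℕ
      N = m C ⌈ m /2⌉

-- Combining the two bounds

module Asymptotics (R : RealNumbers) where
  open Ordered R
  open Binomial
  open Layers

  middle-antichain : ∀ n {M} (M≡ : M ≡ central n) (i j : Fin M) → i ≢ j →
    ∃[ r ] lookup (choose n ⌈ n /2⌉ (Fin.cast M≡ i)) r ≡ true × lookup (choose n ⌈ n /2⌉ (Fin.cast M≡ j)) r ≡ false
  middle-antichain n ≡.refl i j i≢j = difference (pick i) (pick j)
    (ℕₚ.≤-reflexive (≡.trans (∣choose∣ n ⌈ n /2⌉ (Fin.cast ≡.refl j)) (≡.sym (∣choose∣ n ⌈ n /2⌉ (Fin.cast ≡.refl i)))))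
    λ e → i≢j (≡.trans (≡.sym (Finₚ.cast-is-id ≡.refl i))
      (≡.trans (choose-injective n ⌈ n /2⌉ _ _ e) (Finₚ.cast-is-id ≡.refl j)))
    where
    pick : Fin (central n) → Subset n
    pick i = choose n ⌈ n /2⌉ (Fin.cast ≡.refl i)

  lower-bound : ∀ n {c} → Ratios R 2 (2 ℕ.+ n) c → centralBinomial R n ≤ fromℕ 8 * c
  lower-bound n {c} ratios = ≡.subst (λ M → fromℕ M ≤ fromℕ 8 * c) M≡
    (HardInstance.ratio-lower R (λ i → choose n ⌈ n /2⌉ (Fin.cast M≡ i)) (middle-antichain n M≡) ratios)
    where
    M≡ : suc (ℕ.pred (central n)) ≡ central n
    M≡ = ℕₚ.suc-pred (central n) {{ℕ.>-nonZero (central-pos n)}}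

  upper-bound : ∀ m → Ratios R 2 m (fromℕ (5 ℕ.* (2 ℕ.+ (2 ℕ.* central m ℕ.+ m))))
  upper-bound m record { tree = node n t ; weight = w ; weight-pos = w>0 } K =
    UpperBound.Requests.upper-bound R t w w>0 K

  -- Two types are spent on the bits; passing from `m` - 2 to `m` costs a factor of 4, which
  -- multiplies the 8 of `lower-bound`.
  central≤32*ratio : ∀ m {c} → 2 ℕ.≤ m → Ratios R 2 m c → centralBinomial R m ≤ fromℕ 32 * c
  central≤32*ratio (suc (suc n)) {c} (s≤s (s≤s z≤n)) ratios = ≤-trans
    (fromℕ-mono-≤ (ℕₚ.≤-trans (central-suc-≤ (suc n)) (ℕₚ.*-monoʳ-≤ 2 (central-suc-≤ n))))
    (≤-trans (≤-reflexive (≈-trans (fromℕ-cong (≡.sym (ℕₚ.*-assoc 2 2 (central n)))) (fromℕ-* 4 (central n))))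
      (≤-trans (*-monoʳ-≤ (fromℕ-nonneg 4) (lower-bound n ratios))
        (≤-reflexive (≈-trans (≈-sym (*-assoc _ _ c)) (*-congʳ (≈-sym (fromℕ-* 4 8)))))))

  ratio≤30*central : ∀ m → ∃[ c ] Ratios R 2 m c × c ≤ fromℕ 30 * centralBinomial R m
  ratio≤30*central m = _ , upper-bound m , ≤-trans (fromℕ-mono-≤ bound) (≤-reflexive (fromℕ-* 30 (central m)))
    where
    N = central m
    expand : ∀ N → 5 ℕ.* (2 ℕ.* N ℕ.+ (2 ℕ.* N ℕ.+ 2 ℕ.* N)) ≡ 30 ℕ.* N
    expand = solve-∀
    bound : 5 ℕ.* (2 ℕ.+ (2 ℕ.* N ℕ.+ m)) ℕ.≤ 30 ℕ.* N
    bound = ℕₚ.≤-trans (ℕₚ.*-monoʳ-≤ 5 (ℕₚ.+-mono-≤ (ℕₚ.*-monoʳ-≤ 2 (central-pos m))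
      (ℕₚ.+-monoʳ-≤ (2 ℕ.* N) (m≤2*central m)))) (ℕₚ.≤-reflexive (expand N))

  -- Serves both functions of the theorem. The 64 is 2 times the 32 of `central≤32*ratio`, with the
  -- 2 from the comparison of `g` with the central coefficient.
  theta : ∀ (g : ℕ → ℝ) → (∀ m → 2 ℕ.≤ m → g m ≤ fromℕ 2 * centralBinomial R m) →
    (∀ m → 2 ℕ.≤ m → centralBinomial R m ≤ g m) → Inf_=Θ_ R (Ratios R 2) g
  theta g g≤ ≤g = recip 64>0 , fromℕ 30 , 2 , recip-pos 64>0 , fromℕ-pos 29 , λ m 2≤m →
    (λ {c} ratios → *-cancelˡ-≤ 64>0 (≤-trans (≤-reflexive (cancel (g m)))
      (≤-trans (g≤ m 2≤m) (≤-trans (*-monoʳ-≤ (fromℕ-nonneg 2) (central≤32*ratio m 2≤m ratios))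
        (≤-reflexive (≈-trans (≈-sym (*-assoc _ _ c)) (*-congʳ (≈-sym (fromℕ-* 2 32))))))))) ,
    λ bg<y → case ratio≤30*central m of λ (c , ratios , le) →
      c , ratios , ≤-<-trans (≤-trans le (*-monoʳ-≤ (fromℕ-nonneg 30) (≤g m 2≤m))) bg<y
    where
    64>0 = fromℕ-pos 63
    cancel : ∀ x → fromℕ 64 * (recip 64>0 * x) ≈ x
    cancel x = ≈-trans (≈-sym (*-assoc _ _ x)) (≈-trans (*-congʳ (recip-inverseʳ 64>0)) (*-identityˡ x))

  module _ (n : ℕ) where
    private
      m = suc n
      s>0 = √-pos (fromℕ-pos n)
      s = √ (fromℕ-pos n)

    s*2^m/√m : s * 2^m/√m R m ≈ fromℕ (2 ℕ.^ m)
    s*2^m/√m = ≈-trans (solve 3 (λ s p r → s :* (p :* r) := p :* (s :* r)) ≈-refl s (fromℕ (2 ℕ.^ m)) (recip s>0))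
      (≈-trans (*-congˡ (recip-inverseʳ s>0)) (*-identityʳ _))

    -- The root is accessible only through its square, so comparisons with 2 ^ m are made after
    -- squaring and reduce to `central-upper` and `central-lower`.
    square : ∀ k → (s * fromℕ k) * (s * fromℕ k) ≈ fromℕ (k ℕ.* k ℕ.* m)
    square k = ≈-trans (solve 2 (λ s k → (s :* k) :* (s :* k) := (k :* k) :* (s :* s)) ≈-refl s (fromℕ k))
      (≈-trans (*-cong (≈-sym (fromℕ-* k k)) (√-square (fromℕ-pos n))) (≈-sym (fromℕ-* (k ℕ.* k) m)))

    4^m : 2 ℕ.^ m ℕ.* 2 ℕ.^ m ≡ 4 ℕ.^ m
    4^m = ≡.trans (≡.sym (ℕₚ.^-distribˡ-+-* 2 m m)) (≡.trans (≡.cong (2 ℕ.^_) (double m)) (≡.sym (ℕₚ.^-*-assoc 2 2 m)))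
      where
      double : ∀ m → m ℕ.+ m ≡ 2 ℕ.* m
      double = solve-∀

    central≤2^m/√m : centralBinomial R m ≤ 2^m/√m R m
    central≤2^m/√m = *-cancelˡ-≤ s>0 (≤-trans (square-cancel-≤ (fromℕ-nonneg (2 ℕ.^ m))
      (≤-trans (≤-reflexive (square (central m))) (≤-trans (fromℕ-mono-≤ (central-upper m))
        (≤-reflexive (≈-trans (fromℕ-cong (≡.sym 4^m)) (fromℕ-* (2 ℕ.^ m) (2 ℕ.^ m)))))))
      (≤-reflexive (≈-sym s*2^m/√m)))

    2^m/√m≤2*central : 2^m/√m R m ≤ fromℕ 2 * centralBinomial R m
    2^m/√m≤2*central = *-cancelˡ-≤ s>0 (≤-trans (≤-reflexive s*2^m/√m) (≤-trans
      (square-cancel-≤ (0≤* (<⇒≤ s>0) (fromℕ-nonneg (2 ℕ.* N)))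
        (≤-trans (≤-reflexive (≈-trans (≈-sym (fromℕ-* (2 ℕ.^ m) (2 ℕ.^ m))) (fromℕ-cong 4^m)))
          (≤-trans (fromℕ-mono-≤ (ℕₚ.≤-trans (central-lower m (s≤s z≤n)) (ℕₚ.≤-reflexive (expand N m))))
            (≤-reflexive (≈-sym (square (2 ℕ.* N)))))))
      (≤-reflexive (*-congˡ (fromℕ-* 2 N)))))
      where
      N = central m
      expand : ∀ N m → 4 ℕ.* (N ℕ.* N ℕ.* m) ≡ 2 ℕ.* N ℕ.* (2 ℕ.* N) ℕ.* m
      expand = solve-∀

theorem1p3 : (R : RealNumbers) → (Inf_=Θ_ R (Ratios R 2) (centralBinomial R)) × (Inf_=Θ_ R (Ratios R 2) (2^m/√m R))
theorem1p3 R = theta (centralBinomial R) (λ m _ → central≤2*central m) (λ _ _ → ≤-refl)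
             , theta (2^m/√m R) (λ { (suc n) _ → 2^m/√m≤2*central n }) (λ { (suc n) _ → central≤2^m/√m n })
  where
  open Ordered R
  open Asymptotics R
  open Binomial
  central≤2*central : ∀ m → centralBinomial R m ≤ fromℕ 2 * centralBinomial R m
  central≤2*central m = ≤-trans (fromℕ-mono-≤ (ℕₚ.m≤m+n (central m) _)) (≤-reflexive (fromℕ-* 2 (central m)))
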